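{- Let $n(g)$ denote the number of numerical semigroups of genus $g$, and let $\omega=\frac{1+\sqrt5}{2}$. For $g\ge 3$ let $\tilde c_g$ be the number of numerical semigroups $S$ of genus $g$ whose Frobenius number $f$ and multiplicity $m$ satisfy $f=3m-1$, and put $\tilde C(q)=\sum_{g\ge3}\tilde c_g q^g$. Then the power series $\tilde C(q)$ has radius of convergence strictly larger than $\omega^{ -1}$, and $$\lim_{g\to\infty}\frac{n(g)}{\omega^g}=C,\qquad C=\frac{5+\sqrt5}{10}\bigl(1+\tilde C(\omega^{ -1})\bigr).$$
   Context: A numerical semigroup is a submonoid $S$ of $(\mathbb N,+)$ (so $0\in S$, $S+S\subseteq S$) with $\mathbb N\setminus S$ finite. Its genus is $g=\#(\mathbb N\setminus S)$, its multiplicity is $m=\min(S\setminus\{0\})$, and its Frobenius number is $f=\max(\mathbb N\setminus S)$. -}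

module Defs where

open import Level using (Level; 0ℓ; _⊔_) renaming (suc to lsuc)
open import Data.Empty using (⊥-elim)
open import Data.Fin.Base as Fin using (Fin)
import Data.Fin.Properties as Fin
open import Data.List.Base using (List; []; _∷_; length; lookup; upTo; concatMap; map; deduplicate)
open import Data.List.Membership.Propositional using () renaming (_∈_ to _∈ₗ_; _∉_ to _∉ₗ_)
open import Data.List.Membership.Propositional.Properties using (∈-upTo⁺)
open import Data.List.Membership.DecPropositional using () renaming (_∈?_ to mem)
import Data.List.Membership.Setoid.Properties as SetoidMembershipₚ
import Data.List.Relation.Unary.All as All
import Data.List.Relation.Unary.Any as Any
import Data.List.Relation.Unary.Any.Properties as Anyₚ
import Data.List.Relation.Unary.AllPairs as AllPairs
open import Data.List.Relation.Unary.Any using (here; there)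
open import Data.List.Relation.Unary.Enumerates.Setoid using (IsEnumeration)
import Data.List.Relation.Unary.Enumerates.Setoid.Properties as Enumₚ
open import Data.List.Relation.Unary.Unique.Propositional using (Unique)
import Data.List.Relation.Unary.Unique.DecPropositional as UniqueDec
import Data.List.Relation.Unary.Unique.Setoid as SetoidUnique
import Data.List.Relation.Unary.Unique.DecSetoid.Properties as UniqueDecₚ
open import Data.Nat.Base as ℕ using (ℕ; zero; suc)
import Data.Nat.Properties as ℕ
open import Data.Product.Base using (Σ; Σ-syntax; ∃; ∃-syntax; _×_; _,_; proj₁; proj₂)
open import Data.Sum.Base using (_⊎_; inj₁; inj₂)
open import Function.Base using (_∘_; _on_)
open import Function.Bundles using (Bijection; _⇔_; Equivalence; mk⇔)
open import Relation.Binary.Bundles using (Setoid; DecSetoid)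
open import Relation.Binary.PropositionalEquality as ≡ using (_≡_; _≢_; refl; sym; trans; cong; cong₂; subst)
open import Relation.Nullary.Decidable.Core using (Dec; yes; no; ¬?; _×-dec_; _⊎-dec_; map′; decidable-stable)
open import Relation.Nullary.Negation.Core using (¬_; contradiction)
open import Relation.Unary using (Pred; Decidable; _∈_; _∉_; _⊆_; _≐_)
open import Data.Integer.Base as ℤ using (ℤ)
import Data.Integer.Properties as ℤ
open import Data.Rational.Base as ℚ using (ℚ; 0ℚ; 1ℚ; ½; mkℚ)
import Data.Rational.Properties as ℚ
import Data.Rational.Unnormalised.Base as ℚᵘ
import Data.Rational.Unnormalised.Properties as ℚᵘ
open import Data.Rational.Solver using (module +-*-Solver)

Finite : ∀ {a ℓ} → Setoid a ℓ → Set (a ⊔ ℓ)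
Finite X = ∃[ k ] Bijection (≡.setoid (Fin k)) X

card : ∀ {a ℓ} {X : Setoid a ℓ} → Finite X → ℕ
card = proj₁

enumeration⇒finite : ∀ {a ℓ} (D : DecSetoid a ℓ) (xs : List (DecSetoid.Carrier D)) →
                     IsEnumeration (DecSetoid.setoid D) xs → Finite (DecSetoid.setoid D)
enumeration⇒finite D xs enum = length ys , record
  { to        = lookup ys
  ; cong      = λ { refl → D.refl }
  ; bijective = inj ys (UniqueDecₚ.deduplicate-! D xs)
              , Enumₚ.lookup-surjective D.setoid (Enumₚ.deduplicate⁺ D enum)
  }
  where
  module D = DecSetoid D
  open SetoidUnique D.setoid using () renaming (Unique to Uniqueₛ)
  ys = deduplicate D._≟_ xs
  fresh : ∀ {z} zs → All.All (λ u → ¬ (z D.≈ u)) zs → ∀ j → ¬ (z D.≈ lookup zs j)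
  fresh (_ ∷ _)  (q All.∷ _)  Fin.zero    = q
  fresh (_ ∷ zs) (_ All.∷ qs) (Fin.suc j) = fresh zs qs j
  inj : ∀ zs → Uniqueₛ zs → ∀ {i j} → lookup zs i D.≈ lookup zs j → i ≡ j
  inj (z ∷ zs) (p AllPairs.∷ ps) {Fin.zero}  {Fin.zero}  _ = refl
  inj (z ∷ zs) (p AllPairs.∷ ps) {Fin.zero}  {Fin.suc j} e = ⊥-elim (fresh zs p j e)
  inj (z ∷ zs) (p AllPairs.∷ ps) {Fin.suc i} {Fin.zero}  e = ⊥-elim (fresh zs p i (D.sym e))
  inj (z ∷ zs) (p AllPairs.∷ ps) {Fin.suc i} {Fin.suc j} e = cong Fin.suc (inj zs ps e)

-- Finiteness of the complement is witnessed by a duplicate-free list of the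
-- gaps.  The list order is not part of the semigroup: equality below is
-- equality of the underlying subsets of ℕ.

record NumericalSemigroup : Set₁ where
  field
    carrier     : Pred ℕ 0ℓ
    carrier?    : Decidable carrier
    0∈carrier   : 0 ∈ carrier
    +-closed    : ∀ {a b} → a ∈ carrier → b ∈ carrier → a ℕ.+ b ∈ carrier
    gaps        : List ℕ
    gaps-unique : Unique gaps
    gaps-spec   : ∀ x → (x ∈ₗ gaps) ⇔ (x ∉ carrier)

  genus : ℕ
  genus = length gaps

open NumericalSemigroup using (carrier; genus)

infix 4 _≋_

_≋_ : NumericalSemigroup → NumericalSemigroup → Set
S ≋ T = carrier S ≐ carrier T

IsMultiplicity : NumericalSemigroup → ℕ → Set
IsMultiplicity S m = (m ∈ carrier S × m ≢ 0) × (∀ x → x ∈ carrier S → x ≢ 0 → m ℕ.≤ x)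

IsFrobenius : NumericalSemigroup → ℕ → Set
IsFrobenius S f = f ∉ carrier S × (∀ x → x ∉ carrier S → x ℕ.≤ f)

-- There is no truncation in 3m ∸ 1, since m ≥ 1.
F≡3m-1 : NumericalSemigroup → Set
F≡3m-1 S = ∃[ f ] ∃[ m ] IsFrobenius S f × IsMultiplicity S m × f ≡ 3 ℕ.* m ℕ.∸ 1

SemigroupsWith : ∀ {ℓ} → Pred NumericalSemigroup ℓ → Setoid (lsuc 0ℓ ⊔ ℓ) 0ℓ
SemigroupsWith P = record
  { Carrier       = Σ NumericalSemigroup P
  ; _≈_           = _≋_ on proj₁
  ; isEquivalence = record
    { refl  = (λ x → x) , (λ x → x)
    ; sym   = λ (p , q) → q , p
    ; trans = λ (p , q) (p′ , q′) → (λ x → p′ (p x)) , (λ x → q (q′ x))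
    }
  }

module GapLists where

  _∈?_ : ∀ (x : ℕ) xs → Dec (x ∈ₗ xs)
  _∈?_ = mem ℕ._≟_

  module _ (S : NumericalSemigroup) where
    open NumericalSemigroup S hiding (carrier; genus)

    gap⇒∉ : ∀ {x} → x ∈ₗ gaps → x ∉ carrier S
    gap⇒∉ {x} = Equivalence.to (gaps-spec x)

    ∉⇒gap : ∀ {x} → x ∉ carrier S → x ∈ₗ gaps
    ∉⇒gap {x} = Equivalence.from (gaps-spec x)

    ¬gap⇒∈ : ∀ {x} → x ∉ₗ gaps → x ∈ carrier S
    ¬gap⇒∈ {x} ¬g = decidable-stable (carrier? x) (λ x∉ → ¬g (∉⇒gap x∉))

    split : ∀ {a c} → a ℕ.≤ c → c ∈ₗ gaps → a ∈ₗ gaps ⊎ (c ℕ.∸ a) ∈ₗ gaps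
    split {a} {c} a≤c c∈ with a ∈? gaps | (c ℕ.∸ a) ∈? gaps
    ... | yes p | _     = inj₁ p
    ... | no _  | yes q = inj₂ q
    ... | no p  | no q  = contradiction
      (subst (_∈ carrier S) (ℕ.m+[n∸m]≡n a≤c) (+-closed (¬gap⇒∈ p) (¬gap⇒∈ q))) (gap⇒∉ c∈)

    -- For a gap c, every pair (i , c - i) contains a gap, so c has at least
    -- c/2 gaps below it.
    gap<2g : ∀ {c} → c ∈ₗ gaps → c ℕ.< 2 ℕ.* genus S
    gap<2g {c} c∈ with c ℕ.<? 2 ℕ.* genus S
    ... | yes p = p
    ... | no  p = contradiction (Fin.injective⇒≤ {f = pick} pick-inj) ℕ.1+n≰n
      where
      g = genus S
      2g≤c : 2 ℕ.* g ℕ.≤ c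
      2g≤c = ℕ.≮⇒≥ p
      g+g≤c : g ℕ.+ g ℕ.≤ c
      g+g≤c = subst (λ t → g ℕ.+ t ℕ.≤ c) (ℕ.+-identityʳ g) 2g≤c
      i≤g : (i : Fin (suc g)) → Fin.toℕ i ℕ.≤ g
      i≤g i = ℕ.s≤s⁻¹ (Fin.toℕ<n i)
      i≤c : (i : Fin (suc g)) → Fin.toℕ i ℕ.≤ c
      i≤c i = ℕ.≤-trans (i≤g i) (ℕ.≤-trans (ℕ.m≤m+n g g) g+g≤c)
      Choice : Fin (suc g) → Set
      Choice i = Fin.toℕ i ∈ₗ gaps ⊎ (c ℕ.∸ Fin.toℕ i) ∈ₗ gaps
      idx : (i : Fin (suc g)) → Choice i → Fin g
      idx i (inj₁ m) = Any.index m
      idx i (inj₂ m) = Any.index m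
      choice : ∀ i → Choice i
      choice i = split (i≤c i) c∈
      pick : Fin (suc g) → Fin g
      pick i = idx i (choice i)
      ii : ∀ {x y} (a : x ∈ₗ gaps) (b : y ∈ₗ gaps) → Any.index a ≡ Any.index b → x ≡ y
      ii = SetoidMembershipₚ.index-injective (≡.setoid ℕ)
      cross : ∀ (i j : Fin (suc g)) → Fin.toℕ i ≡ c ℕ.∸ Fin.toℕ j → i ≡ j
      cross i j e = Fin.toℕ-injective (trans i≡g (sym j≡g))
        where
        i+j≡c : Fin.toℕ i ℕ.+ Fin.toℕ j ≡ c
        i+j≡c = trans (cong (ℕ._+ Fin.toℕ j) e) (ℕ.m∸n+n≡m (i≤c j))
        g+g≤i+j : g ℕ.+ g ℕ.≤ Fin.toℕ i ℕ.+ Fin.toℕ j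
        g+g≤i+j = subst (g ℕ.+ g ℕ.≤_) (sym i+j≡c) g+g≤c
        i≡g : Fin.toℕ i ≡ g
        i≡g = ℕ.≤-antisym (i≤g i) (ℕ.+-cancelʳ-≤ g g (Fin.toℕ i) (ℕ.≤-trans g+g≤i+j (ℕ.+-monoʳ-≤ (Fin.toℕ i) (i≤g j))))
        j≡g : Fin.toℕ j ≡ g
        j≡g = ℕ.≤-antisym (i≤g j) (ℕ.+-cancelˡ-≤ g g (Fin.toℕ j) (ℕ.≤-trans g+g≤i+j (ℕ.+-monoˡ-≤ (Fin.toℕ j) (i≤g i))))
      idx-inj : ∀ i j (a : Choice i) (b : Choice j) → idx i a ≡ idx j b → i ≡ j
      idx-inj i j (inj₁ a) (inj₁ b) e = Fin.toℕ-injective (ii a b e)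
      idx-inj i j (inj₁ a) (inj₂ b) e = cross i j (ii a b e)
      idx-inj i j (inj₂ a) (inj₁ b) e = sym (cross j i (sym (ii a b e)))
      idx-inj i j (inj₂ a) (inj₂ b) e = Fin.toℕ-injective (ℕ.∸-cancelˡ-≡ (i≤c i) (i≤c j) (ii a b e))
      pick-inj : ∀ {i j} → pick i ≡ pick j → i ≡ j
      pick-inj {i} {j} = idx-inj i j (choice i) (choice j)

  IsGapList : List ℕ → Set
  IsGapList gs = Unique gs × 0 ∉ₗ gs ×
    All.All (λ c → ∀ {a} → a ℕ.< suc c → a ∈ₗ gs ⊎ (c ℕ.∸ a) ∈ₗ gs) gs

  isGapList? : ∀ gs → Dec (IsGapList gs)
  isGapList? gs = UniqueDec.unique? ℕ._≟_ gs ×-dec ¬? (0 ∈? gs) ×-dec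
    All.all? (λ c → ℕ.allUpTo? (λ a → (a ∈? gs) ⊎-dec ((c ℕ.∸ a) ∈? gs)) (suc c)) gs

  fromGaps : ∀ gs → IsGapList gs → NumericalSemigroup
  fromGaps gs (uniq , 0∉ , closed) = record
    { carrier     = _∉ₗ gs
    ; carrier?    = λ x → ¬? (x ∈? gs)
    ; 0∈carrier   = 0∉
    ; +-closed    = λ {a} {b} a∉ b∉ a+b∈ → case (All.lookup closed a+b∈ (ℕ.s≤s (ℕ.m≤m+n a b))) a∉ b∉
    ; gaps        = gs
    ; gaps-unique = uniq
    ; gaps-spec   = λ x → mk⇔ contradiction (decidable-stable (x ∈? gs))
    }
    where
    case : ∀ {a b} → a ∈ₗ gs ⊎ (a ℕ.+ b ℕ.∸ a) ∈ₗ gs → a ∉ₗ gs → ¬ (b ∉ₗ gs)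
    case (inj₁ a∈) a∉ _ = a∉ a∈
    case {a} {b} (inj₂ b∈) _ b∉ = b∉ (subst (_∈ₗ gs) (ℕ.m+n∸m≡n a b) b∈)

  gaps-isGapList : ∀ S → IsGapList (NumericalSemigroup.gaps S)
  gaps-isGapList S = S.gaps-unique , (λ 0∈ → gap⇒∉ S 0∈ S.0∈carrier) ,
    All.tabulate (λ c∈ a<1+c → split S (ℕ.s≤s⁻¹ a<1+c) c∈)
    where module S = NumericalSemigroup S

  ≋-fromGaps : ∀ S (q : IsGapList (NumericalSemigroup.gaps S)) → S ≋ fromGaps _ q
  ≋-fromGaps S q = (λ x∈ x∈gaps → gap⇒∉ S x∈gaps x∈) , ¬gap⇒∈ S

  _≋?_ : ∀ S T → Dec (S ≋ T)
  S ≋? T = map′ (λ (p , q) → incl S T p , incl T S q) (λ (p , q) → lcni S T p , lcni T S q)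
    (All.all? (_∈? S.gaps) T.gaps ×-dec All.all? (_∈? T.gaps) S.gaps)
    where
    module S = NumericalSemigroup S
    module T = NumericalSemigroup T
    incl : ∀ S T → All.All (_∈ₗ NumericalSemigroup.gaps S) (NumericalSemigroup.gaps T) → carrier S ⊆ carrier T
    incl S T p x∈S = ¬gap⇒∈ T (λ x∈gT → gap⇒∉ S (All.lookup p x∈gT) x∈S)
    lcni : ∀ S T → carrier S ⊆ carrier T → All.All (_∈ₗ NumericalSemigroup.gaps S) (NumericalSemigroup.gaps T)
    lcni S T p = All.tabulate (λ x∈gT → ∉⇒gap S (λ x∈S → gap⇒∉ T x∈gT (p x∈S)))

  decSetoid : ∀ {ℓ} (P : Pred NumericalSemigroup ℓ) → DecSetoid (lsuc 0ℓ ⊔ ℓ) 0ℓ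
  decSetoid P = record
    { isDecEquivalence = record
      { isEquivalence = Setoid.isEquivalence (SemigroupsWith P)
      ; _≟_           = λ S T → proj₁ S ≋? proj₁ T
      }
    }

  words : ℕ → ℕ → List (List ℕ)
  words b zero    = [] ∷ []
  words b (suc k) = concatMap (λ x → map (x ∷_) (words b k)) (upTo b)

  ∈-words : ∀ b gs → All.All (ℕ._< b) gs → gs ∈ₗ words b (length gs)
  ∈-words b []       _               = here refl
  ∈-words b (x ∷ gs) (p All.∷ ps) =
    Anyₚ.concatMap⁺ (λ x → map (x ∷_) (words b (length gs)))
      (Any.map (λ { refl → Anyₚ.map⁺ (Any.map (cong (x ∷_)) (∈-words b gs ps)) }) (∈-upTo⁺ p))

open GapLists

finite-of-genus : ∀ {ℓ} (P : Pred NumericalSemigroup ℓ) → Decidable P →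
                  (∀ {S T} → S ≋ T → genus S ≡ genus T → P S → P T) →
                  ∀ g → (∀ {S} → P S → genus S ≡ g) → Finite (SemigroupsWith P)
finite-of-genus P P? resp g P⇒g = enumeration⇒finite (decSetoid P) (concatMap build candidates) enum
  where
  X : Setoid _ _
  X = SemigroupsWith P

  candidates : List (List ℕ)
  candidates = words (2 ℕ.* g) g

  build₁ : ∀ gs (q : IsGapList gs) → Dec (P (fromGaps gs q)) → List (Setoid.Carrier X)
  build₁ gs q (yes r) = (fromGaps gs q , r) ∷ []
  build₁ gs q (no _)  = []

  build₂ : ∀ gs → Dec (IsGapList gs) → List (Setoid.Carrier X)
  build₂ gs (yes q) = build₁ gs q (P? (fromGaps gs q))
  build₂ gs (no _)  = []

  build : List ℕ → List (Setoid.Carrier X)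
  build gs = build₂ gs (isGapList? gs)

  built : ∀ (x : Setoid.Carrier X) → Any.Any (Setoid._≈_ X x) (build (NumericalSemigroup.gaps (proj₁ x)))
  built x@(S , pS) = go₂ (isGapList? gs)
    where
    gs = NumericalSemigroup.gaps S
    go₁ : ∀ q d → Any.Any (Setoid._≈_ X x) (build₁ gs q d)
    go₁ q (yes r) = here (≋-fromGaps S q)
    go₁ q (no ¬r) = contradiction (resp (≋-fromGaps S q) refl pS) ¬r
    go₂ : ∀ d → Any.Any (Setoid._≈_ X x) (build₂ gs d)
    go₂ (yes q) = go₁ q (P? (fromGaps gs q))
    go₂ (no ¬q) = contradiction (gaps-isGapList S) ¬q

  candidate : ∀ S → genus S ≡ g → NumericalSemigroup.gaps S ∈ₗ candidates
  candidate S refl = ∈-words _ _ (All.tabulate (gap<2g S))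

  enum : IsEnumeration X (concatMap build candidates)
  enum x@(S , pS) = Anyₚ.concatMap⁺ build
    (Any.map (λ { refl → built x }) (candidate S (P⇒g pS)))

module Decisions where

  isMultiplicity? : ∀ S m → Dec (IsMultiplicity S m)
  isMultiplicity? S m = (carrier? m ×-dec ¬? (m ℕ.≟ 0)) ×-dec
    map′ to from (ℕ.allUpTo? (λ x → ¬? (carrier? x ×-dec ¬? (x ℕ.≟ 0))) m)
    where
    open NumericalSemigroup S using (carrier?)
    None<m : Set
    None<m = ∀ {x} → x ℕ.< m → ¬ (x ∈ carrier S × x ≢ 0)
    to : None<m → ∀ x → x ∈ carrier S → x ≢ 0 → m ℕ.≤ x
    to h x x∈ x≢0 = ℕ.≮⇒≥ (λ x<m → h x<m (x∈ , x≢0))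
    from : (∀ x → x ∈ carrier S → x ≢ 0 → m ℕ.≤ x) → None<m
    from h x<m (x∈ , x≢0) = ℕ.<⇒≱ x<m (h _ x∈ x≢0)

  isFrobenius? : ∀ S f → Dec (IsFrobenius S f)
  isFrobenius? S f = ¬? (carrier? f) ×-dec
    map′ (λ h x x∉ → All.lookup h (∉⇒gap S x∉)) (λ h → All.tabulate (λ {x} x∈ → h x (gap⇒∉ S x∈)))
         (All.all? (ℕ._≤? f) gaps)
    where open NumericalSemigroup S using (carrier?; gaps)

  F≡3m-1? : Decidable F≡3m-1
  F≡3m-1? S = map′ to from (Any.any? (λ f → ℕ.anyUpTo? (λ m →
      isFrobenius? S f ×-dec isMultiplicity? S m ×-dec (f ℕ.≟ 3 ℕ.* m ℕ.∸ 1)) (2 ℕ.+ f)) gaps)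
    where
    open NumericalSemigroup S using (gaps)
    Q : ℕ → Set
    Q f = ∃[ m ] m ℕ.< 2 ℕ.+ f × IsFrobenius S f × IsMultiplicity S m × f ≡ 3 ℕ.* m ℕ.∸ 1
    to : Any.Any Q gaps → F≡3m-1 S
    to p = let (f , m , _ , r) = Any.satisfied p in f , m , r
    from : F≡3m-1 S → Any.Any Q gaps
    from (f , m , (f∉ , fmax) , rest , e) =
      Any.map (λ { refl → m , m<2+f , (f∉ , fmax) , rest , e }) (∉⇒gap S f∉)
      where
      m<2+f : m ℕ.< 2 ℕ.+ f
      m<2+f = ℕ.s≤s (ℕ.≤-trans (ℕ.m≤n*m m 3) (ℕ.≤-trans (ℕ.m≤n+m∸n (3 ℕ.* m) 1) (ℕ.≤-reflexive (cong suc (sym e)))))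

  F≡3m-1-resp : ∀ {S T} → S ≋ T → F≡3m-1 S → F≡3m-1 T
  F≡3m-1-resp (p , q) (f , m , (f∉ , fmax) , ((m∈ , m≢0) , mmin) , e) =
    f , m , (f∉ ∘ q , λ x x∉ → fmax x (x∉ ∘ p)) , ((p m∈ , m≢0) , λ x x∈ → mmin x (q x∈)) , e

open Decisions

genus-finite : ∀ g → Finite (SemigroupsWith (λ S → genus S ≡ g))
genus-finite g = finite-of-genus _ (λ S → genus S ℕ.≟ g) (λ _ e p → trans (sym e) p) g (λ p → p)

genus∧F≡3m-1-finite : ∀ g → Finite (SemigroupsWith (λ S → genus S ≡ g × F≡3m-1 S))
genus∧F≡3m-1-finite g = finite-of-genus _ (λ S → (genus S ℕ.≟ g) ×-dec F≡3m-1? S)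
  (λ {S} {T} S≋T e (p , q) → trans (sym e) p , F≡3m-1-resp {S} {T} S≋T q) g proj₁

n : ℕ → ℕ
n g = card (genus-finite g)

c̃ : ℕ → ℕ
c̃ g = card (genus∧F≡3m-1-finite g)

module RationalLemmas where

  ‖_‖ : ℚ → ℚ
  ‖_‖ = ℚ.∣_∣

  ℚ<⇒≱ : ∀ {p q} → p ℚ.< q → ¬ (q ℚ.≤ p)
  ℚ<⇒≱ p<q q≤p = ℚ.<-irrefl refl (ℚ.<-≤-trans p<q q≤p)

  half+half : ∀ ε → ε ℚ.* ½ ℚ.+ ε ℚ.* ½ ≡ ε
  half+half ε = trans (sym (ℚ.*-distribˡ-+ ε ½ ½)) (ℚ.*-identityʳ ε)

  pos* : ∀ {p q} → 0ℚ ℚ.< p → 0ℚ ℚ.< q → 0ℚ ℚ.< p ℚ.* q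
  pos* {p} {q} 0<p 0<q = ℚ.positive⁻¹ (p ℚ.* q) {{ℚ.pos*pos⇒pos p {{ℚ.positive 0<p}} q {{ℚ.positive 0<q}}}}

  half-pos : ∀ {ε} → 0ℚ ℚ.< ε → 0ℚ ℚ.< ε ℚ.* ½
  half-pos 0<ε = pos* 0<ε (ℚ.positive⁻¹ ½)

  p≤‖p‖ : ∀ p → p ℚ.≤ ‖ p ‖
  p≤‖p‖ p with ℚ.≤-total 0ℚ p
  ... | inj₁ 0≤p = ℚ.≤-reflexive (sym (ℚ.0≤p⇒∣p∣≡p 0≤p))
  ... | inj₂ p≤0 = ℚ.≤-trans p≤0 (ℚ.0≤∣p∣ p)

  ‖-‖-swap : ∀ p q → ‖ p ℚ.- q ‖ ≡ ‖ q ℚ.- p ‖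
  ‖-‖-swap p q = trans (sym (ℚ.∣-p∣≡∣p∣ (p ℚ.- q)))
    (cong ‖_‖ (solve 2 (λ a b → :- (a :- b) := b :- a) refl p q))
    where open +-*-Solver

  ‖p‖<ε : ∀ {p ε} → p ℚ.< ε → ℚ.- p ℚ.< ε → ‖ p ‖ ℚ.< ε
  ‖p‖<ε {p} {ε} a b with ℚ.∣p∣≡p∨∣p∣≡-p p
  ... | inj₁ e = subst (ℚ._< ε) (sym e) a
  ... | inj₂ e = subst (ℚ._< ε) (sym e) b

  ‖p‖≤‖q‖+‖p-q‖ : ∀ p q → ‖ p ‖ ℚ.≤ ‖ q ‖ ℚ.+ ‖ p ℚ.- q ‖
  ‖p‖≤‖q‖+‖p-q‖ p q = subst (λ t → ‖ t ‖ ℚ.≤ ‖ q ‖ ℚ.+ ‖ p ℚ.- q ‖)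
    (solve 2 (λ a b → b :+ (a :- b) := a) refl p q) (ℚ.∣p+q∣≤∣p∣+∣q∣ q (p ℚ.- q))
    where open +-*-Solver

  p-q≤r : ∀ {p q r} → p ℚ.≤ q ℚ.+ r → p ℚ.- q ℚ.≤ r
  p-q≤r {p} {q} {r} h = subst (p ℚ.- q ℚ.≤_) (solve 2 (λ a b → a :+ b :- a := b) refl q r) (ℚ.+-monoˡ-≤ (ℚ.- q) h)
    where open +-*-Solver

  p-q<r : ∀ {p q r} → p ℚ.< q ℚ.+ r → p ℚ.- q ℚ.< r
  p-q<r {p} {q} {r} h = subst (p ℚ.- q ℚ.<_) (solve 2 (λ a b → a :+ b :- a := b) refl q r) (ℚ.+-monoˡ-< (ℚ.- q) h)
    where open +-*-Solver

  neg-diff : ∀ p q → ℚ.- (p ℚ.- q) ≡ q ℚ.- p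
  neg-diff p q = solve 2 (λ a b → :- (a :- b) := b :- a) refl p q
    where open +-*-Solver

  ‖‖-‖‖ : ∀ p q → ‖ ‖ p ‖ ℚ.- ‖ q ‖ ‖ ℚ.≤ ‖ p ℚ.- q ‖
  ‖‖-‖‖ p q with ℚ.∣p∣≡p∨∣p∣≡-p (‖ p ‖ ℚ.- ‖ q ‖)
  ... | inj₁ e = subst (ℚ._≤ ‖ p ℚ.- q ‖) (sym e) (p-q≤r {‖ p ‖} {‖ q ‖} (‖p‖≤‖q‖+‖p-q‖ p q))
  ... | inj₂ e = subst (ℚ._≤ ‖ p ℚ.- q ‖) (sym (trans e (neg-diff ‖ p ‖ ‖ q ‖)))
                   (p-q≤r {‖ q ‖} {‖ p ‖} (subst (λ t → ‖ q ‖ ℚ.≤ ‖ p ‖ ℚ.+ t) (‖-‖-swap q p) (‖p‖≤‖q‖+‖p-q‖ q p)))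

  ‖p+q‖<ε : ∀ {p q ε} → ‖ p ‖ ℚ.< ε ℚ.* ½ → ‖ q ‖ ℚ.< ε ℚ.* ½ → ‖ p ℚ.+ q ‖ ℚ.< ε
  ‖p+q‖<ε {p} {q} {ε} a b = ℚ.≤-<-trans (ℚ.∣p+q∣≤∣p∣+∣q∣ p q) (subst (_ ℚ.<_) (half+half ε) (ℚ.+-mono-< a b))

  recip : ∀ B → 0ℚ ℚ.< B → ℚ
  recip B 0<B = (ℚ.1/ B) {{ℚ.pos⇒nonZero B {{ℚ.positive 0<B}}}}

  recip-pos : ∀ B 0<B → 0ℚ ℚ.< recip B 0<B
  recip-pos B 0<B = ℚ.positive⁻¹ (recip B 0<B) {{ℚ.1/pos⇒pos B {{ℚ.positive 0<B}}}}

  *-recip : ∀ B 0<B → B ℚ.* recip B 0<B ≡ 1ℚ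
  *-recip B 0<B = ℚ.*-inverseʳ B {{ℚ.pos⇒nonZero B {{ℚ.positive 0<B}}}}

  ‖p*q‖<ε : ∀ {p q ε} B (0<B : 0ℚ ℚ.< B) → ‖ p ‖ ℚ.≤ B → ‖ q ‖ ℚ.< ε ℚ.* recip B 0<B → ‖ p ℚ.* q ‖ ℚ.< ε
  ‖p*q‖<ε {p} {q} {ε} B 0<B p≤B q< = begin-strict
    ‖ p ℚ.* q ‖                 ≡⟨ ℚ.∣p*q∣≡∣p∣*∣q∣ p q ⟩
    ‖ p ‖ ℚ.* ‖ q ‖             ≤⟨ ℚ.*-monoʳ-≤-nonNeg ‖ q ‖ {{ℚ.∣-∣-nonNeg q}} p≤B ⟩
    B ℚ.* ‖ q ‖                 <⟨ ℚ.*-monoʳ-<-pos B {{ℚ.positive 0<B}} q< ⟩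
    B ℚ.* (ε ℚ.* recip B 0<B)   ≡⟨ solve 3 (λ b e r → b :* (e :* r) := (b :* r) :* e) refl B ε (recip B 0<B) ⟩
    (B ℚ.* recip B 0<B) ℚ.* ε   ≡⟨ cong (ℚ._* ε) (*-recip B 0<B) ⟩
    1ℚ ℚ.* ε                    ≡⟨ ℚ.*-identityˡ ε ⟩
    ε                           ∎
    where
    open ℚ.≤-Reasoning
    open +-*-Solver using (solve; _:*_; _:=_)

  square-mono : ∀ {p q} → 0ℚ ℚ.≤ p → p ℚ.≤ q → p ℚ.* p ℚ.≤ q ℚ.* q
  square-mono {p} {q} 0≤p p≤q = ℚ.≤-trans
    (ℚ.*-monoˡ-≤-nonNeg p {{ℚ.nonNegative 0≤p}} p≤q)
    (ℚ.*-monoʳ-≤-nonNeg q {{ℚ.nonNegative (ℚ.≤-trans 0≤p p≤q)}} p≤q)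

open RationalLemmas

-- Equality of reals is the relation _≃_ below, not _≡_.

Cauchy : (ℕ → ℚ) → Set
Cauchy x = ∀ ε → 0ℚ ℚ.< ε → ∃[ N ] ∀ i j → N ℕ.≤ i → N ℕ.≤ j → ℚ.∣ x i ℚ.- x j ∣ ℚ.< ε

record ℝ : Set where
  constructor mkℝ
  field
    seq    : ℕ → ℚ
    cauchy : Cauchy seq

open ℝ

infix 4 _≃_ _<_ _≤_

_≃_ : ℝ → ℝ → Set
x ≃ y = ∀ ε → 0ℚ ℚ.< ε → ∃[ N ] ∀ i → N ℕ.≤ i → ℚ.∣ seq x i ℚ.- seq y i ∣ ℚ.< ε

_<_ : ℝ → ℝ → Set
x < y = ∃[ ε ] 0ℚ ℚ.< ε × ∃[ N ] ∀ i → N ℕ.≤ i → seq x i ℚ.+ ε ℚ.≤ seq y i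

_≤_ : ℝ → ℝ → Set
x ≤ y = ¬ (y < x)

fromℚ : ℚ → ℝ
fromℚ q = mkℝ (λ _ → q) (λ ε 0<ε → 0 , λ _ _ _ _ → subst (ℚ._< ε) (cong ℚ.∣_∣ (sym (ℚ.+-inverseʳ q))) 0<ε)

ℕ⇒ℚ : ℕ → ℚ
ℕ⇒ℚ zero    = 0ℚ
ℕ⇒ℚ (suc k) = 1ℚ ℚ.+ ℕ⇒ℚ k

fromℕ : ℕ → ℝ
fromℕ k = fromℚ (ℕ⇒ℚ k)

infixl 6 _+_ _-_
infixl 7 _*_ _/_[_]
infixr 8 _^_
infix  8 -_

_+_ : ℝ → ℝ → ℝ
x + y = mkℝ (λ i → seq x i ℚ.+ seq y i) c
  where
  c : Cauchy (λ i → seq x i ℚ.+ seq y i)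
  c ε 0<ε = let (N , p) = cauchy x (ε ℚ.* ½) (half-pos 0<ε)
                (M , q) = cauchy y (ε ℚ.* ½) (half-pos 0<ε)
            in N ℕ.⊔ M , λ i j i≥ j≥ →
      subst (λ t → ‖ t ‖ ℚ.< ε)
        (solve 4 (λ a b c d → (a :- c) :+ (b :- d) := (a :+ b) :- (c :+ d)) refl (seq x i) (seq y i) (seq x j) (seq y j))
        (‖p+q‖<ε (p i j (ℕ.m⊔n≤o⇒m≤o N M i≥) (ℕ.m⊔n≤o⇒m≤o N M j≥)) (q i j (ℕ.m⊔n≤o⇒n≤o N M i≥) (ℕ.m⊔n≤o⇒n≤o N M j≥)))
    where open +-*-Solver

-_ : ℝ → ℝ
- x = mkℝ (λ i → ℚ.- seq x i) c
  where
  c : Cauchy (λ i → ℚ.- seq x i)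
  c ε 0<ε = let (N , p) = cauchy x ε 0<ε in N , λ i j i≥ j≥ →
      subst (λ t → ‖ t ‖ ℚ.< ε)
        (solve 2 (λ a b → b :- a := (:- a) :- (:- b)) refl (seq x i) (seq x j)) (p j i j≥ i≥)
    where open +-*-Solver

_-_ : ℝ → ℝ → ℝ
x - y = x + (- y)

∣_∣ : ℝ → ℝ
∣ x ∣ = mkℝ (λ i → ℚ.∣ seq x i ∣) (λ ε 0<ε → let (N , p) = cauchy x ε 0<ε in
  N , λ i j i≥ j≥ → ℚ.≤-<-trans (‖‖-‖‖ (seq x i) (seq x j)) (p i j i≥ j≥))

module Boundedness where

  bounded : ∀ x → ∃[ B ] 0ℚ ℚ.< B × ∃[ N ] ∀ i → N ℕ.≤ i → ‖ seq x i ‖ ℚ.≤ B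
  bounded x = let (N , p) = cauchy x 1ℚ (ℚ.positive⁻¹ 1ℚ) in
    ‖ seq x N ‖ ℚ.+ 1ℚ
    , ℚ.+-mono-≤-< (ℚ.0≤∣p∣ (seq x N)) (ℚ.positive⁻¹ 1ℚ)
    , N , λ i i≥ → ℚ.≤-trans (‖p‖≤‖q‖+‖p-q‖ (seq x i) (seq x N))
                     (ℚ.+-monoʳ-≤ ‖ seq x N ‖ (ℚ.<⇒≤ (p i N i≥ ℕ.≤-refl)))

open Boundedness

_*_ : ℝ → ℝ → ℝ
x * y = mkℝ (λ i → seq x i ℚ.* seq y i) c
  where
  c : Cauchy (λ i → seq x i ℚ.* seq y i)
  c ε 0<ε =
    let (A , 0<A , N₁ , bx) = bounded x
        (B , 0<B , N₂ , by) = bounded y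
        h = half-pos 0<ε
        (N₃ , cx) = cauchy x (ε ℚ.* ½ ℚ.* recip B 0<B) (pos* h (recip-pos B 0<B))
        (N₄ , cy) = cauchy y (ε ℚ.* ½ ℚ.* recip A 0<A) (pos* h (recip-pos A 0<A))
        N = (N₁ ℕ.⊔ N₂) ℕ.⊔ (N₃ ℕ.⊔ N₄)
        k₁₂ : ∀ {i} → N ℕ.≤ i → N₁ ℕ.⊔ N₂ ℕ.≤ i
        k₁₂ = ℕ.m⊔n≤o⇒m≤o (N₁ ℕ.⊔ N₂) (N₃ ℕ.⊔ N₄)
        k₃₄ : ∀ {i} → N ℕ.≤ i → N₃ ℕ.⊔ N₄ ℕ.≤ i
        k₃₄ = ℕ.m⊔n≤o⇒n≤o (N₁ ℕ.⊔ N₂) (N₃ ℕ.⊔ N₄)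
    in N , λ i j i≥ j≥ →
      subst (λ t → ‖ t ‖ ℚ.< ε)
        (solve 4 (λ a b c d → a :* (b :- d) :+ d :* (a :- c) := a :* b :- c :* d) refl
          (seq x i) (seq y i) (seq x j) (seq y j))
        (‖p+q‖<ε
          (‖p*q‖<ε A 0<A (bx i (ℕ.m⊔n≤o⇒m≤o N₁ N₂ (k₁₂ i≥)))
            (cy i j (ℕ.m⊔n≤o⇒n≤o N₃ N₄ (k₃₄ i≥)) (ℕ.m⊔n≤o⇒n≤o N₃ N₄ (k₃₄ j≥))))
          (‖p*q‖<ε B 0<B (by j (ℕ.m⊔n≤o⇒n≤o N₁ N₂ (k₁₂ j≥)))
            (cx i j (ℕ.m⊔n≤o⇒m≤o N₃ N₄ (k₃₄ i≥)) (ℕ.m⊔n≤o⇒m≤o N₃ N₄ (k₃₄ j≥)))))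
    where open +-*-Solver

_^_ : ℝ → ℕ → ℝ
x ^ zero  = fromℕ 1
x ^ suc k = x * x ^ k

Nonzero : ℝ → Set
Nonzero x = fromℕ 0 < ∣ x ∣

-- Totalised by inv 0 = 0, which matters only for finitely many terms of a
-- sequence representing a nonzero real.
inv : ℚ → ℚ
inv q with q ℚ.≟ 0ℚ
... | yes _   = 0ℚ
... | no  q≢0 = (ℚ.1/ q) {{ℚ.≢-nonZero q≢0}}

module InvLemmas where

  inv-inverse : ∀ q → q ≢ 0ℚ → q ℚ.* inv q ≡ 1ℚ
  inv-inverse q q≢0 with q ℚ.≟ 0ℚ
  ... | yes q≡0 = contradiction q≡0 q≢0
  ... | no  p   = ℚ.*-inverseʳ q {{ℚ.≢-nonZero p}}

  0<‖q‖⇒q≢0 : ∀ {q δ} → 0ℚ ℚ.< δ → 0ℚ ℚ.+ δ ℚ.≤ ‖ q ‖ → q ≢ 0ℚ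
  0<‖q‖⇒q≢0 {δ = δ} 0<δ h refl = ℚ<⇒≱ 0<δ (subst (ℚ._≤ 0ℚ) (ℚ.+-identityˡ δ) h)

open InvLemmas

_⁻¹[_] : (x : ℝ) → Nonzero x → ℝ
x ⁻¹[ δ , 0<δ , M , lower ] = mkℝ (λ i → inv (seq x i)) c
  where
  c : Cauchy (λ i → inv (seq x i))
  c ε 0<ε =
    let (N , p) = cauchy x (ε ℚ.* (δ ℚ.* δ)) (pos* 0<ε (pos* 0<δ 0<δ))
    in M ℕ.⊔ N , λ i j i≥ j≥ →
      let Mi = lower i (ℕ.m⊔n≤o⇒m≤o M N i≥)
          Mj = lower j (ℕ.m⊔n≤o⇒m≤o M N j≥)
      in bound (seq x i) (seq x j) Mi Mj (p j i (ℕ.m⊔n≤o⇒n≤o M N j≥) (ℕ.m⊔n≤o⇒n≤o M N i≥))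
    where
    bound : ∀ a b → 0ℚ ℚ.+ δ ℚ.≤ ‖ a ‖ → 0ℚ ℚ.+ δ ℚ.≤ ‖ b ‖ →
            ‖ b ℚ.- a ‖ ℚ.< ε ℚ.* (δ ℚ.* δ) → ‖ inv a ℚ.- inv b ‖ ℚ.< ε
    bound a b la lb h = ℚ.*-cancelʳ-<-nonNeg (δ ℚ.* δ) {{ℚ.nonNegative (ℚ.<⇒≤ (pos* 0<δ 0<δ))}} (begin-strict
      ‖ inv a ℚ.- inv b ‖ ℚ.* (δ ℚ.* δ)            ≤⟨ ℚ.*-monoˡ-≤-nonNeg ‖ inv a ℚ.- inv b ‖ {{ℚ.∣-∣-nonNeg (inv a ℚ.- inv b)}} δδ≤ ⟩
      ‖ inv a ℚ.- inv b ‖ ℚ.* (‖ a ‖ ℚ.* ‖ b ‖)    ≡⟨ cong (‖ inv a ℚ.- inv b ‖ ℚ.*_) (sym (ℚ.∣p*q∣≡∣p∣*∣q∣ a b)) ⟩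
      ‖ inv a ℚ.- inv b ‖ ℚ.* ‖ a ℚ.* b ‖          ≡⟨ sym (ℚ.∣p*q∣≡∣p∣*∣q∣ (inv a ℚ.- inv b) (a ℚ.* b)) ⟩
      ‖ (inv a ℚ.- inv b) ℚ.* (a ℚ.* b) ‖          ≡⟨ cong ‖_‖ diff ⟩
      ‖ b ℚ.- a ‖                                  <⟨ h ⟩
      ε ℚ.* (δ ℚ.* δ)                              ∎)
      where
      open ℚ.≤-Reasoning
      δ≤a : δ ℚ.≤ ‖ a ‖
      δ≤a = subst (ℚ._≤ ‖ a ‖) (ℚ.+-identityˡ δ) la
      δ≤b : δ ℚ.≤ ‖ b ‖
      δ≤b = subst (ℚ._≤ ‖ b ‖) (ℚ.+-identityˡ δ) lb
      δδ≤ : δ ℚ.* δ ℚ.≤ ‖ a ‖ ℚ.* ‖ b ‖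
      δδ≤ = ℚ.≤-trans (ℚ.*-monoʳ-≤-nonNeg δ {{ℚ.nonNegative (ℚ.<⇒≤ 0<δ)}} δ≤a)
                      (ℚ.*-monoˡ-≤-nonNeg ‖ a ‖ {{ℚ.∣-∣-nonNeg a}} δ≤b)
      diff : (inv a ℚ.- inv b) ℚ.* (a ℚ.* b) ≡ b ℚ.- a
      diff = trans
        (solve 4 (λ a b u v → (u :- v) :* (a :* b) := (a :* u) :* b :- (b :* v) :* a) refl a b (inv a) (inv b))
        (cong₂ ℚ._-_ (trans (cong (ℚ._* b) (inv-inverse a (0<‖q‖⇒q≢0 0<δ la))) (ℚ.*-identityˡ b))
                     (trans (cong (ℚ._* a) (inv-inverse b (0<‖q‖⇒q≢0 0<δ lb))) (ℚ.*-identityˡ a)))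
        where open +-*-Solver using (solve; _:*_; _:-_; _:=_)

⁻¹-inverse : ∀ x (x≢0 : Nonzero x) → x * x ⁻¹[ x≢0 ] ≃ fromℕ 1
⁻¹-inverse x (δ , 0<δ , M , lower) ε 0<ε = M , λ i i≥ →
  subst (ℚ._< ε) (cong (λ t → ‖ t ℚ.- 1ℚ ‖) (sym (inv-inverse (seq x i) (0<‖q‖⇒q≢0 0<δ (lower i i≥))))) 0<ε

_/_[_] : ℝ → (y : ℝ) → Nonzero y → ℝ
x / y [ y≢0 ] = x * y ⁻¹[ y≢0 ]

positive⇒nonzero : ∀ {x} → fromℕ 0 < x → Nonzero x
positive⇒nonzero {x} (δ , 0<δ , M , lower) = δ , 0<δ , M , λ i i≥ → ℚ.≤-trans (lower i i≥) (p≤‖p‖ (seq x i))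

*-positive : ∀ {x y} → fromℕ 0 < x → fromℕ 0 < y → fromℕ 0 < x * y
*-positive {x} {y} (δ , 0<δ , M , p) (η , 0<η , N , q) = δ ℚ.* η , pos* 0<δ 0<η , M ℕ.⊔ N , λ i i≥ →
  subst (ℚ._≤ seq x i ℚ.* seq y i) (sym (ℚ.+-identityˡ (δ ℚ.* η)))
    (mono (subst (ℚ._≤ seq x i) (ℚ.+-identityˡ δ) (p i (ℕ.m⊔n≤o⇒m≤o M N i≥)))
          (subst (ℚ._≤ seq y i) (ℚ.+-identityˡ η) (q i (ℕ.m⊔n≤o⇒n≤o M N i≥))))
  where
  mono : ∀ {a b} → δ ℚ.≤ a → η ℚ.≤ b → δ ℚ.* η ℚ.≤ a ℚ.* b
  mono {a} {b} u v = ℚ.≤-trans (ℚ.*-monoʳ-≤-nonNeg η {{ℚ.nonNegative (ℚ.<⇒≤ 0<η)}} u)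
                      (ℚ.*-monoˡ-≤-nonNeg a {{ℚ.nonNegative (ℚ.≤-trans (ℚ.<⇒≤ 0<δ) u)}} v)

module ℕ⇒ℚ-Positivity where

  0≤ℕ⇒ℚ : ∀ k → 0ℚ ℚ.≤ ℕ⇒ℚ k
  0≤ℕ⇒ℚ zero    = ℚ.≤-refl
  0≤ℕ⇒ℚ (suc k) = ℚ.+-mono-≤ (ℚ.<⇒≤ (ℚ.positive⁻¹ 1ℚ)) (0≤ℕ⇒ℚ k)

  0<ℕ⇒ℚ : ∀ k → 0ℚ ℚ.< ℕ⇒ℚ (suc k)
  0<ℕ⇒ℚ k = ℚ.+-mono-<-≤ (ℚ.positive⁻¹ 1ℚ) (0≤ℕ⇒ℚ k)

open ℕ⇒ℚ-Positivity

fromℕ-positive : ∀ k → fromℕ 0 < fromℕ (suc k)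
fromℕ-positive k = ℕ⇒ℚ (suc k) , 0<ℕ⇒ℚ k , 0 , λ _ _ → ℚ.≤-reflexive (ℚ.+-identityˡ _)

fromℕ-nonzero : ∀ k → Nonzero (fromℕ (suc k))
fromℕ-nonzero k = positive⇒nonzero {fromℕ (suc k)} (fromℕ-positive k)

^-positive : ∀ {x} → fromℕ 0 < x → ∀ k → fromℕ 0 < x ^ k
^-positive     0<x zero    = fromℕ-positive 0
^-positive {x} 0<x (suc k) = *-positive {x} {x ^ k} 0<x (^-positive {x} 0<x k)

isqrt : ℕ → ℕ
isqrt zero    = 0
isqrt (suc k) with suc (isqrt k) ℕ.* suc (isqrt k) ℕ.≤? suc k
... | yes _ = suc (isqrt k)
... | no  _ = isqrt k

isqrt-spec : ∀ k → isqrt k ℕ.* isqrt k ℕ.≤ k × k ℕ.< suc (isqrt k) ℕ.* suc (isqrt k)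
isqrt-spec zero    = ℕ.z≤n , ℕ.s≤s ℕ.z≤n
isqrt-spec (suc k) with suc (isqrt k) ℕ.* suc (isqrt k) ℕ.≤? suc k
... | yes p = p , ℕ.≤-<-trans (proj₂ (isqrt-spec k)) (ℕ.*-mono-< (ℕ.n<1+n (suc (isqrt k))) (ℕ.n<1+n (suc (isqrt k))))
... | no  p = ℕ.m≤n⇒m≤1+n (proj₁ (isqrt-spec k)) , ℕ.≰⇒> p

module ℕ⇒ℚ-Lemmas where

  ℕ⇒ℚ-+ : ∀ a b → ℕ⇒ℚ (a ℕ.+ b) ≡ ℕ⇒ℚ a ℚ.+ ℕ⇒ℚ b
  ℕ⇒ℚ-+ zero    b = sym (ℚ.+-identityˡ (ℕ⇒ℚ b))
  ℕ⇒ℚ-+ (suc a) b = trans (cong (1ℚ ℚ.+_) (ℕ⇒ℚ-+ a b)) (sym (ℚ.+-assoc 1ℚ (ℕ⇒ℚ a) (ℕ⇒ℚ b)))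

  ℕ⇒ℚ-* : ∀ a b → ℕ⇒ℚ (a ℕ.* b) ≡ ℕ⇒ℚ a ℚ.* ℕ⇒ℚ b
  ℕ⇒ℚ-* zero    b = sym (ℚ.*-zeroˡ (ℕ⇒ℚ b))
  ℕ⇒ℚ-* (suc a) b = trans (ℕ⇒ℚ-+ b (a ℕ.* b)) (trans (cong (ℕ⇒ℚ b ℚ.+_) (ℕ⇒ℚ-* a b))
    (trans (cong (ℚ._+ ℕ⇒ℚ a ℚ.* ℕ⇒ℚ b) (sym (ℚ.*-identityˡ (ℕ⇒ℚ b)))) (sym (ℚ.*-distribʳ-+ (ℕ⇒ℚ b) 1ℚ (ℕ⇒ℚ a)))))

  ℕ⇒ℚ-mono-≤ : ∀ {a b} → a ℕ.≤ b → ℕ⇒ℚ a ℚ.≤ ℕ⇒ℚ b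
  ℕ⇒ℚ-mono-≤ {b = b} ℕ.z≤n   = 0≤ℕ⇒ℚ b
  ℕ⇒ℚ-mono-≤         (ℕ.s≤s p) = ℚ.+-monoʳ-≤ 1ℚ (ℕ⇒ℚ-mono-≤ p)

  ℕ⇒ℚ-mono-< : ∀ {a b} → a ℕ.< b → ℕ⇒ℚ a ℚ.< ℕ⇒ℚ b
  ℕ⇒ℚ-mono-< {a} p = ℚ.<-≤-trans (subst (ℚ._< 1ℚ ℚ.+ ℕ⇒ℚ a) (ℚ.+-identityˡ (ℕ⇒ℚ a)) (ℚ.+-monoˡ-< (ℕ⇒ℚ a) (ℚ.positive⁻¹ 1ℚ))) (ℕ⇒ℚ-mono-≤ p)

  toℚᵘ-ℕ⇒ℚ : ∀ k → ℚ.toℚᵘ (ℕ⇒ℚ k) ℚᵘ.≃ ℚᵘ.mkℚᵘ (ℤ.+ k) 0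
  toℚᵘ-ℕ⇒ℚ zero    = ℚᵘ.≃-refl
  toℚᵘ-ℕ⇒ℚ (suc k) = ℚᵘ.≃-trans (ℚ.toℚᵘ-homo-+ 1ℚ (ℕ⇒ℚ k))
    (ℚᵘ.≃-trans (ℚᵘ.+-congʳ ℚᵘ.1ℚᵘ (toℚᵘ-ℕ⇒ℚ k)) (ℚᵘ.*≡* (cong (ℤ._* ℤ.1ℤ) (cong (λ t → ℤ.1ℤ ℤ.+ t) (ℤ.*-identityʳ (ℤ.+ k))))))

  archimedean : ∀ q → ∃[ k ] q ℚ.≤ ℕ⇒ℚ k
  archimedean q@(mkℚ z d _) = ℤ.∣ z ∣ , ℚ.toℚᵘ-cancel-≤ (ℚᵘ.≤-respʳ-≃ (ℚᵘ.≃-sym (toℚᵘ-ℕ⇒ℚ ℤ.∣ z ∣)) (ℚᵘ.*≤* le))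
    where
    abs≤ : ∀ z → z ℤ.≤ ℤ.+ ℤ.∣ z ∣
    abs≤ (ℤ.+ n)    = ℤ.≤-refl
    abs≤ (ℤ.-[1+ n ]) = ℤ.-≤+
    le : z ℤ.* ℤ.1ℤ ℤ.≤ (ℤ.+ ℤ.∣ z ∣) ℤ.* (ℤ.+ suc d)
    le = ℤ.≤-trans (ℤ.≤-reflexive (ℤ.*-identityʳ z)) (ℤ.≤-trans (abs≤ z)
      (ℤ.≤-trans (ℤ.+≤+ (ℕ.m≤m*n ℤ.∣ z ∣ (suc d))) (ℤ.≤-reflexive (ℤ.pos-* ℤ.∣ z ∣ (suc d)))))

  δ : ℕ → ℚ
  δ i = recip (ℕ⇒ℚ (suc i)) (0<ℕ⇒ℚ i)

  0<δ : ∀ i → 0ℚ ℚ.< δ i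
  0<δ i = recip-pos (ℕ⇒ℚ (suc i)) (0<ℕ⇒ℚ i)

  δ-inverse : ∀ i → ℕ⇒ℚ (suc i) ℚ.* δ i ≡ 1ℚ
  δ-inverse i = *-recip (ℕ⇒ℚ (suc i)) (0<ℕ⇒ℚ i)

  δ-small : ∀ ε → 0ℚ ℚ.< ε → ∃[ N ] ∀ i → N ℕ.≤ i → δ i ℚ.< ε
  δ-small ε 0<ε = let (N , p) = archimedean (recip ε 0<ε) in N , λ i i≥ →
    ℚ.*-cancelˡ-<-nonNeg (ℕ⇒ℚ (suc i)) {{ℚ.nonNegative (0≤ℕ⇒ℚ (suc i))}}
      (subst (ℚ._< ℕ⇒ℚ (suc i) ℚ.* ε) (sym (δ-inverse i))
        (subst (ℚ._< ℕ⇒ℚ (suc i) ℚ.* ε) (trans (ℚ.*-comm (recip ε 0<ε) ε) (*-recip ε 0<ε))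
          (ℚ.*-monoˡ-<-pos ε {{ℚ.positive 0<ε}} (ℚ.≤-<-trans p (ℕ⇒ℚ-mono-< (ℕ.s≤s i≥))))))

open ℕ⇒ℚ-Lemmas

-- √-seq k i = ⌊ (i+1) √k ⌋ / (i+1)
√-seq : ℕ → ℕ → ℚ
√-seq k i = ℕ⇒ℚ (isqrt (k ℕ.* (suc i ℕ.* suc i))) ℚ.* inv (ℕ⇒ℚ (suc i))

module √-Lemmas where

  ℕ⇒ℚ≢0 : ∀ i → ℕ⇒ℚ (suc i) ≢ 0ℚ
  ℕ⇒ℚ≢0 i e = ℚ.<⇒≢ (0<ℕ⇒ℚ i) (sym e)

  δ≡inv : ∀ i → inv (ℕ⇒ℚ (suc i)) ≡ δ i
  δ≡inv i = trans (sym (ℚ.*-identityʳ v)) (trans (cong (v ℚ.*_) (sym (δ-inverse i)))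
    (trans (sym (ℚ.*-assoc v s (δ i))) (trans (cong (ℚ._* δ i) (trans (ℚ.*-comm v s) (inv-inverse s (ℕ⇒ℚ≢0 i)))) (ℚ.*-identityˡ (δ i)))))
    where
    s = ℕ⇒ℚ (suc i)
    v = inv s

  module _ (k i : ℕ) where
    r : ℕ
    r = isqrt (k ℕ.* (suc i ℕ.* suc i))

    √≡ : √-seq k i ≡ ℕ⇒ℚ r ℚ.* δ i
    √≡ = cong (ℕ⇒ℚ r ℚ.*_) (δ≡inv i)

    0≤√ : 0ℚ ℚ.≤ √-seq k i
    0≤√ = subst (0ℚ ℚ.≤_) (sym √≡) (ℚ.nonNegative⁻¹ (ℕ⇒ℚ r ℚ.* δ i) {{ℚ.nonNeg*nonNeg⇒nonNeg (ℕ⇒ℚ r) {{ℚ.nonNegative (0≤ℕ⇒ℚ r)}} (δ i) {{ℚ.nonNegative (ℚ.<⇒≤ (0<δ i))}}}})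

    0<δδ : 0ℚ ℚ.< δ i ℚ.* δ i
    0<δδ = pos* (0<δ i) (0<δ i)

    k≡ : ℕ⇒ℚ (k ℕ.* (suc i ℕ.* suc i)) ℚ.* (δ i ℚ.* δ i) ≡ ℕ⇒ℚ k
    k≡ = trans (cong (ℚ._* (δ i ℚ.* δ i)) (trans (ℕ⇒ℚ-* k (suc i ℕ.* suc i)) (cong (ℕ⇒ℚ k ℚ.*_) (ℕ⇒ℚ-* (suc i) (suc i)))))
      (trans (solve 3 (λ k s d → (k :* (s :* s)) :* (d :* d) := k :* ((s :* d) :* (s :* d))) refl (ℕ⇒ℚ k) (ℕ⇒ℚ (suc i)) (δ i))
      (trans (cong (λ t → ℕ⇒ℚ k ℚ.* (t ℚ.* t)) (δ-inverse i)) (ℚ.*-identityʳ (ℕ⇒ℚ k))))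
      where open +-*-Solver using (solve; _:*_; _:=_)

    sq : ∀ m → (ℕ⇒ℚ m ℚ.* δ i) ℚ.* (ℕ⇒ℚ m ℚ.* δ i) ≡ ℕ⇒ℚ (m ℕ.* m) ℚ.* (δ i ℚ.* δ i)
    sq m = trans (solve 2 (λ m d → (m :* d) :* (m :* d) := (m :* m) :* (d :* d)) refl (ℕ⇒ℚ m) (δ i))
      (cong (ℚ._* (δ i ℚ.* δ i)) (sym (ℕ⇒ℚ-* m m)))
      where open +-*-Solver using (solve; _:*_; _:=_)

    √²≤k : √-seq k i ℚ.* √-seq k i ℚ.≤ ℕ⇒ℚ k
    √²≤k = subst (λ t → t ℚ.* t ℚ.≤ ℕ⇒ℚ k) (sym √≡) (subst (ℚ._≤ ℕ⇒ℚ k) (sym (sq r))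
      (ℚ.≤-trans (ℚ.*-monoʳ-≤-nonNeg (δ i ℚ.* δ i) {{ℚ.nonNegative (ℚ.<⇒≤ 0<δδ)}} (ℕ⇒ℚ-mono-≤ (proj₁ (isqrt-spec (k ℕ.* (suc i ℕ.* suc i))))))
        (ℚ.≤-reflexive k≡)))

    √+δ≡ : √-seq k i ℚ.+ δ i ≡ ℕ⇒ℚ (suc r) ℚ.* δ i
    √+δ≡ = trans (cong (ℚ._+ δ i) √≡) (solve 2 (λ m d → m :* d :+ d := (con 1ℚ :+ m) :* d) refl (ℕ⇒ℚ r) (δ i))
      where open +-*-Solver

    k<√+δ² : ℕ⇒ℚ k ℚ.< (√-seq k i ℚ.+ δ i) ℚ.* (√-seq k i ℚ.+ δ i)
    k<√+δ² = subst (λ t → ℕ⇒ℚ k ℚ.< t ℚ.* t) (sym √+δ≡) (subst (ℕ⇒ℚ k ℚ.<_) (sym (sq (suc r)))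
      (ℚ.≤-<-trans (ℚ.≤-reflexive (sym k≡))
        (ℚ.*-monoˡ-<-pos (δ i ℚ.* δ i) {{ℚ.positive 0<δδ}} (ℕ⇒ℚ-mono-< (proj₂ (isqrt-spec (k ℕ.* (suc i ℕ.* suc i))))))))

  √<√+δ : ∀ k i j → √-seq k i ℚ.< √-seq k j ℚ.+ δ j
  √<√+δ k i j = ℚ.≰⇒> λ h → ℚ<⇒≱ (k<√+δ² k j)
    (ℚ.≤-trans (square-mono (ℚ.+-mono-≤ (0≤√ k j) (ℚ.<⇒≤ (0<δ j))) h) (√²≤k k i))

open √-Lemmas

√_ : ℕ → ℝ
√ k = mkℝ (√-seq k) c
  where
  c : Cauchy (√-seq k)
  c ε 0<ε = let (N , p) = δ-small ε 0<ε in N , λ i j i≥ j≥ →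
    ‖p‖<ε (ℚ.<-trans (p-q<r (√<√+δ k i j)) (p j j≥))
          (subst (ℚ._< ε) (sym (neg-diff (√-seq k i) (√-seq k j))) (ℚ.<-trans (p-q<r (√<√+δ k j i)) (p i i≥)))

√-nonneg : ∀ k → fromℕ 0 ≤ √ k
√-nonneg k (ε , 0<ε , N , p) = ℚ<⇒≱ (ℚ.+-mono-≤-< (0≤√ k N) 0<ε) (p N ℕ.≤-refl)

√-square : ∀ k → √ k * √ k ≃ fromℕ k
√-square k ε 0<ε =
  let (N , p) = δ-small (ε ℚ.* recip B 0<B) (pos* 0<ε (recip-pos B 0<B)) in N , λ i i≥ →
    subst (ℚ._< ε) (‖-‖-swap (ℕ⇒ℚ k) (√-seq k i ℚ.* √-seq k i))
      (‖p‖<ε (ℚ.<-trans (p-q<r (subst (ℕ⇒ℚ k ℚ.<_) (expand (√-seq k i) (δ i)) (k<√+δ² k i)))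
               (ℚ.≤-<-trans (p≤‖p‖ _) (‖p*q‖<ε B 0<B (bound i) (subst (ℚ._< ε ℚ.* recip B 0<B) (sym (ℚ.0≤p⇒∣p∣≡p (ℚ.<⇒≤ (0<δ i)))) (p i i≥)))))
             (ℚ.≤-<-trans (ℚ.≤-trans (ℚ.≤-reflexive (neg-diff (ℕ⇒ℚ k) _)) (p-q≤r (subst (√-seq k i ℚ.* √-seq k i ℚ.≤_) (sym (ℚ.+-identityʳ (ℕ⇒ℚ k))) (√²≤k k i)))) 0<ε))
  where
  c₀ = √-seq k 0 ℚ.+ δ 0
  B = c₀ ℚ.+ c₀ ℚ.+ 1ℚ
  0<B : 0ℚ ℚ.< B
  0<B = ℚ.+-mono-≤-< (ℚ.+-mono-≤ 0≤c₀ 0≤c₀) (ℚ.positive⁻¹ 1ℚ)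
    where
    0≤c₀ : 0ℚ ℚ.≤ c₀
    0≤c₀ = ℚ.+-mono-≤ (0≤√ k 0) (ℚ.<⇒≤ (0<δ 0))
  expand : ∀ a d → (a ℚ.+ d) ℚ.* (a ℚ.+ d) ≡ a ℚ.* a ℚ.+ (a ℚ.+ a ℚ.+ d) ℚ.* d
  expand a d = solve 2 (λ a d → (a :+ d) :* (a :+ d) := a :* a :+ (a :+ a :+ d) :* d) refl a d
    where open +-*-Solver
  δ≤1 : ∀ i → δ i ℚ.≤ 1ℚ
  δ≤1 i = ℚ.*-cancelˡ-≤-pos (ℕ⇒ℚ (suc i)) {{ℚ.positive (0<ℕ⇒ℚ i)}}
    (subst (ℚ._≤ ℕ⇒ℚ (suc i) ℚ.* 1ℚ) (sym (δ-inverse i)) (subst (1ℚ ℚ.≤_) (sym (ℚ.*-identityʳ (ℕ⇒ℚ (suc i))))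
      (subst (ℚ._≤ 1ℚ ℚ.+ ℕ⇒ℚ i) (ℚ.+-identityʳ 1ℚ) (ℚ.+-monoʳ-≤ 1ℚ (0≤ℕ⇒ℚ i)))))
  bound : ∀ i → ‖ √-seq k i ℚ.+ √-seq k i ℚ.+ δ i ‖ ℚ.≤ B
  bound i = subst (ℚ._≤ B) (sym (ℚ.0≤p⇒∣p∣≡p (ℚ.+-mono-≤ (ℚ.+-mono-≤ (0≤√ k i) (0≤√ k i)) (ℚ.<⇒≤ (0<δ i)))))
    (ℚ.+-mono-≤ (ℚ.+-mono-≤ (ℚ.<⇒≤ (√<√+δ k i 0)) (ℚ.<⇒≤ (√<√+δ k i 0))) (δ≤1 i))

infix 4 _⟶_

_⟶_ : (ℕ → ℝ) → ℝ → Set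
x ⟶ ℓ = ∀ ε → fromℕ 0 < ε → ∃[ N ] ∀ k → N ℕ.≤ k → ∣ x k - ℓ ∣ < ε

partialSum : (ℕ → ℝ) → ℕ → ℝ
partialSum a zero    = fromℕ 0
partialSum a (suc k) = partialSum a k + a k

PowerSeries : Set
PowerSeries = ℕ → ℝ

_at_HasSum_ : PowerSeries → ℝ → ℝ → Set
a at z HasSum s = partialSum (λ k → a k * z ^ k) ⟶ s

-- The radius of convergence of a is the supremum in [0,∞] of the r ≥ 0 at
-- which a converges; ρ lies strictly below a supremum iff it lies strictly
-- below some element of the set.
_<radius_ : ℝ → PowerSeries → Set
ρ <radius a = ∃[ r ] (fromℕ 0 ≤ r × ∃[ s ] a at r HasSum s) × ρ < r

ω : ℝ
ω = (fromℕ 1 + √ 5) / fromℕ 2 [ fromℕ-nonzero 1 ]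

ω-positive : fromℕ 0 < ω
ω-positive = *-positive {fromℕ 1 + √ 5} {fromℚ ½}
  (1ℚ , ℚ.positive⁻¹ 1ℚ , 0 , λ i _ → ℚ.≤-trans (ℚ.+-monoʳ-≤ 0ℚ (subst (ℚ._≤ 1ℚ ℚ.+ √-seq 5 i) (ℚ.+-identityʳ 1ℚ) (ℚ.+-monoʳ-≤ 1ℚ (0≤√ 5 i)))) (ℚ.≤-reflexive (ℚ.+-identityˡ _)))
  (½ , ℚ.positive⁻¹ ½ , 0 , λ _ _ → ℚ.≤-refl)

ω^-nonzero : ∀ k → Nonzero (ω ^ k)
ω^-nonzero k = positive⇒nonzero {ω ^ k} (^-positive {ω} ω-positive k)

ω⁻¹ : ℝ
ω⁻¹ = ω ⁻¹[ positive⇒nonzero {ω} ω-positive ]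

C̃ : PowerSeries
C̃ 0 = fromℕ 0
C̃ 1 = fromℕ 0
C̃ 2 = fromℕ 0
C̃ g@(suc (suc (suc _))) = fromℕ (c̃ g)

{-# OPTIONS --safe #-}
-- Kunz coordinates turn a numerical semigroup of multiplicity m into the word
-- w₁ … w₍ₘ₋₁₎, where wᵢ ≥ 1 counts the gaps congruent to i modulo m, subject to
-- wᵢ₊ⱼ ≤ wᵢ + wⱼ (and wᵢ₊ⱼ₋ₘ ≤ wᵢ + wⱼ + 1 when i + j > m); the genus is Σ wᵢ.
-- The condition f < 3m says that all letters are at most 3, and f = 3m - 1 that
-- moreover the last letter is 3.  Appending a letter 1 or 2 to a word with
-- letters ≤ 3 is always allowed, so the number T(g) of such words satisfies
-- T(g) = T(g-1) + T(g-2) + c̃(g).  With z = 1/ω and z + z² = 1 this gives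
-- T(g) z^g + z² T(g-1) z^(g-1) = 1 + Σ_{j≤g} c̃(j) z^j, and z² < 1 forces
-- T(g) z^g → (1 + C̃(z)) / (1 + z²).
--
-- It remains to see that c̃(g) and the number of words with a letter ≥ 4 grow
-- exponentially slower than ω^g.  Let s be the maximal letter (or 6, if larger
-- letters occur) and k the last position with w_k ≥ s.  Then the pairs of
-- positions (i , k-i) carry letters ≤ s with sum ≥ s, and the pairs (k+i , m-i)
-- letters ≤ s-1 with sum ≥ s-1.  If a is the first position of a letter 1, then
-- letters before a differ from 1 and w_{i+a} ≤ w_i + 1, so the pairs i, i+a, i+2a, …
-- form a chain with restricted transitions.  Weighting a word by r^(Σ wᵢ) with
-- r = 31/50 > 1/ω, a finite computation shows that the total weight of
-- every chain is small enough for the product over all chains to stay bounded,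
-- whence these words number O(g³ r^(-g)).
module Submission where

open import Data.Bool.Base using (Bool; true; false; T)
open import Data.Fin.Base as Fin using (Fin)
import Data.Fin.Properties as Fin
import Data.Integer.Base as ℤ
open import Data.List.Base using (List; []; _∷_; _++_; map; concatMap; length; lookup; filter; deduplicate; applyUpTo; take; upTo; initLast; _∷ʳ′_; _∷ʳ_)
import Data.List.Membership.Propositional.Properties as ∈
open import Data.List.Membership.Propositional using (_∈_)
import Data.List.Properties as List
open import Data.List.Relation.Unary.All as All using (All; []; _∷_)
import Data.List.Relation.Unary.All.Properties as Allₚ
open import Data.List.Relation.Unary.AllPairs using ([]; _∷_)
open import Data.List.Relation.Unary.Any as Any using (Any; here; there)
import Data.List.Relation.Unary.Any.Properties as Anyₚ
import Data.List.Relation.Unary.Unique.DecPropositional.Properties as UniqueDec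
open import Data.List.Relation.Unary.Unique.Propositional using (Unique)
import Data.List.Relation.Unary.Unique.Propositional.Properties as Unique
open import Data.Nat.Base as ℕ using (ℕ; zero; suc; z≤n; s≤s; ⌊_/2⌋)
open import Data.Nat.Divisibility using (n∣m*n)
open import Data.Nat.ListAction using (sum)
import Data.Nat.Properties as ℕ
import Data.Nat.Solver as ℕSolver
open import Data.Product.Base using (Σ; ∃-syntax; _×_; _,_; proj₁; proj₂)
open import Data.Rational.Base as ℚ using (ℚ; 0ℚ; 1ℚ; ½)
import Data.Rational.Properties as ℚ
open import Data.Rational.Solver using (module +-*-Solver)
open import Data.Sum.Base using (_⊎_; inj₁; inj₂)
open import Data.Unit.Base using (⊤; tt)
open import Function.Base using (_∘_; id)
open import Function.Bundles using (Bijection; mk⇔)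
open import Relation.Binary.Definitions using (tri<; tri≈; tri>)
open import Relation.Binary.PropositionalEquality using (_≡_; _≢_; refl; sym; trans; cong; cong₂; subst)
open import Relation.Nullary.Decidable using (Dec; yes; no; ¬?; _×-dec_; decidable-stable; map′; from-yes)
open import Relation.Nullary.Negation.Core using (¬_; contradiction)
open import Relation.Unary using (Decidable; Pred; _≐_)
open import Defs using (ℕ⇒ℚ; NumericalSemigroup; _≋_; IsMultiplicity; F≡3m-1; SemigroupsWith; Finite; card; n; c̃; genus-finite; genus∧F≡3m-1-finite; module GapLists; module Decisions; module ℕ⇒ℚ-Lemmas)
open NumericalSemigroup using (genus)

-- Treating the pairs of a region as independent is not enough: at levels 3 and 4 the admissible
-- pairs together weigh more than 1, so a product over linearly many pairs would grow exponentially.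
-- Linking pairs at distance `a` leaves at most `a` chains, and a chain weighs at most a constant
-- whatever its length. But `a` may itself be of the order of the genus, so a constant above 1 per
-- chain is still too much. The balance is restored by the letters before position `a`, which are
-- known not to be 1: in the outer region each such position gains a factor `κ`, in the inner region
-- each chain without such knowledge costs at most `τ`, and `κ * τ = 1`. Up to a bounded number of
-- factors the two exponents agree, both being about the minimum of `a` and the position of the top
-- letter. Reals are Cauchy sequences, so the analytic part uses rational identities between terms
-- of index `i`; defects such as `z + z² - 1` are carried along and vanish as `i` grows, for each
-- fixed `g`.

-- Inequalities and powers in ℚ.

module ℚLemmas where

  *-mono-≤-nonNeg : ∀ {a b c d} → 0ℚ ℚ.≤ a → 0ℚ ℚ.≤ d → a ℚ.≤ b → c ℚ.≤ d → a ℚ.* c ℚ.≤ b ℚ.* d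
  *-mono-≤-nonNeg {a} {b} {c} {d} 0≤a 0≤d a≤b c≤d = ℚ.≤-trans
    (ℚ.*-monoˡ-≤-nonNeg a {{ℚ.nonNegative 0≤a}} c≤d) (ℚ.*-monoʳ-≤-nonNeg d {{ℚ.nonNegative 0≤d}} a≤b)

  *-monoˡ : ∀ {a b} c → 0ℚ ℚ.≤ c → a ℚ.≤ b → c ℚ.* a ℚ.≤ c ℚ.* b
  *-monoˡ c 0≤c = ℚ.*-monoˡ-≤-nonNeg c {{ℚ.nonNegative 0≤c}}

  *-monoʳ : ∀ {a b} c → 0ℚ ℚ.≤ c → a ℚ.≤ b → a ℚ.* c ℚ.≤ b ℚ.* c
  *-monoʳ c 0≤c = ℚ.*-monoʳ-≤-nonNeg c {{ℚ.nonNegative 0≤c}}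

  *-nonNeg : ∀ {a b} → 0ℚ ℚ.≤ a → 0ℚ ℚ.≤ b → 0ℚ ℚ.≤ a ℚ.* b
  *-nonNeg {a} {b} 0≤a 0≤b = subst (ℚ._≤ a ℚ.* b) (ℚ.*-zeroʳ a) (*-monoˡ a 0≤a 0≤b)

  +-nonNeg : ∀ {a b} → 0ℚ ℚ.≤ a → 0ℚ ℚ.≤ b → 0ℚ ℚ.≤ a ℚ.+ b
  +-nonNeg = ℚ.+-mono-≤

  *≤1 : ∀ {a c} → 0ℚ ℚ.≤ c → a ℚ.≤ 1ℚ → a ℚ.* c ℚ.≤ c
  *≤1 {a} {c} 0≤c a≤1 = subst (a ℚ.* c ℚ.≤_) (ℚ.*-identityˡ c) (*-monoʳ c 0≤c a≤1)

  0≤1 : 0ℚ ℚ.≤ 1ℚ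
  0≤1 = from-yes (0ℚ ℚ.≤? 1ℚ)

  pow : ℚ → ℕ → ℚ
  pow x zero    = 1ℚ
  pow x (suc k) = x ℚ.* pow x k

  pow-nonNeg : ∀ {x} → 0ℚ ℚ.≤ x → ∀ k → 0ℚ ℚ.≤ pow x k
  pow-nonNeg 0≤x zero    = 0≤1
  pow-nonNeg 0≤x (suc k) = *-nonNeg 0≤x (pow-nonNeg 0≤x k)

  pow-+ : ∀ x a b → pow x (a ℕ.+ b) ≡ pow x a ℚ.* pow x b
  pow-+ x zero    b = sym (ℚ.*-identityˡ (pow x b))
  pow-+ x (suc a) b = trans (cong (x ℚ.*_) (pow-+ x a b)) (sym (ℚ.*-assoc x (pow x a) (pow x b)))

  pow-* : ∀ x y k → pow (x ℚ.* y) k ≡ pow x k ℚ.* pow y k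
  pow-* x y zero    = refl
  pow-* x y (suc k) = trans (cong (x ℚ.* y ℚ.*_) (pow-* x y k))
    (solve 4 (λ x y a b → (x :* y) :* (a :* b) := (x :* a) :* (y :* b)) refl x y (pow x k) (pow y k))
    where open +-*-Solver

  pow-mono : ∀ {x y} → 0ℚ ℚ.≤ x → x ℚ.≤ y → ∀ k → pow x k ℚ.≤ pow y k
  pow-mono 0≤x x≤y zero    = ℚ.≤-refl
  pow-mono 0≤x x≤y (suc k) = *-mono-≤-nonNeg 0≤x (pow-nonNeg (ℚ.≤-trans 0≤x x≤y) k) x≤y (pow-mono 0≤x x≤y k)

  pow-antitone : ∀ {x} → 0ℚ ℚ.≤ x → x ℚ.≤ 1ℚ → ∀ {a b} → a ℕ.≤ b → pow x b ℚ.≤ pow x a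
  pow-antitone 0≤x x≤1 {b = zero}  ℕ.z≤n     = ℚ.≤-refl
  pow-antitone 0≤x x≤1 {b = suc b} ℕ.z≤n     = ℚ.≤-trans (*≤1 (pow-nonNeg 0≤x b) x≤1) (pow-antitone 0≤x x≤1 {b = b} ℕ.z≤n)
  pow-antitone {x} 0≤x x≤1         (ℕ.s≤s p) = *-monoˡ x 0≤x (pow-antitone 0≤x x≤1 p)

  pow-monotone : ∀ {x} → 1ℚ ℚ.≤ x → ∀ {a b} → a ℕ.≤ b → pow x a ℚ.≤ pow x b
  pow-monotone {x} 1≤x {b = zero}  ℕ.z≤n     = ℚ.≤-refl
  pow-monotone {x} 1≤x {b = suc b} ℕ.z≤n     = ℚ.≤-trans (pow-monotone 1≤x {b = b} ℕ.z≤n)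
    (subst (ℚ._≤ x ℚ.* pow x b) (ℚ.*-identityˡ (pow x b)) (*-monoʳ (pow x b) (pow-nonNeg (ℚ.≤-trans 0≤1 1≤x) b) 1≤x))
  pow-monotone {x} 1≤x             (ℕ.s≤s p) = *-monoˡ x (ℚ.≤-trans 0≤1 1≤x) (pow-monotone 1≤x p)

-- Weighted sums over lists, and counting by mass.

module Sums where

  open ℚLemmas

  sumBy : {A : Set} → (A → ℚ) → List A → ℚ
  sumBy f []       = 0ℚ
  sumBy f (x ∷ xs) = f x ℚ.+ sumBy f xs

  private variable
    A B : Set

  sumBy-++ : ∀ (f : A → ℚ) xs ys → sumBy f (xs ++ ys) ≡ sumBy f xs ℚ.+ sumBy f ys
  sumBy-++ f []       ys = sym (ℚ.+-identityˡ (sumBy f ys))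
  sumBy-++ f (x ∷ xs) ys = trans (cong (f x ℚ.+_) (sumBy-++ f xs ys)) (sym (ℚ.+-assoc (f x) (sumBy f xs) (sumBy f ys)))

  sumBy-map : ∀ (f : B → ℚ) (h : A → B) xs → sumBy f (map h xs) ≡ sumBy (f ∘ h) xs
  sumBy-map f h []       = refl
  sumBy-map f h (x ∷ xs) = cong (f (h x) ℚ.+_) (sumBy-map f h xs)

  sumBy-concatMap : ∀ (f : B → ℚ) (h : A → List B) xs → sumBy f (concatMap h xs) ≡ sumBy (λ x → sumBy f (h x)) xs
  sumBy-concatMap f h []       = refl
  sumBy-concatMap f h (x ∷ xs) = trans (sumBy-++ f (h x) (concatMap h xs)) (cong (sumBy f (h x) ℚ.+_) (sumBy-concatMap f h xs))

  sumBy-cong : ∀ {f h : A → ℚ} → (∀ x → f x ≡ h x) → ∀ xs → sumBy f xs ≡ sumBy h xs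
  sumBy-cong e []       = refl
  sumBy-cong e (x ∷ xs) = cong₂ ℚ._+_ (e x) (sumBy-cong e xs)

  sumBy-*ˡ : ∀ c (f : A → ℚ) xs → sumBy (λ x → c ℚ.* f x) xs ≡ c ℚ.* sumBy f xs
  sumBy-*ˡ c f []       = sym (ℚ.*-zeroʳ c)
  sumBy-*ˡ c f (x ∷ xs) = trans (cong (c ℚ.* f x ℚ.+_) (sumBy-*ˡ c f xs)) (sym (ℚ.*-distribˡ-+ c (f x) (sumBy f xs)))

  sumBy-*ʳ : ∀ c (f : A → ℚ) xs → sumBy (λ x → f x ℚ.* c) xs ≡ sumBy f xs ℚ.* c
  sumBy-*ʳ c f xs = trans (sumBy-cong (λ x → ℚ.*-comm (f x) c) xs) (trans (sumBy-*ˡ c f xs) (ℚ.*-comm c (sumBy f xs)))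

  sumBy-mono : ∀ {f h : A → ℚ} xs → (∀ {x} → x ∈ xs → f x ℚ.≤ h x) → sumBy f xs ℚ.≤ sumBy h xs
  sumBy-mono []       p = ℚ.≤-refl
  sumBy-mono (x ∷ xs) p = ℚ.+-mono-≤ (p (here refl)) (sumBy-mono xs (p ∘ there))

  sumBy-nonNeg : ∀ {f : A → ℚ} → (∀ x → 0ℚ ℚ.≤ f x) → ∀ xs → 0ℚ ℚ.≤ sumBy f xs
  sumBy-nonNeg p []       = ℚ.≤-refl
  sumBy-nonNeg p (x ∷ xs) = +-nonNeg (p x) (sumBy-nonNeg p xs)

  sumBy-const : ∀ c (xs : List A) → sumBy (λ _ → c) xs ≡ ℕ⇒ℚ (length xs) ℚ.* c
  sumBy-const c []       = sym (ℚ.*-zeroˡ c)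
  sumBy-const c (x ∷ xs) = trans (cong₂ ℚ._+_ (sym (ℚ.*-identityˡ c)) (sumBy-const c xs)) (sym (ℚ.*-distribʳ-+ c 1ℚ (ℕ⇒ℚ (length xs))))

  sumBy-filter : ∀ {f : A → ℚ} {P : A → Set} (P? : Decidable P) → (∀ x → 0ℚ ℚ.≤ f x) → ∀ xs → sumBy f (filter P? xs) ℚ.≤ sumBy f xs
  sumBy-filter         P? 0≤f []       = ℚ.≤-refl
  sumBy-filter {f = f} P? 0≤f (x ∷ xs) with P? x
  ... | yes _ = ℚ.+-monoʳ-≤ (f x) (sumBy-filter P? 0≤f xs)
  ... | no  _ = ℚ.≤-trans (sumBy-filter P? 0≤f xs) (subst (ℚ._≤ f x ℚ.+ sumBy f xs) (ℚ.+-identityˡ (sumBy f xs)) (ℚ.+-monoˡ-≤ (sumBy f xs) (0≤f x)))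

  private
    drop-∈ : ∀ {x z : A} as {bs} → z ≢ x → z ∈ as ++ x ∷ bs → z ∈ as ++ bs
    drop-∈ []       z≢x (here e)  = contradiction e z≢x
    drop-∈ []       z≢x (there p) = p
    drop-∈ (a ∷ as) z≢x (here e)  = here e
    drop-∈ (a ∷ as) z≢x (there p) = there (drop-∈ as z≢x p)

    fresh : ∀ {x z : A} {xs} → All (x ≢_) xs → z ∈ xs → z ≢ x
    fresh (p ∷ ps) (here refl) e = p (sym e)
    fresh (p ∷ ps) (there z∈)  e = fresh ps z∈ e

  sumBy-⊆ : ∀ {f : A → ℚ} → (∀ x → 0ℚ ℚ.≤ f x) → ∀ {xs ys} → Unique xs → (∀ {x} → x ∈ xs → x ∈ ys) → sumBy f xs ℚ.≤ sumBy f ys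
  sumBy-⊆         0≤f {[]}     {ys} _        _  = sumBy-nonNeg 0≤f ys
  sumBy-⊆ {f = f} 0≤f {x ∷ xs} (x∉ ∷ u) xs⊆ with ∈.∈-∃++ (xs⊆ (here refl))
  ... | as , bs , refl = ℚ.≤-trans (ℚ.+-monoʳ-≤ (f x) (sumBy-⊆ 0≤f u (λ z∈ → drop-∈ as (fresh x∉ z∈) (xs⊆ (there z∈)))))
    (ℚ.≤-reflexive (trans (cong (f x ℚ.+_) (sumBy-++ f as bs))
      (trans (solve 3 (λ x a b → x :+ (a :+ b) := a :+ (x :+ b)) refl (f x) (sumBy f as) (sumBy f bs)) (sym (sumBy-++ f as (x ∷ bs))))))
    where open +-*-Solver

  length-⊆ : ∀ {xs ys : List A} → Unique xs → (∀ {x} → x ∈ xs → x ∈ ys) → length xs ℕ.≤ length ys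
  length-⊆ {xs = []}     _        _   = ℕ.z≤n
  length-⊆ {xs = x ∷ xs} (x∉ ∷ u) xs⊆ with ∈.∈-∃++ (xs⊆ (here refl))
  ... | as , bs , refl = ℕ.≤-trans (ℕ.s≤s (length-⊆ u (λ z∈ → drop-∈ as (fresh x∉ z∈) (xs⊆ (there z∈)))))
    (ℕ.≤-reflexive (sym (length-insert as)))
    where
    length-insert : ∀ as → length (as ++ x ∷ bs) ≡ suc (length (as ++ bs))
    length-insert []       = refl
    length-insert (_ ∷ as) = cong suc (length-insert as)

  map-unique : ∀ (h : A → B) {xs} → (∀ {x y} → x ∈ xs → y ∈ xs → h x ≡ h y → x ≡ y) → Unique xs → Unique (map h xs)
  map-unique h inj []       = []
  map-unique h inj (x∉ ∷ u) = go x∉ (λ y∈ → inj (here refl) (there y∈)) ∷ map-unique h (λ x∈ y∈ → inj (there x∈) (there y∈)) u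
    where
    go : ∀ {x ys} → All (x ≢_) ys → (∀ {y} → y ∈ ys → h x ≡ h y → x ≡ y) → All (h x ≢_) (map h ys)
    go []       _ = []
    go (p ∷ ps) i = (λ e → p (i (here refl) e)) ∷ go ps (i ∘ there)

  -- The codes of `xs` are distinct members of `ys`, each weighing exactly `c`, so their joint mass
  -- is part of that of `ys`. The exponential bounds below use it with `c = r^g`.
  count≤mass : ∀ {f : B → ℚ} → (∀ x → 0ℚ ℚ.≤ f x) → ∀ c (code : A → B) {xs ys} → Unique xs →
               (∀ {x y} → x ∈ xs → y ∈ xs → code x ≡ code y → x ≡ y) →
               (∀ {x} → x ∈ xs → code x ∈ ys × f (code x) ≡ c) → ℕ⇒ℚ (length xs) ℚ.* c ℚ.≤ sumBy f ys
  count≤mass {f = f} 0≤f c code {xs} {ys} u inj ok = ℚ.≤-trans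
    (ℚ.≤-reflexive (trans (sym (sumBy-const c xs)) (trans (constant xs (proj₂ ∘ ok)) (sym (sumBy-map f code xs)))))
    (sumBy-⊆ 0≤f (map-unique code inj u) sub)
    where
    constant : ∀ zs → (∀ {z} → z ∈ zs → f (code z) ≡ c) → sumBy (λ _ → c) zs ≡ sumBy (f ∘ code) zs
    constant []       _ = refl
    constant (z ∷ zs) h = cong₂ ℚ._+_ (sym (h (here refl))) (constant zs (h ∘ there))
    sub : ∀ {b} → b ∈ map code xs → b ∈ ys
    sub b∈ with ∈.∈-map⁻ code b∈
    ... | x , x∈ , refl = proj₁ (ok x∈)

-- Words built from nested pairs, and the factorisation of their mass over chains.

module Regions where

  open ℚLemmas
  open Sums

  -- Slightly above 1/ω = 0.61803…; at r = 5/8 the bounds of LevelBounds are too weak.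
  r : ℚ
  r = ℤ.+ 31 ℚ./ 50

  2ℚ : ℚ
  2ℚ = ℤ.+ 2 ℚ./ 1

  0≤r : 0ℚ ℚ.≤ r
  0≤r = from-yes (0ℚ ℚ.≤? r)

  0≤2 : 0ℚ ℚ.≤ 2ℚ
  0≤2 = from-yes (0ℚ ℚ.≤? 2ℚ)

  Pair : Set
  Pair = ℕ × ℕ

  weight : Pair → ℚ
  weight (x , y) = pow r (x ℕ.+ y)

  weight-nonNeg : ∀ p → 0ℚ ℚ.≤ weight p
  weight-nonNeg (x , y) = pow-nonNeg 0≤r (x ℕ.+ y)

  mass : List (List ℕ) → ℚ
  mass = sumBy (λ c → pow r (sum c))

  record Level : Set where
    constructor level
    field
      letters : List ℕ
      floor   : ℕ

  open Level public

  states : Level → List Pair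
  states L = concatMap (λ x → map (x ,_) (filter (λ y → floor L ℕ.≤? x ℕ.+ y) (letters L))) (letters L)

  -- Along a chain the left member moves `a` places right and the right member `a` places left. With
  -- the letter 1 at position `a`, `w (i + a) ≤ w i + 1` bounds the new left letter by the old one
  -- and the old right letter by the new one.
  Step : Pair → Pair → Set
  Step (x , y) (x′ , y′) = x′ ℕ.≤ suc x × y ℕ.≤ suc y′

  step? : ∀ p q → Dec (Step p q)
  step? (x , y) (x′ , y′) = (x′ ℕ.≤? suc x) ×-dec (y ℕ.≤? suc y′)

  options : Level → Pair → List Pair
  options L p = filter (step? p) (states L)

  -- A transfer-matrix sum: the total weight of the chains of `n` pairs that start in `O` and move
  -- by `Step`.
  chainMass : Level → ℕ → List Pair → ℚ
  chainMass L zero    O = 1ℚ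
  chainMass L (suc n) O = sumBy (λ p → weight p ℚ.* chainMass L n (options L p)) O

  chainMass-nonNeg : ∀ L n O → 0ℚ ℚ.≤ chainMass L n O
  chainMass-nonNeg L zero    O = 0≤1
  chainMass-nonNeg L (suc n) O = sumBy-nonNeg (λ p → *-nonNeg (weight-nonNeg p) (chainMass-nonNeg L n (options L p))) O

  -- The words x₀ y₀ x₁ y₁ … of length n whose j-th pair (xⱼ , yⱼ) lies in the j-th
  -- list of the queue, where choosing a pair p appends options L p to the queue.
  gen : Level → List (List Pair) → ℕ → List (List ℕ)
  gen L Q       zero          = [] ∷ []
  gen L Q       (suc zero)    = map (_∷ []) (letters L)
  gen L []      (suc (suc n)) = []
  gen L (O ∷ Q) (suc (suc n)) =
    concatMap (λ p → map (λ c → proj₁ p ∷ proj₂ p ∷ c) (gen L (Q ∷ʳ options L p) n)) O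

  -- The entry of `ns` belonging to a list of the queue is the number of pairs in the chain which
  -- that list starts.
  queueMass : Level → List ℕ → List (List Pair) → ℚ
  queueMass L (n ∷ ns) (O ∷ Q) = chainMass L n O ℚ.* queueMass L ns Q
  queueMass L _        _       = 1ℚ

  private
    queueMass-∷ʳ : ∀ L ns Q n O → length ns ≡ length Q →
                   queueMass L (ns ∷ʳ n) (Q ∷ʳ O) ≡ queueMass L ns Q ℚ.* chainMass L n O
    queueMass-∷ʳ L []       []       n O e = ℚ.*-comm (chainMass L n O) 1ℚ
    queueMass-∷ʳ L (m ∷ ns) (P ∷ Q) n O e =
      trans (cong (chainMass L m P ℚ.*_) (queueMass-∷ʳ L ns Q n O (ℕ.suc-injective e)))
            (sym (ℚ.*-assoc (chainMass L m P) (queueMass L ns Q) (chainMass L n O)))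
    queueMass-∷ʳ L []      (_ ∷ _) n O ()
    queueMass-∷ʳ L (_ ∷ _) []      n O ()

    queueMass-replicate : ∀ L d → ∃[ ns ] length ns ≡ d × (∀ Q → queueMass L ns Q ≡ 1ℚ)
    queueMass-replicate L zero    = [] , refl , λ _ → refl
    queueMass-replicate L (suc d) with queueMass-replicate L d
    ... | ns , e , f = 0 ∷ ns , cong suc e , λ { [] → refl ; (O ∷ Q) → trans (ℚ.*-identityˡ (queueMass L ns Q)) (f Q) }

    take-++⁻ : ∀ {P : ℕ → Set} h xs {ys} → All P (take h (xs ++ ys)) → All P (take h xs)
    take-++⁻ zero    xs       _        = []
    take-++⁻ (suc h) []       _        = []
    take-++⁻ (suc h) (x ∷ xs) (p ∷ ps) = p ∷ take-++⁻ h xs ps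

  mass-pair : ∀ (p : Pair) cs → mass (map (λ c → proj₁ p ∷ proj₂ p ∷ c) cs) ≡ weight p ℚ.* mass cs
  mass-pair (x , y) cs = trans (sumBy-map (λ c → pow r (sum c)) (λ c → x ∷ y ∷ c) cs) (trans
    (sumBy-cong (λ c → trans (cong (pow r) (sym (ℕ.+-assoc x y (sum c)))) (pow-+ r (x ℕ.+ y) (sum c))) cs)
    (sumBy-*ˡ (weight (x , y)) (λ c → pow r (sum c)) cs))

  letterMass : Level → ℚ
  letterMass L = sumBy (pow r) (letters L)

  -- The j-th list of the queue is used once by every pair of its residue class
  -- modulo the length of the queue, so the mass factors over these classes.
  gen-mass : ∀ L → letterMass L ℚ.≤ 2ℚ → ∀ n d → ∃[ ns ] length ns ≡ d × All (1 ℕ.≤_) (take ⌊ n /2⌋ ns) ×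
             (∀ Q → length Q ≡ d → mass (gen L Q n) ℚ.≤ 2ℚ ℚ.* queueMass L ns Q)
  gen-mass L mid zero d with queueMass-replicate L d
  ... | ns , e , f = ns , e , [] , λ Q _ → subst (λ t → 1ℚ ℚ.≤ 2ℚ ℚ.* t) (sym (f Q)) (from-yes (1ℚ ℚ.≤? 2ℚ ℚ.* 1ℚ))
  gen-mass L mid (suc zero) d with queueMass-replicate L d
  ... | ns , e , f = ns , e , [] , λ Q _ → subst (λ t → mass (gen L Q 1) ℚ.≤ 2ℚ ℚ.* t) (sym (f Q))
    (ℚ.≤-trans (ℚ.≤-reflexive (trans (sumBy-map (λ c → pow r (sum c)) (_∷ []) (letters L)) (sumBy-cong (λ x → cong (pow r) (ℕ.+-identityʳ x)) (letters L))))
      (ℚ.≤-trans mid (ℚ.≤-reflexive (sym (ℚ.*-identityʳ 2ℚ)))))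
  -- An empty queue cannot supply a pair, so no word is generated and the mass is 0.
  gen-mass L mid (suc (suc n)) zero = [] , refl , [] , λ { [] _ → from-yes (0ℚ ℚ.≤? 2ℚ ℚ.* 1ℚ) }
  gen-mass L mid (suc (suc n)) (suc d) with gen-mass L mid n (suc d)
  ... | ns , e , pos , bound with initLast ns
  -- The list appended by the first pair stands last in the new queue and starts a chain of `c`
  -- pairs; together with the first pair this is a chain of `suc c` pairs, counted at the front.
  ... | cs ∷ʳ′ c = suc c ∷ cs , cong suc len , ℕ.s≤s ℕ.z≤n ∷ take-++⁻ ⌊ n /2⌋ cs pos , step
    where
    len : length cs ≡ d
    len = ℕ.suc-injective (trans (sym (trans (List.length-++ cs) (ℕ.+-comm (length cs) 1))) e)
    step : ∀ Q → length Q ≡ suc d → mass (gen L Q (suc (suc n))) ℚ.≤ 2ℚ ℚ.* queueMass L (suc c ∷ cs) Q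
    step (O ∷ Q) q = begin
      mass (gen L (O ∷ Q) (suc (suc n)))
        ≡⟨ sumBy-concatMap (λ c → pow r (sum c)) (λ p → map (λ c → proj₁ p ∷ proj₂ p ∷ c) (gen L (Q ∷ʳ options L p) n)) O ⟩
      sumBy (λ p → mass (map (λ c → proj₁ p ∷ proj₂ p ∷ c) (gen L (Q ∷ʳ options L p) n))) O
        ≡⟨ sumBy-cong (λ p → mass-pair p (gen L (Q ∷ʳ options L p) n)) O ⟩
      sumBy (λ p → weight p ℚ.* mass (gen L (Q ∷ʳ options L p) n)) O
        ≤⟨ sumBy-mono O (λ {p} _ → *-monoˡ (weight p) (weight-nonNeg p) (bound (Q ∷ʳ options L p)
             (trans (List.length-++ Q) (trans (ℕ.+-comm (length Q) 1) q)))) ⟩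
      sumBy (λ p → weight p ℚ.* (2ℚ ℚ.* queueMass L (cs ∷ʳ c) (Q ∷ʳ options L p))) O
        ≡⟨ sumBy-cong (λ p → trans
             (cong (λ t → weight p ℚ.* (2ℚ ℚ.* t)) (queueMass-∷ʳ L cs Q c (options L p) (trans len (sym (ℕ.suc-injective q)))))
             (solve 4 (λ w t q f → w :* (t :* (q :* f)) := (t :* q) :* (w :* f)) refl (weight p) 2ℚ (queueMass L cs Q) (chainMass L c (options L p)))) O ⟩
      sumBy (λ p → (2ℚ ℚ.* queueMass L cs Q) ℚ.* (weight p ℚ.* chainMass L c (options L p))) O
        ≡⟨ sumBy-*ˡ (2ℚ ℚ.* queueMass L cs Q) (λ p → weight p ℚ.* chainMass L c (options L p)) O ⟩
      (2ℚ ℚ.* queueMass L cs Q) ℚ.* chainMass L (suc c) O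
        ≡⟨ solve 3 (λ t q f → (t :* q) :* f := t :* (f :* q)) refl 2ℚ (queueMass L cs Q) (chainMass L (suc c) O) ⟩
      2ℚ ℚ.* queueMass L (suc c ∷ cs) (O ∷ Q) ∎
      where
      open ℚ.≤-Reasoning
      open +-*-Solver

  prodTo : (ℕ → ℚ) → ℕ → ℚ
  prodTo b zero    = 1ℚ
  prodTo b (suc d) = b 0 ℚ.* prodTo (b ∘ suc) d

  -- With `d ≤ ⌊ n /2⌋` every list of the queue is used at least once. Bounds are thus asked for
  -- nonempty chains only; an empty chain has mass 1, which may exceed `b j`.
  region-mass : ∀ L → letterMass L ℚ.≤ 2ℚ → ∀ (init : ℕ → List Pair) (b : ℕ → ℚ) d n → d ℕ.≤ ⌊ n /2⌋ →
                (∀ j → j ℕ.< d → ∀ t → chainMass L (suc t) (init j) ℚ.≤ b j) →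
                mass (gen L (applyUpTo init d) n) ℚ.≤ 2ℚ ℚ.* prodTo b d
  region-mass L mid init b d n d≤ bounds with gen-mass L mid n d
  ... | ns , e , pos , bound = ℚ.≤-trans (bound (applyUpTo init d) (List.length-applyUpTo init d))
      (*-monoˡ 2ℚ 0≤2 (go ns init b d e (subst (All (1 ℕ.≤_)) (List.take-all ⌊ n /2⌋ ns (subst (ℕ._≤ ⌊ n /2⌋) (sym e) d≤)) pos) bounds))
    where
    go : ∀ ns (init : ℕ → List Pair) (b : ℕ → ℚ) d → length ns ≡ d → All (1 ℕ.≤_) ns →
         (∀ j → j ℕ.< d → ∀ t → chainMass L (suc t) (init j) ℚ.≤ b j) → queueMass L ns (applyUpTo init d) ℚ.≤ prodTo b d
    go []           init b zero    _ _        _  = ℚ.≤-refl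
    go (suc t ∷ ns) init b (suc d) e (_ ∷ ps) bd = *-mono-≤-nonNeg (chainMass-nonNeg L (suc t) (init 0))
      (prodTo-nonNeg (b ∘ suc) d (λ j j< → ℚ.≤-trans (chainMass-nonNeg L 1 (init (suc j))) (bd (suc j) (ℕ.s≤s j<) 0)))
      (bd 0 (ℕ.s≤s ℕ.z≤n) t)
      (go ns (init ∘ suc) (b ∘ suc) d (ℕ.suc-injective e) ps (λ j j< → bd (suc j) (ℕ.s≤s j<)))
      where
      prodTo-nonNeg : ∀ (b : ℕ → ℚ) d → (∀ j → j ℕ.< d → 0ℚ ℚ.≤ b j) → 0ℚ ℚ.≤ prodTo b d
      prodTo-nonNeg b zero    _ = 0≤1
      prodTo-nonNeg b (suc d) h = *-nonNeg (h 0 (ℕ.s≤s ℕ.z≤n)) (prodTo-nonNeg (b ∘ suc) d (λ j j< → h (suc j) (ℕ.s≤s j<)))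

-- Numerical bounds for the chain masses at each level.

module LevelBounds where

  open ℚLemmas
  open Sums
  open Regions

  noX : Level → List Pair
  noX L = filter (λ p → ¬? (proj₁ p ℕ.≟ 1)) (states L)

  noXY : Level → List Pair
  noXY L = filter (λ p → ¬? (proj₂ p ℕ.≟ 1)) (noX L)

  -- `κ` is the gain per letter known to differ from 1. The outer region has at most one chain
  -- without such a letter, and that one may cost 2; `letterMass` is for the middle letter of a
  -- region of odd length.
  record OuterBound (L : Level) (κ : ℚ) : Set where
    field
      letterMass≤2 : letterMass L ℚ.≤ 2ℚ
      all≤2        : ∀ t → chainMass L (suc t) (states L) ℚ.≤ 2ℚ
      noX≤κ        : ∀ t → chainMass L (suc t) (noX L) ℚ.≤ κ
      noXY≤κ²      : ∀ t → chainMass L (suc t) (noXY L) ℚ.≤ κ ℚ.* κ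

  record InnerBound (L : Level) (τ : ℚ) : Set where
    field
      letterMass≤2 : letterMass L ℚ.≤ 2ℚ
      all≤τ        : ∀ t → chainMass L (suc t) (states L) ℚ.≤ τ
      noX≤1        : ∀ t → chainMass L (suc t) (noX L) ℚ.≤ 1ℚ

  module _ (L : Level) where

    -- If all pairs together weigh at most 1, every continuation has mass at most 1, so a chain
    -- weighs no more than its first pair.
    chainMass-subunit : sumBy weight (states L) ℚ.≤ 1ℚ → ∀ t O → chainMass L (suc t) O ℚ.≤ sumBy weight O
    options≤1 : sumBy weight (states L) ℚ.≤ 1ℚ → ∀ t p → chainMass L t (options L p) ℚ.≤ 1ℚ

    chainMass-subunit h t O = sumBy-mono O λ {p} _ →
      subst (weight p ℚ.* chainMass L t (options L p) ℚ.≤_) (ℚ.*-identityʳ (weight p)) (*-monoˡ (weight p) (weight-nonNeg p) (options≤1 h t p))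

    options≤1 h zero    p = ℚ.≤-refl
    options≤1 h (suc t) p = ℚ.≤-trans (chainMass-subunit h t (options L p))
      (ℚ.≤-trans (sumBy-filter (step? p) weight-nonNeg (states L)) h)

    -- Levels 3 and 4 have total pair weight above 1, so the step condition must be exploited. If
    -- after each pair two further steps weigh no more than one, induction makes the mass decrease
    -- with the length, and finitely many checks settle all lengths.
    Contracting : Set
    Contracting = All (λ p → chainMass L 2 (options L p) ℚ.≤ chainMass L 1 (options L p)) (states L)

    contracting? : Dec Contracting
    contracting? = All.all? (λ p → chainMass L 2 (options L p) ℚ.≤? chainMass L 1 (options L p)) (states L)

    module _ (h : Contracting) where

      private
        decrease : ∀ t {p} → p ∈ states L → chainMass L (suc (suc t)) (options L p) ℚ.≤ chainMass L (suc t) (options L p)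
        decrease zero        p∈ = All.lookup h p∈
        decrease (suc t) {p} p∈ = sumBy-mono (options L p) λ {q} q∈ →
          *-monoˡ (weight q) (weight-nonNeg q) (decrease t (proj₁ (∈.∈-filter⁻ (step? p) {xs = states L} q∈)))

        below-first : ∀ t {p} → p ∈ states L → chainMass L (suc t) (options L p) ℚ.≤ chainMass L 1 (options L p)
        below-first zero    p∈ = ℚ.≤-refl
        below-first (suc t) p∈ = ℚ.≤-trans (decrease t p∈) (below-first t p∈)

      -- After the first pair, a longer continuation weighs no more than a single pair does, so
      -- length 2 dominates all greater lengths. Length 1 is checked separately, since the first
      -- step from `O` may still increase the mass.
      chainMass-contracting : ∀ {b} O → (∀ {p} → p ∈ O → p ∈ states L) →
        chainMass L 1 O ℚ.≤ b → chainMass L 2 O ℚ.≤ b → ∀ t → chainMass L (suc t) O ℚ.≤ b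
      chainMass-contracting O O⊆ b₁ b₂ zero    = b₁
      chainMass-contracting O O⊆ b₁ b₂ (suc t) = ℚ.≤-trans
        (sumBy-mono O (λ {p} p∈ → *-monoˡ (weight p) (weight-nonNeg p) (below-first t (O⊆ p∈)))) b₂

    noX⊆ : ∀ {p} → p ∈ noX L → p ∈ states L
    noX⊆ p∈ = proj₁ (∈.∈-filter⁻ (λ p → ¬? (proj₁ p ℕ.≟ 1)) {xs = states L} p∈)

    noXY⊆ : ∀ {p} → p ∈ noXY L → p ∈ states L
    noXY⊆ p∈ = noX⊆ (proj₁ (∈.∈-filter⁻ (λ p → ¬? (proj₂ p ℕ.≟ 1)) {xs = noX L} p∈))

  -- A position known not to carry the letter 1 gains a factor κ₄ in an outer
  -- region; this pays for the chains of mass up to τ₄ = 1 / κ₄ in the inner region.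
  κ₄ τ₄ : ℚ
  κ₄ = ℤ.+ 6 ℚ./ 7
  τ₄ = ℤ.+ 7 ℚ./ 6

  L₀ L₃ L₄ L₅ : Level
  L₀ = level [] 0
  L₃ = level (1 ∷ 2 ∷ 3 ∷ []) 3
  L₄ = level (1 ∷ 2 ∷ 3 ∷ 4 ∷ []) 4
  L₅ = level (1 ∷ 2 ∷ 3 ∷ 4 ∷ 5 ∷ []) 5

  L₃-contracting : Contracting L₃
  L₃-contracting = from-yes (contracting? L₃)

  L₄-contracting : Contracting L₄
  L₄-contracting = from-yes (contracting? L₄)

  L₃-outer : OuterBound L₃ 1ℚ
  L₃-outer = record
    { letterMass≤2 = from-yes (letterMass L₃ ℚ.≤? 2ℚ)
    ; all≤2   = chainMass-contracting L₃ L₃-contracting (states L₃) id (from-yes (chainMass L₃ 1 (states L₃) ℚ.≤? 2ℚ)) (from-yes (chainMass L₃ 2 (states L₃) ℚ.≤? 2ℚ))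
    ; noX≤κ   = chainMass-contracting L₃ L₃-contracting (noX L₃) (noX⊆ L₃) (from-yes (chainMass L₃ 1 (noX L₃) ℚ.≤? 1ℚ)) (from-yes (chainMass L₃ 2 (noX L₃) ℚ.≤? 1ℚ))
    ; noXY≤κ² = chainMass-contracting L₃ L₃-contracting (noXY L₃) (noXY⊆ L₃) (from-yes (chainMass L₃ 1 (noXY L₃) ℚ.≤? 1ℚ ℚ.* 1ℚ)) (from-yes (chainMass L₃ 2 (noXY L₃) ℚ.≤? 1ℚ ℚ.* 1ℚ))
    }

  L₃-inner : InnerBound L₃ τ₄
  L₃-inner = record
    { letterMass≤2 = from-yes (letterMass L₃ ℚ.≤? 2ℚ)
    ; all≤τ = chainMass-contracting L₃ L₃-contracting (states L₃) id (from-yes (chainMass L₃ 1 (states L₃) ℚ.≤? τ₄)) (from-yes (chainMass L₃ 2 (states L₃) ℚ.≤? τ₄))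
    ; noX≤1 = OuterBound.noX≤κ L₃-outer
    }

  L₄-outer : OuterBound L₄ κ₄
  L₄-outer = record
    { letterMass≤2 = from-yes (letterMass L₄ ℚ.≤? 2ℚ)
    ; all≤2   = chainMass-contracting L₄ L₄-contracting (states L₄) id (from-yes (chainMass L₄ 1 (states L₄) ℚ.≤? 2ℚ)) (from-yes (chainMass L₄ 2 (states L₄) ℚ.≤? 2ℚ))
    ; noX≤κ   = chainMass-contracting L₄ L₄-contracting (noX L₄) (noX⊆ L₄) (from-yes (chainMass L₄ 1 (noX L₄) ℚ.≤? κ₄)) (from-yes (chainMass L₄ 2 (noX L₄) ℚ.≤? κ₄))
    ; noXY≤κ² = chainMass-contracting L₄ L₄-contracting (noXY L₄) (noXY⊆ L₄) (from-yes (chainMass L₄ 1 (noXY L₄) ℚ.≤? κ₄ ℚ.* κ₄)) (from-yes (chainMass L₄ 2 (noXY L₄) ℚ.≤? κ₄ ℚ.* κ₄))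
    }

  L₄-inner : InnerBound L₄ τ₄
  L₄-inner = record
    { letterMass≤2 = from-yes (letterMass L₄ ℚ.≤? 2ℚ)
    ; all≤τ = chainMass-contracting L₄ L₄-contracting (states L₄) id (from-yes (chainMass L₄ 1 (states L₄) ℚ.≤? τ₄)) (from-yes (chainMass L₄ 2 (states L₄) ℚ.≤? τ₄))
    ; noX≤1 = λ t → ℚ.≤-trans (OuterBound.noX≤κ L₄-outer t) (from-yes (κ₄ ℚ.≤? 1ℚ))
    }

  -- From level 5 on the pair weights alone sum to at most 1; here the sum is about 0.89.
  L₅-subunit : sumBy weight (states L₅) ℚ.≤ 1ℚ
  L₅-subunit = from-yes (sumBy weight (states L₅) ℚ.≤? 1ℚ)

  L₅-outer : OuterBound L₅ κ₄
  L₅-outer = record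
    { letterMass≤2 = from-yes (letterMass L₅ ℚ.≤? 2ℚ)
    ; all≤2   = λ t → ℚ.≤-trans (chainMass-subunit L₅ L₅-subunit t (states L₅)) (ℚ.≤-trans L₅-subunit (from-yes (1ℚ ℚ.≤? 2ℚ)))
    ; noX≤κ   = λ t → ℚ.≤-trans (chainMass-subunit L₅ L₅-subunit t (noX L₅)) (from-yes (sumBy weight (noX L₅) ℚ.≤? κ₄))
    ; noXY≤κ² = λ t → ℚ.≤-trans (chainMass-subunit L₅ L₅-subunit t (noXY L₅)) (from-yes (sumBy weight (noXY L₅) ℚ.≤? κ₄ ℚ.* κ₄))
    }

  subunit⇒noX≤1 : ∀ L → sumBy weight (states L) ℚ.≤ 1ℚ → ∀ t → chainMass L (suc t) (noX L) ℚ.≤ 1ℚ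
  subunit⇒noX≤1 L h t = ℚ.≤-trans (chainMass-subunit L h t (noX L))
    (ℚ.≤-trans (sumBy-filter (λ p → ¬? (proj₁ p ℕ.≟ 1)) weight-nonNeg (states L)) h)

  subunit⇒noXY≤1 : ∀ L → sumBy weight (states L) ℚ.≤ 1ℚ → ∀ t → chainMass L (suc t) (noXY L) ℚ.≤ 1ℚ
  subunit⇒noXY≤1 L h t = ℚ.≤-trans (chainMass-subunit L h t (noXY L))
    (ℚ.≤-trans (sumBy-filter (λ p → ¬? (proj₂ p ℕ.≟ 1)) weight-nonNeg (noX L))
    (ℚ.≤-trans (sumBy-filter (λ p → ¬? (proj₁ p ℕ.≟ 1)) weight-nonNeg (states L)) h))

  subunit⇒inner : ∀ L → letterMass L ℚ.≤ 2ℚ → sumBy weight (states L) ℚ.≤ 1ℚ → InnerBound L 1ℚ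
  subunit⇒inner L m h = record
    { letterMass≤2 = m
    ; all≤τ = λ t → ℚ.≤-trans (chainMass-subunit L h t (states L)) h
    ; noX≤1 = subunit⇒noX≤1 L h
    }

  subunit⇒outer : ∀ L → letterMass L ℚ.≤ 2ℚ → sumBy weight (states L) ℚ.≤ 1ℚ → OuterBound L 1ℚ
  subunit⇒outer L m h = record
    { letterMass≤2 = m
    ; all≤2   = λ t → ℚ.≤-trans (chainMass-subunit L h t (states L)) (ℚ.≤-trans h (from-yes (1ℚ ℚ.≤? 2ℚ)))
    ; noX≤κ   = subunit⇒noX≤1 L h
    ; noXY≤κ² = λ t → ℚ.≤-trans (subunit⇒noXY≤1 L h t) (ℚ.≤-reflexive (sym (ℚ.*-identityˡ 1ℚ)))
    }

  L₀-inner : InnerBound L₀ 1ℚ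
  L₀-inner = subunit⇒inner L₀ 0≤2 0≤1

  L₅-inner : InnerBound L₅ 1ℚ
  L₅-inner = subunit⇒inner L₅ (OuterBound.letterMass≤2 L₅-outer) L₅-subunit

  range : ℕ → ℕ → List ℕ
  range lo zero    = []
  range lo (suc k) = lo ∷ range (suc lo) k

  ∈-range : ∀ {lo k x} → lo ℕ.≤ x → x ℕ.< lo ℕ.+ k → x ∈ range lo k
  ∈-range {lo} {zero}  lo≤x x< = contradiction (ℕ.≤-trans (ℕ.s≤s lo≤x) (subst (_ ℕ.≤_) (ℕ.+-identityʳ lo) x<)) ℕ.1+n≰n
  ∈-range {lo} {suc k} {x} lo≤x x< with lo ℕ.≟ x
  ... | yes refl = here refl
  ... | no  lo≢x = there (∈-range (ℕ.≤∧≢⇒< lo≤x lo≢x) (subst (x ℕ.<_) (ℕ.+-suc lo k) x<))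

  -- `B` only makes the alphabet finite; the estimates below are uniform in it.
  L₆ : ℕ → Level
  L₆ B = level (range 1 B) 6

  private
    -- c = 1 / (1 - r)
    c : ℚ
    c = ℤ.+ 50 ℚ./ 19

    0≤c : 0ℚ ℚ.≤ c
    0≤c = from-yes (0ℚ ℚ.≤? c)

    geometric-step : ∀ a → a ℚ.+ c ℚ.* (r ℚ.* a) ≡ c ℚ.* a
    geometric-step a = trans (solve 3 (λ c r a → a :+ c :* (r :* a) := (con 1ℚ :+ c :* r) :* a) refl c r a) refl
      where open +-*-Solver

    geometric : ∀ k lo → sumBy (pow r) (range lo k) ℚ.≤ c ℚ.* pow r lo
    geometric zero    lo = *-nonNeg 0≤c (pow-nonNeg 0≤r lo)
    geometric (suc k) lo = ℚ.≤-trans (ℚ.+-monoʳ-≤ (pow r lo) (geometric k (suc lo))) (ℚ.≤-reflexive (geometric-step (pow r lo)))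

    -- The partners of `x` start at `6 - x`, so they weigh at most the geometric tail from there or
    -- from `lo`, whichever is larger.
    inner : ∀ x (large? : Decidable (λ y → 6 ℕ.≤ x ℕ.+ y)) k lo →
            sumBy (pow r) (filter large? (range lo k)) ℚ.≤ c ℚ.* pow r (lo ℕ.⊔ (6 ℕ.∸ x))
    inner x large? zero    lo = *-nonNeg 0≤c (pow-nonNeg 0≤r (lo ℕ.⊔ (6 ℕ.∸ x)))
    inner x large? (suc k) lo with large? lo
    ... | yes p = ℚ.≤-trans (ℚ.+-monoʳ-≤ (pow r lo) (inner x large? k (suc lo)))
      (ℚ.≤-reflexive (trans (cong (λ t → pow r lo ℚ.+ c ℚ.* pow r t) (ℕ.m≥n⇒m⊔n≡m (ℕ.m≤n⇒m≤1+n 6∸x≤lo)))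
        (trans (geometric-step (pow r lo)) (cong (λ t → c ℚ.* pow r t) (sym (ℕ.m≥n⇒m⊔n≡m 6∸x≤lo))))))
      where
      6∸x≤lo : 6 ℕ.∸ x ℕ.≤ lo
      6∸x≤lo = ℕ.m≤n+o⇒m∸n≤o 6 x p
    ... | no  p = ℚ.≤-trans (inner x large? k (suc lo)) (ℚ.≤-reflexive (cong (λ t → c ℚ.* pow r t)
        (trans (ℕ.m≤n⇒m⊔n≡n lo<) (sym (ℕ.m≤n⇒m⊔n≡n (ℕ.<⇒≤ lo<))))))
      where
      lo< : lo ℕ.< 6 ℕ.∸ x
      lo< = ℕ.m+n≤o⇒m≤o∸n (suc lo) (subst (ℕ._≤ 6) (cong suc (ℕ.+-comm x lo)) (ℕ.≰⇒> p))

    -- Bounds the row of pairs with left letter `x`. From `x = 6` on every right letter is allowed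
    -- and the rows form a geometric series; the five earlier rows are evaluated one by one.
    term : ℕ → ℚ
    term x = pow r x ℚ.* (c ℚ.* pow r (1 ℕ.⊔ (6 ℕ.∸ x)))

    tail : ∀ k lo → 6 ℕ.≤ lo → sumBy term (range lo k) ℚ.≤ c ℚ.* pow r lo ℚ.* (c ℚ.* pow r 1)
    tail zero    lo _ = *-nonNeg (*-nonNeg 0≤c (pow-nonNeg 0≤r lo)) (*-nonNeg 0≤c (pow-nonNeg 0≤r 1))
    tail (suc k) lo h = ℚ.≤-trans (ℚ.+-mono-≤ (ℚ.≤-reflexive (cong (λ t → pow r lo ℚ.* (c ℚ.* pow r (1 ℕ.⊔ t))) (ℕ.m≤n⇒m∸n≡0 h))) (tail k (suc lo) (ℕ.m≤n⇒m≤1+n h)))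
      (ℚ.≤-reflexive (trans (sym (ℚ.*-distribʳ-+ (c ℚ.* pow r 1) (pow r lo) (c ℚ.* pow r (suc lo)))) (cong (ℚ._* (c ℚ.* pow r 1)) (geometric-step (pow r lo)))))

    peel-term : ∀ {b} lo → 0ℚ ℚ.≤ b → (∀ k → sumBy term (range (suc lo) k) ℚ.≤ b) → ∀ k → sumBy term (range lo k) ℚ.≤ term lo ℚ.+ b
    peel-term lo 0≤b h zero    = +-nonNeg (*-nonNeg (pow-nonNeg 0≤r lo) (*-nonNeg 0≤c (pow-nonNeg 0≤r (1 ℕ.⊔ (6 ℕ.∸ lo))))) 0≤b
    peel-term lo 0≤b h (suc k) = ℚ.+-monoʳ-≤ (term lo) (h k)

    b₆ b₅ b₄ b₃ b₂ : ℚ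
    b₆ = c ℚ.* pow r 6 ℚ.* (c ℚ.* pow r 1)
    b₅ = term 5 ℚ.+ b₆
    b₄ = term 4 ℚ.+ b₅
    b₃ = term 3 ℚ.+ b₄
    b₂ = term 2 ℚ.+ b₃

    term-sum : ∀ k → sumBy term (range 1 k) ℚ.≤ term 1 ℚ.+ b₂
    term-sum = peel-term 1 (from-yes (0ℚ ℚ.≤? b₂)) (peel-term 2 (from-yes (0ℚ ℚ.≤? b₃)) (peel-term 3 (from-yes (0ℚ ℚ.≤? b₄))
      (peel-term 4 (from-yes (0ℚ ℚ.≤? b₅)) (peel-term 5 (from-yes (0ℚ ℚ.≤? b₆)) (λ k → tail k 6 ℕ.≤-refl)))))

  L₆-subunit : ∀ B → sumBy weight (states (L₆ B)) ℚ.≤ 1ℚ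
  L₆-subunit B = ℚ.≤-trans (ℚ.≤-reflexive (sumBy-concatMap weight (λ x → map (x ,_) (partners x)) (range 1 B)))
    (ℚ.≤-trans (sumBy-mono (range 1 B) (λ {x} _ → row x)) (ℚ.≤-trans (term-sum B) (from-yes (term 1 ℚ.+ b₂ ℚ.≤? 1ℚ))))
    where
    partners : ℕ → List ℕ
    partners x = filter (λ y → 6 ℕ.≤? x ℕ.+ y) (range 1 B)
    row : ∀ x → sumBy weight (map (x ,_) (partners x)) ℚ.≤ term x
    row x = ℚ.≤-trans (ℚ.≤-reflexive (trans (sumBy-map weight (x ,_) (partners x))
      (trans (sumBy-cong (pow-+ r x) (partners x)) (sumBy-*ˡ (pow r x) (pow r) (partners x)))))
      (*-monoˡ (pow r x) (pow-nonNeg 0≤r x) (inner x (λ y → 6 ℕ.≤? x ℕ.+ y) B 1))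

  L₆-letterMass : ∀ B → letterMass (L₆ B) ℚ.≤ 2ℚ
  L₆-letterMass B = ℚ.≤-trans (geometric B 1) (from-yes (c ℚ.* pow r 1 ℚ.≤? 2ℚ))

  L₆-outer : ∀ B → OuterBound (L₆ B) 1ℚ
  L₆-outer B = subunit⇒outer (L₆ B) (L₆-letterMass B) (L₆-subunit B)

-- Balancing gains and costs over the two regions of a word.

module Schemes where

  open ℚLemmas
  open Sums
  open Regions
  open LevelBounds

  pick : Level → Bool → Bool → List Pair
  pick L true  true  = noXY L
  pick L true  false = noX L
  pick L false _     = states L

  -- Positions run from 1 to n, the j-th pair sits at positions 1 + j and n - j,
  -- and the letters at positions below a are known to differ from 1.
  outerInit : Level → ℕ → ℕ → ℕ → List Pair
  outerInit L a n j = pick L (suc j ℕ.<ᵇ a) (n ℕ.∸ j ℕ.<ᵇ a)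

  -- Here `a` is counted from the start of the region. Only the left member is recorded, because
  -- `noX` already brings an inner chain down to mass 1.
  innerInit : Level → ℕ → ℕ → List Pair
  innerInit L a j = pick L (suc j ℕ.<ᵇ a) false

  private
    choose : Bool → ℚ → ℚ → ℚ
    choose true  x y = x
    choose false x y = y

    choose-true : ∀ {b x y} → T b → choose b x y ≡ x
    choose-true {true} _ = refl

    choose-≤ : ∀ b {x y z} → x ℚ.≤ z → y ℚ.≤ z → choose b x y ℚ.≤ z
    choose-≤ true  p q = p
    choose-≤ false p q = q

    choose-≥ : ∀ b {x y z} → z ℚ.≤ x → z ℚ.≤ y → z ℚ.≤ choose b x y
    choose-≥ true  p q = p
    choose-≥ false p q = q

  n≤1+2⌊n/2⌋ : ∀ n → n ℕ.≤ suc (⌊ n /2⌋ ℕ.+ ⌊ n /2⌋)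
  n≤1+2⌊n/2⌋ zero          = ℕ.z≤n
  n≤1+2⌊n/2⌋ (suc zero)    = ℕ.≤-refl
  n≤1+2⌊n/2⌋ (suc (suc n)) = ℕ.s≤s (ℕ.≤-trans (ℕ.s≤s (n≤1+2⌊n/2⌋ n)) (ℕ.≤-reflexive (cong suc (sym (ℕ.+-suc ⌊ n /2⌋ ⌊ n /2⌋)))))

  1+m∸n≤ : ∀ m n → suc m ℕ.∸ n ℕ.≤ suc (m ℕ.∸ n)
  1+m∸n≤ m n = ℕ.m≤n+o⇒m∸n≤o (suc m) n (ℕ.≤-trans (ℕ.s≤s (ℕ.m≤n+m∸n m n)) (ℕ.≤-reflexive (sym (ℕ.+-suc n (m ℕ.∸ n)))))

  module _ {κ : ℚ} (0≤κ : 0ℚ ℚ.≤ κ) where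

    prodTo-last : ∀ e (b : ℕ → ℚ) → (∀ j → 0ℚ ℚ.≤ b j) → (∀ j → j ℕ.< e → b j ℚ.≤ κ) → b e ℚ.≤ 2ℚ → prodTo b (suc e) ℚ.≤ 2ℚ ℚ.* pow κ e
    prodTo-last zero    b 0≤b b≤ last = *-monoʳ 1ℚ 0≤1 last
    prodTo-last (suc e) b 0≤b b≤ last = ℚ.≤-trans
      (*-mono-≤-nonNeg (0≤b 0) (*-nonNeg 0≤2 (pow-nonNeg 0≤κ e)) (b≤ 0 (ℕ.s≤s ℕ.z≤n)) (prodTo-last e (b ∘ suc) (0≤b ∘ suc) (λ j j< → b≤ (suc j) (ℕ.s≤s j<)) last))
      (ℚ.≤-reflexive (solve 3 (λ k t p → k :* (t :* p) := t :* (k :* p)) refl κ 2ℚ (pow κ e)))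
      where open +-*-Solver

    prodTo-squares : κ ℚ.≤ 1ℚ → ∀ h c (b : ℕ → ℚ) → (∀ j → 0ℚ ℚ.≤ b j) → (∀ j → b j ℚ.≤ κ) → (∀ j → c ℕ.≤ j → b j ℚ.≤ κ ℚ.* κ) →
                     prodTo b h ℚ.≤ pow κ ((h ℕ.+ h) ℕ.∸ c)
    prodTo-squares κ≤1 zero    c       b 0≤b b≤ b≤² = ℚ.≤-reflexive (cong (pow κ) (sym (ℕ.0∸n≡0 c)))
    prodTo-squares κ≤1 (suc h) zero    b 0≤b b≤ b≤² = ℚ.≤-trans
      (*-mono-≤-nonNeg (0≤b 0) (pow-nonNeg 0≤κ (h ℕ.+ h)) (b≤² 0 ℕ.z≤n) (prodTo-squares κ≤1 h zero (b ∘ suc) (0≤b ∘ suc) (b≤ ∘ suc) (λ j _ → b≤² (suc j) ℕ.z≤n)))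
      (ℚ.≤-reflexive (trans (ℚ.*-assoc κ κ (pow κ (h ℕ.+ h))) (cong (pow κ ∘ suc) (sym (ℕ.+-suc h h)))))
    prodTo-squares κ≤1 (suc h) (suc c) b 0≤b b≤ b≤² = ℚ.≤-trans
      (*-mono-≤-nonNeg (0≤b 0) (pow-nonNeg 0≤κ (h ℕ.+ h ℕ.∸ c)) (b≤ 0) (prodTo-squares κ≤1 h c (b ∘ suc) (0≤b ∘ suc) (b≤ ∘ suc) (λ j c≤j → b≤² (suc j) (ℕ.s≤s c≤j))))
      (pow-antitone 0≤κ κ≤1 (ℕ.≤-trans (ℕ.≤-reflexive (cong (ℕ._∸ c) (ℕ.+-suc h h))) (1+m∸n≤ (h ℕ.+ h) c)))

  -- The region has `(a ⊓ suc n) ∸ 1` positions before `a`; one of them is given away for a middle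
  -- letter, which belongs to no pair.
  outer-mass : ∀ {L κ} → 0ℚ ℚ.≤ κ → κ ℚ.≤ 1ℚ → OuterBound L κ → ∀ a n → 1 ℕ.≤ a →
               mass (gen L (applyUpTo (outerInit L a n) (a ℕ.⊓ ⌊ n /2⌋)) n) ℚ.≤ 2ℚ ℚ.* (2ℚ ℚ.* pow κ ((a ℕ.⊓ suc n) ℕ.∸ 2))
  outer-mass {L} {κ} 0≤κ κ≤1 bound (suc e) n _ with suc e ℕ.≤? ⌊ n /2⌋
  -- The first `e` chains start before position `a` and gain `κ` each; the last starts at position
  -- `a` itself, where the letter 1 may stand, and is allowed 2.
  ... | yes a≤h = subst (λ d → mass (gen L (applyUpTo (outerInit L (suc e) n) d) n) ℚ.≤ 2ℚ ℚ.* (2ℚ ℚ.* pow κ ((suc e ℕ.⊓ suc n) ℕ.∸ 2)))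
      (sym (ℕ.m≤n⇒m⊓n≡m a≤h))
      (ℚ.≤-trans (region-mass L letterMass≤2 (outerInit L (suc e) n) b (suc e) n a≤h (λ j _ t → init≤ j t))
        (*-monoˡ 2ℚ 0≤2 (ℚ.≤-trans
          (prodTo-last 0≤κ e b (λ j → choose-≥ (suc j ℕ.<ᵇ suc e) 0≤κ 0≤2) (λ j j<e → ℚ.≤-reflexive (choose-true {suc j ℕ.<ᵇ suc e} (ℕ.<⇒<ᵇ (ℕ.s≤s j<e)))) (choose-≤ (suc e ℕ.<ᵇ suc e) κ≤2 ℚ.≤-refl))
          (*-monoˡ 2ℚ 0≤2 (pow-antitone 0≤κ κ≤1 (ℕ.≤-trans (ℕ.∸-monoˡ-≤ 2 (ℕ.m⊓n≤m (suc e) (suc n))) (ℕ.m∸n≤m e 1)))))))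
    where
    open OuterBound bound
    κ≤2 : κ ℚ.≤ 2ℚ
    κ≤2 = ℚ.≤-trans κ≤1 (from-yes (1ℚ ℚ.≤? 2ℚ))
    b : ℕ → ℚ
    b j = choose (suc j ℕ.<ᵇ suc e) κ 2ℚ
    init≤ : ∀ j t → chainMass L (suc t) (outerInit L (suc e) n j) ℚ.≤ b j
    init≤ j t with suc j ℕ.<ᵇ suc e | n ℕ.∸ j ℕ.<ᵇ suc e
    ... | true  | true  = ℚ.≤-trans (noXY≤κ² t) (*≤1 0≤κ κ≤1)
    ... | true  | false = noX≤κ t
    ... | false | _     = all≤2 t
  -- Every chain is a single pair whose left letter is known to differ from 1. The right letter is
  -- known too once `n ∸ j < a`, that is from `j = suc n ∸ a` on, and such a pair gains `κ²`.
  ... | no  a≰h = subst (λ d → mass (gen L (applyUpTo (outerInit L a n) d) n) ℚ.≤ 2ℚ ℚ.* (2ℚ ℚ.* pow κ ((a ℕ.⊓ suc n) ℕ.∸ 2)))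
      (sym (ℕ.m≥n⇒m⊓n≡n (ℕ.<⇒≤ h<a)))
      (ℚ.≤-trans (region-mass L letterMass≤2 (outerInit L a n) b h n ℕ.≤-refl init≤)
        (*-monoˡ 2ℚ 0≤2 (ℚ.≤-trans
          (prodTo-squares 0≤κ κ≤1 h (suc n ℕ.∸ a) b (λ j → choose-≥ (n ℕ.∸ j ℕ.<ᵇ a) (*-nonNeg 0≤κ 0≤κ) 0≤κ)
            (λ j → choose-≤ (n ℕ.∸ j ℕ.<ᵇ a) (*≤1 0≤κ κ≤1) ℚ.≤-refl)
            (λ j c≤j → ℚ.≤-reflexive (choose-true {n ℕ.∸ j ℕ.<ᵇ a} (ℕ.<⇒<ᵇ (near j c≤j)))))
          (ℚ.≤-trans (pow-antitone 0≤κ κ≤1 exponent)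
            (subst (ℚ._≤ 2ℚ ℚ.* pow κ ((a ℕ.⊓ suc n) ℕ.∸ 2)) (ℚ.*-identityˡ _) (*-monoʳ _ (pow-nonNeg 0≤κ ((a ℕ.⊓ suc n) ℕ.∸ 2)) (from-yes (1ℚ ℚ.≤? 2ℚ))))))))
    where
    open OuterBound bound
    a h : ℕ
    a = suc e
    h = ⌊ n /2⌋
    h<a : h ℕ.< a
    h<a = ℕ.≰⇒> a≰h
    b : ℕ → ℚ
    b j = choose (n ℕ.∸ j ℕ.<ᵇ a) (κ ℚ.* κ) κ
    init≤ : ∀ j → j ℕ.< h → ∀ t → chainMass L (suc t) (outerInit L a n j) ℚ.≤ b j
    init≤ j j<h t with suc j ℕ.<ᵇ a | ℕ.<⇒<ᵇ (ℕ.≤-<-trans j<h h<a) | n ℕ.∸ j ℕ.<ᵇ a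
    ... | true | _ | true  = noXY≤κ² t
    ... | true | _ | false = noX≤κ t
    near : ∀ j → suc n ℕ.∸ a ℕ.≤ j → n ℕ.∸ j ℕ.< a
    near j c≤j = ℕ.s≤s (ℕ.m≤n+o⇒m∸n≤o n j (ℕ.≤-trans (ℕ.≤-trans (ℕ.m≤n+m∸n n e) (ℕ.+-monoʳ-≤ e c≤j)) (ℕ.≤-reflexive (ℕ.+-comm e j))))
    exponent : (a ℕ.⊓ suc n) ℕ.∸ 2 ℕ.≤ (h ℕ.+ h) ℕ.∸ (suc n ℕ.∸ a)
    exponent = ℕ.≤-trans (ℕ.∸-monoˡ-≤ 2 M≤) (ℕ.≤-reflexive (trans (ℕ.∸-+-assoc (2 ℕ.+ (h ℕ.+ h)) c 2) (cong (2 ℕ.+ (h ℕ.+ h) ℕ.∸_) (ℕ.+-comm c 2))))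
      where
      c : ℕ
      c = suc n ℕ.∸ a
      M≤ : a ℕ.⊓ suc n ℕ.≤ 2 ℕ.+ (h ℕ.+ h) ℕ.∸ c
      M≤ = ℕ.m+n≤o⇒m≤o∸n (a ℕ.⊓ suc n) (ℕ.≤-trans (ℕ.≤-reflexive (ℕ.m⊓n+n∸m≡n a (suc n))) (ℕ.s≤s (n≤1+2⌊n/2⌋ n)))

  private
    prodTo-units : ∀ {τ} → 1ℚ ℚ.≤ τ → ∀ d c (b : ℕ → ℚ) → (∀ j → 0ℚ ℚ.≤ b j) → (∀ j → b j ℚ.≤ τ) → (∀ j → j ℕ.< c → b j ℚ.≤ 1ℚ) →
                   prodTo b d ℚ.≤ pow τ (d ℕ.∸ c)
    prodTo-units {τ} 1≤τ zero    c       b 0≤b b≤ b≤1 = ℚ.≤-reflexive (cong (pow τ) (sym (ℕ.0∸n≡0 c)))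
    prodTo-units {τ} 1≤τ (suc d) zero    b 0≤b b≤ b≤1 = *-mono-≤-nonNeg (0≤b 0) (pow-nonNeg (ℚ.≤-trans 0≤1 1≤τ) d) (b≤ 0)
      (prodTo-units 1≤τ d zero (b ∘ suc) (0≤b ∘ suc) (b≤ ∘ suc) (λ _ ()))
    prodTo-units {τ} 1≤τ (suc d) (suc c) b 0≤b b≤ b≤1 = ℚ.≤-trans
      (*-mono-≤-nonNeg (0≤b 0) (pow-nonNeg (ℚ.≤-trans 0≤1 1≤τ) (d ℕ.∸ c)) (b≤1 0 (ℕ.s≤s ℕ.z≤n))
        (prodTo-units 1≤τ d c (b ∘ suc) (0≤b ∘ suc) (b≤ ∘ suc) (λ j j<c → b≤1 (suc j) (ℕ.s≤s j<c))))
      (ℚ.≤-reflexive (ℚ.*-identityˡ (pow τ (d ℕ.∸ c))))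

  -- Chains starting before position `a` cost at most 1. As the region begins after position `k`, at
  -- most `suc (a ⊓ k)` of the `a ⊓ ⌊ n /2⌋` chains are left over, and each costs at most `τ`.
  inner-mass : ∀ {L τ} → 1ℚ ℚ.≤ τ → InnerBound L τ → ∀ a k n →
               mass (gen L (applyUpTo (innerInit L (a ℕ.∸ k)) (a ℕ.⊓ ⌊ n /2⌋)) n) ℚ.≤ 2ℚ ℚ.* pow τ (suc (a ℕ.⊓ k))
  inner-mass {L} {τ} 1≤τ bound a k n = ℚ.≤-trans
    (region-mass L letterMass≤2 (innerInit L A) b d n (ℕ.m⊓n≤n a ⌊ n /2⌋) (λ j _ t → init≤ j t))
    (*-monoˡ 2ℚ 0≤2 (ℚ.≤-trans
      (prodTo-units 1≤τ d (A ℕ.∸ 1) b (λ j → choose-≥ (suc j ℕ.<ᵇ A) 0≤1 (ℚ.≤-trans 0≤1 1≤τ)) (λ j → choose-≤ (suc j ℕ.<ᵇ A) 1≤τ ℚ.≤-refl)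
        (λ j j< → ℚ.≤-reflexive (choose-true {suc j ℕ.<ᵇ A} (ℕ.<⇒<ᵇ (small j j<)))))
      (pow-monotone 1≤τ exponent)))
    where
    open InnerBound bound
    A d : ℕ
    A = a ℕ.∸ k
    d = a ℕ.⊓ ⌊ n /2⌋
    b : ℕ → ℚ
    b j = choose (suc j ℕ.<ᵇ A) 1ℚ τ
    init≤ : ∀ j t → chainMass L (suc t) (innerInit L A j) ℚ.≤ b j
    init≤ j t with suc j ℕ.<ᵇ A
    ... | true  = noX≤1 t
    ... | false = all≤τ t
    small : ∀ j → j ℕ.< A ℕ.∸ 1 → suc j ℕ.< A
    small j j< with A
    ... | suc A′ = ℕ.s≤s j<
    exponent : d ℕ.∸ (A ℕ.∸ 1) ℕ.≤ suc (a ℕ.⊓ k)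
    exponent = ℕ.m≤n+o⇒m∸n≤o d (A ℕ.∸ 1) (begin
      d                            ≤⟨ ℕ.m⊓n≤m a ⌊ n /2⌋ ⟩
      a                            ≡⟨ trans (ℕ.+-comm A (a ℕ.⊓ k)) (trans (cong (ℕ._+ A) (ℕ.⊓-comm a k)) (ℕ.m⊓n+n∸m≡n k a)) ⟨
      A ℕ.+ (a ℕ.⊓ k)              ≤⟨ ℕ.+-monoˡ-≤ (a ℕ.⊓ k) (ℕ.m≤n+m∸n A 1) ⟩
      suc (A ℕ.∸ 1 ℕ.+ (a ℕ.⊓ k))  ≡⟨ ℕ.+-suc (A ℕ.∸ 1) (a ℕ.⊓ k) ⟨
      A ℕ.∸ 1 ℕ.+ suc (a ℕ.⊓ k)    ∎)
      where open ℕ.≤-Reasoning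

  pairs : {A B : Set} → List A → List B → List (A × B)
  pairs xs ys = concatMap (λ x → map (x ,_) ys) xs

  ∈-pairs : {A B : Set} {x : A} {y : B} {xs : List A} {ys : List B} → x ∈ xs → y ∈ ys → (x , y) ∈ pairs xs ys
  ∈-pairs {x = x} {xs = xs} {ys} x∈ y∈ = ∈.∈-concatMap⁺ (λ x → map (x ,_) ys) (Any.map (λ { refl → ∈.∈-map⁺ (x ,_) y∈ }) x∈)

  sumBy-pairs : {A B : Set} (f : A → ℚ) (h : B → ℚ) → ∀ xs ys → sumBy (λ (x , y) → f x ℚ.* h y) (pairs xs ys) ≡ sumBy f xs ℚ.* sumBy h ys
  sumBy-pairs f h xs ys = trans (sumBy-concatMap (λ (x , y) → f x ℚ.* h y) (λ x → map (x ,_) ys) xs) (trans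
    (sumBy-cong (λ x → trans (sumBy-map (λ (x , y) → f x ℚ.* h y) (x ,_) ys) (sumBy-*ˡ (f x) h ys)) xs) (sumBy-*ʳ (sumBy h ys) f xs))

  record Scheme : Set where
    field
      outer inner  : Level
      top          : List ℕ
      κ τ          : ℚ
      0≤κ          : 0ℚ ℚ.≤ κ
      κ≤1          : κ ℚ.≤ 1ℚ
      1≤τ          : 1ℚ ℚ.≤ τ
      τ≤2          : τ ℚ.≤ 2ℚ
      κτ≡1         : κ ℚ.* τ ≡ 1ℚ
      outerBound   : OuterBound outer κ
      innerBound   : InnerBound inner τ
      topBound     : sumBy (pow r) top ℚ.≤ 2ℚ

  Code : Set
  Code = List ℕ × ℕ × List ℕ

  codeMass : Code → ℚ
  codeMass (l₁ , x , l₂) = pow r (sum l₁) ℚ.* (pow r x ℚ.* pow r (sum l₂))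

  codeMass-nonNeg : ∀ c → 0ℚ ℚ.≤ codeMass c
  codeMass-nonNeg (l₁ , x , l₂) = *-nonNeg (pow-nonNeg 0≤r (sum l₁)) (*-nonNeg (pow-nonNeg 0≤r x) (pow-nonNeg 0≤r (sum l₂)))

  codeMass-sum : ∀ l₁ x l₂ → codeMass (l₁ , x , l₂) ≡ pow r (sum l₁ ℕ.+ (x ℕ.+ sum l₂))
  codeMass-sum l₁ x l₂ = sym (trans (pow-+ r (sum l₁) (x ℕ.+ sum l₂)) (cong (pow r (sum l₁) ℚ.*_) (pow-+ r x (sum l₂))))

  module _ (S : Scheme) where
    open Scheme S

    outerQueue : ℕ → ℕ → List (List Pair)
    outerQueue n a = applyUpTo (outerInit outer a n) (a ℕ.⊓ ⌊ n /2⌋)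

    innerQueue : ℕ → ℕ → ℕ → List (List Pair)
    innerQueue k n a = applyUpTo (innerInit inner (a ℕ.∸ k)) (a ℕ.⊓ ⌊ n /2⌋)

    codes : ℕ → ℕ → ℕ → List Code
    codes n₁ n₂ a = pairs (gen outer (outerQueue n₁ a) n₁) (pairs top (gen inner (innerQueue (suc n₁) n₂ a) n₂))

    -- `128 = 2^4 * 2^3`: two factors 2 from the outer region, one each from the top letter and the
    -- inner region, and `τ^3 ≤ 2^3` for the factors `τ` that exceed the factors `κ` in number.
    codes-bound : ℚ
    codes-bound = ℤ.+ 128 ℚ./ 1

    codes-mass : ∀ n₁ n₂ a → 1 ℕ.≤ a → sumBy codeMass (codes n₁ n₂ a) ℚ.≤ codes-bound
    codes-mass n₁ n₂ a 1≤a = begin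
      sumBy codeMass (codes n₁ n₂ a)
        ≡⟨ sumBy-pairs (λ c → pow r (sum c)) (λ (x , l) → pow r x ℚ.* pow r (sum l)) G₁ (pairs top G₂) ⟩
      mass G₁ ℚ.* sumBy (λ (x , l) → pow r x ℚ.* pow r (sum l)) (pairs top G₂)
        ≡⟨ cong (mass G₁ ℚ.*_) (sumBy-pairs (pow r) (λ c → pow r (sum c)) top G₂) ⟩
      mass G₁ ℚ.* (sumBy (pow r) top ℚ.* mass G₂)
        ≤⟨ *-mono-≤-nonNeg (sumBy-nonNeg (λ c → pow-nonNeg 0≤r (sum c)) G₁) (*-nonNeg 0≤2 (*-nonNeg 0≤2 (pow-nonNeg 0≤τ (suc M))))
             (outer-mass 0≤κ κ≤1 outerBound a n₁ 1≤a)
             (*-mono-≤-nonNeg (sumBy-nonNeg (pow-nonNeg 0≤r) top) (*-nonNeg 0≤2 (pow-nonNeg 0≤τ (suc M))) topBound (inner-mass 1≤τ innerBound a (suc n₁) n₂)) ⟩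
      2ℚ ℚ.* (2ℚ ℚ.* pow κ e) ℚ.* (2ℚ ℚ.* (2ℚ ℚ.* pow τ (suc M)))
        ≤⟨ *-monoˡ _ (*-nonNeg 0≤2 (*-nonNeg 0≤2 (pow-nonNeg 0≤κ e))) (*-monoˡ 2ℚ 0≤2 (*-monoˡ 2ℚ 0≤2 (pow-monotone 1≤τ {suc M} {3 ℕ.+ e} (ℕ.s≤s (ℕ.m≤n+m∸n M 2))))) ⟩
      2ℚ ℚ.* (2ℚ ℚ.* pow κ e) ℚ.* (2ℚ ℚ.* (2ℚ ℚ.* pow τ (3 ℕ.+ e)))
        ≡⟨ solve 4 (λ w k t p → w :* (w :* k) :* (w :* (w :* (t :* (t :* (t :* p))))) := (w :* w :* (w :* w)) :* ((t :* (t :* (t :* con 1ℚ))) :* (k :* p))) refl 2ℚ (pow κ e) τ (pow τ e) ⟩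
      (2ℚ ℚ.* 2ℚ ℚ.* (2ℚ ℚ.* 2ℚ)) ℚ.* (pow τ 3 ℚ.* (pow κ e ℚ.* pow τ e))
        ≡⟨ cong (λ t → (2ℚ ℚ.* 2ℚ ℚ.* (2ℚ ℚ.* 2ℚ)) ℚ.* (pow τ 3 ℚ.* t)) (trans (sym (pow-* κ τ e)) (trans (cong (λ t → pow t e) κτ≡1) (pow-1 e))) ⟩
      (2ℚ ℚ.* 2ℚ ℚ.* (2ℚ ℚ.* 2ℚ)) ℚ.* (pow τ 3 ℚ.* 1ℚ)
        ≤⟨ *-monoˡ (2ℚ ℚ.* 2ℚ ℚ.* (2ℚ ℚ.* 2ℚ)) (from-yes (0ℚ ℚ.≤? 2ℚ ℚ.* 2ℚ ℚ.* (2ℚ ℚ.* 2ℚ))) (*-monoʳ 1ℚ 0≤1 (pow-mono 0≤τ τ≤2 3)) ⟩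
      (2ℚ ℚ.* 2ℚ ℚ.* (2ℚ ℚ.* 2ℚ)) ℚ.* (pow 2ℚ 3 ℚ.* 1ℚ)
        ≡⟨ refl ⟩
      codes-bound ∎
      where
      open ℚ.≤-Reasoning
      open +-*-Solver
      G₁ G₂ : List (List ℕ)
      G₁ = gen outer (outerQueue n₁ a) n₁
      G₂ = gen inner (innerQueue (suc n₁) n₂ a) n₂
      M e : ℕ
      M = a ℕ.⊓ suc n₁
      e = M ℕ.∸ 2
      0≤τ : 0ℚ ℚ.≤ τ
      0≤τ = ℚ.≤-trans 0≤1 1≤τ
      pow-1 : ∀ k → pow 1ℚ k ≡ 1ℚ
      pow-1 zero    = refl
      pow-1 (suc k) = trans (ℚ.*-identityˡ (pow 1ℚ k)) (pow-1 k)

    -- Both lengths and `a` depend on the word; running over all their values costs the factor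
    -- `N^3`.
    allCodes : ℕ → List Code
    allCodes N = concatMap (λ n₁ → concatMap (λ n₂ → concatMap (λ a → codes n₁ n₂ (suc a)) (upTo N)) (upTo N)) (upTo N)

    ∈-allCodes : ∀ {N n₁ n₂ a c} → n₁ ℕ.< N → n₂ ℕ.< N → 1 ℕ.≤ a → a ℕ.≤ N → c ∈ codes n₁ n₂ a → c ∈ allCodes N
    ∈-allCodes {N} {n₁} {n₂} {suc a} n₁< n₂< _ a≤ c∈ =
      into (λ n₁ → concatMap (λ n₂ → concatMap (λ a → codes n₁ n₂ (suc a)) (upTo N)) (upTo N)) (∈.∈-upTo⁺ n₁<)
        (into (λ n₂ → concatMap (λ a → codes n₁ n₂ (suc a)) (upTo N)) (∈.∈-upTo⁺ n₂<) (into (λ a → codes n₁ n₂ (suc a)) (∈.∈-upTo⁺ a≤) c∈))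
      where
      into : {A B : Set} (f : A → List B) → ∀ {x xs y} → x ∈ xs → y ∈ f x → y ∈ concatMap f xs
      into f x∈ y∈ = ∈.∈-concatMap⁺ f (Any.map (λ { refl → y∈ }) x∈)

    allCodes-mass : ∀ N → sumBy codeMass (allCodes N) ℚ.≤ ℕ⇒ℚ N ℚ.* (ℕ⇒ℚ N ℚ.* (ℕ⇒ℚ N ℚ.* codes-bound))
    allCodes-mass N = collect (λ n₁ → collect (λ n₂ → collect (λ a → codes-mass n₁ n₂ (suc a) (ℕ.s≤s ℕ.z≤n))))
      where
      collect : {f : ℕ → List Code} {b : ℚ} → (∀ x → sumBy codeMass (f x) ℚ.≤ b) → sumBy codeMass (concatMap f (upTo N)) ℚ.≤ ℕ⇒ℚ N ℚ.* b
      collect {f} {b} h = ℚ.≤-trans (ℚ.≤-reflexive (sumBy-concatMap codeMass f (upTo N))) (ℚ.≤-trans (sumBy-mono (upTo N) (λ {x} _ → h x))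
        (ℚ.≤-reflexive (trans (sumBy-const b (upTo N)) (cong (λ t → ℕ⇒ℚ t ℚ.* b) (List.length-upTo N)))))

-- Reading a word inwards from both ends, and completeness of the generated codes.

module Coding where

  open ℚLemmas
  open Regions
  open LevelBounds
  open Schemes

  sumTo : (ℕ → ℕ) → ℕ → ℕ
  sumTo f zero    = 0
  sumTo f (suc n) = f 0 ℕ.+ sumTo (f ∘ suc) n

  sumTo-cong : ∀ {f h : ℕ → ℕ} n → (∀ j → j ℕ.< n → f j ≡ h j) → sumTo f n ≡ sumTo h n
  sumTo-cong zero    e = refl
  sumTo-cong (suc n) e = cong₂ ℕ._+_ (e 0 (ℕ.s≤s ℕ.z≤n)) (sumTo-cong n (λ j j< → e (suc j) (ℕ.s≤s j<)))

  sumTo-+ : ∀ f m n → sumTo f (m ℕ.+ n) ≡ sumTo f m ℕ.+ sumTo (λ j → f (m ℕ.+ j)) n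
  sumTo-+ f zero    n = refl
  sumTo-+ f (suc m) n = trans (cong (f 0 ℕ.+_) (sumTo-+ (f ∘ suc) m n)) (sym (ℕ.+-assoc (f 0) _ _))

  sumTo-last : ∀ f n → sumTo f (suc n) ≡ sumTo f n ℕ.+ f n
  sumTo-last f n = trans (cong (sumTo f) (ℕ.+-comm 1 n)) (trans (sumTo-+ f n 1)
    (cong (sumTo f n ℕ.+_) (trans (ℕ.+-identityʳ (f (n ℕ.+ 0))) (cong f (ℕ.+-identityʳ n)))))

  -- A word w₁ … wₙ is stored as the list wₙ ∷ … ∷ w₁, and at u i = wᵢ.
  at : List ℕ → ℕ → ℕ
  at []      i = 0
  at (x ∷ u) i with i ℕ.≟ suc (length u)
  ... | yes _ = x
  ... | no  _ = at u i

  at-last : ∀ x u {i} → i ≡ suc (length u) → at (x ∷ u) i ≡ x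
  at-last x u {i} e with i ℕ.≟ suc (length u)
  ... | yes _ = refl
  ... | no ¬e = contradiction e ¬e

  at-init : ∀ x u {i} → i ℕ.≤ length u → at (x ∷ u) i ≡ at u i
  at-init x u {i} i≤ with i ℕ.≟ suc (length u)
  ... | yes refl = contradiction i≤ ℕ.1+n≰n
  ... | no  _    = refl

  -- Index 0 lies outside the word; the default value is the correct Kunz coordinate of residue 0.
  at-0 : ∀ u → at u 0 ≡ 0
  at-0 []      = refl
  at-0 (x ∷ u) = trans (at-init x u ℕ.z≤n) (at-0 u)

  at-All : ∀ {P : ℕ → Set} {u} → All P u → ∀ {i} → 1 ℕ.≤ i → i ℕ.≤ length u → P (at u i)
  at-All {P} {x ∷ u} (p ∷ ps) {i} 1≤i i≤ with i ℕ.≟ suc (length u)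
  ... | yes _ = p
  ... | no ¬e = at-All ps 1≤i (ℕ.s≤s⁻¹ (ℕ.≤∧≢⇒< i≤ ¬e))
  at-All {u = []} [] {suc i} 1≤i ()

  All-at : ∀ {P : ℕ → Set} u → (∀ i → 1 ℕ.≤ i → i ℕ.≤ length u → P (at u i)) → All P u
  All-at []      h = []
  All-at {P} (x ∷ u) h = subst P (at-last x u refl) (h (suc (length u)) (ℕ.s≤s ℕ.z≤n) ℕ.≤-refl) ∷
    All-at u (λ i 1≤i i≤ → subst P (at-init x u i≤) (h i 1≤i (ℕ.m≤n⇒m≤1+n i≤)))

  at-injective : ∀ u v → length u ≡ length v → (∀ i → 1 ℕ.≤ i → i ℕ.≤ length u → at u i ≡ at v i) → u ≡ v
  at-injective []      []      _ _ = refl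
  at-injective (x ∷ u) (y ∷ v) e h = cong₂ _∷_
    (trans (sym (at-last x u refl)) (trans (h (suc (length u)) (ℕ.s≤s ℕ.z≤n) ℕ.≤-refl) (at-last y v e)))
    (at-injective u v e′ (λ i 1≤i i≤ → trans (sym (at-init x u i≤))
      (trans (h i 1≤i (ℕ.m≤n⇒m≤1+n i≤)) (at-init y v (subst (i ℕ.≤_) e′ i≤)))))
    where
    e′ : length u ≡ length v
    e′ = ℕ.suc-injective e

  sum-at : ∀ u → sum u ≡ sumTo (at u ∘ suc) (length u)
  sum-at []      = refl
  sum-at (x ∷ u) = sym (trans (sumTo-last (at (x ∷ u) ∘ suc) (length u)) (trans
    (cong₂ ℕ._+_ (trans (sumTo-cong (length u) (λ j j< → at-init x u j<)) (sym (sum-at u))) (at-last x u refl)) (ℕ.+-comm (sum u) x)))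

  -- Uses the letter order of `gen`. `X` runs from the left end and `Y` from the right end; as
  -- separate functions both can be shifted in the recursion.
  peel : (X Y : ℕ → ℕ) → ℕ → List ℕ
  peel X Y zero          = []
  peel X Y (suc zero)    = X 0 ∷ []
  peel X Y (suc (suc n)) = X 0 ∷ Y 0 ∷ peel (X ∘ suc) (Y ∘ suc) n

  length-peel : ∀ X Y n → length (peel X Y n) ≡ n
  length-peel X Y zero          = refl
  length-peel X Y (suc zero)    = refl
  length-peel X Y (suc (suc n)) = cong (suc ∘ suc) (length-peel (X ∘ suc) (Y ∘ suc) n)

  Mirror : (X Y : ℕ → ℕ) → ℕ → Set
  Mirror X Y n = ∀ j → j ℕ.< ⌊ n /2⌋ → Y j ≡ X (n ℕ.∸ suc j)

  half< : ∀ {j n} → j ℕ.< ⌊ n /2⌋ → j ℕ.< n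
  half< {n = n} j< = ℕ.<-≤-trans j< (ℕ.⌊n/2⌋≤n n)

  n∸m≡1+n∸1+m : ∀ {m n} → m ℕ.< n → n ℕ.∸ m ≡ suc (n ℕ.∸ suc m)
  n∸m≡1+n∸1+m {n = suc n} m< = ℕ.+-∸-assoc 1 (ℕ.s≤s⁻¹ m<)

  mirror-shift : ∀ X Y n → Mirror X Y (suc (suc n)) → Mirror (X ∘ suc) (Y ∘ suc) n
  mirror-shift X Y n m j j< = trans (m (suc j) (ℕ.s≤s j<)) (cong X (n∸m≡1+n∸1+m (half< j<)))

  sum-peel : ∀ n {X Y} → Mirror X Y n → sum (peel X Y n) ≡ sumTo X n
  sum-peel zero          m = refl
  sum-peel (suc zero)    m = refl
  sum-peel (suc (suc n)) {X} {Y} m = cong (X 0 ℕ.+_) (trans (cong₂ ℕ._+_ (m 0 (ℕ.s≤s ℕ.z≤n)) (sum-peel n (mirror-shift X Y n m)))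
    (trans (ℕ.+-comm (X (suc n)) (sumTo (X ∘ suc) n)) (sym (sumTo-last (X ∘ suc) n))))

  peel-injective : ∀ n X Y X′ Y′ → Mirror X Y n → Mirror X′ Y′ n → peel X Y n ≡ peel X′ Y′ n → ∀ i → i ℕ.< n → X i ≡ X′ i
  peel-injective (suc zero)    X Y X′ Y′ m m′ e zero    _  = List.∷-injectiveˡ e
  peel-injective (suc zero)    X Y X′ Y′ m m′ e (suc i) (ℕ.s≤s ())
  peel-injective (suc (suc n)) X Y X′ Y′ m m′ e zero    _  = List.∷-injectiveˡ e
  peel-injective (suc (suc n)) X Y X′ Y′ m m′ e (suc i) i< with i ℕ.≟ n
  -- The rightmost letter occurs in the list as `Y 0`.
  ... | yes refl = trans (sym (m 0 (ℕ.s≤s ℕ.z≤n))) (trans (List.∷-injectiveˡ (List.∷-injectiveʳ e)) (m′ 0 (ℕ.s≤s ℕ.z≤n)))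
  ... | no  i≢n  = peel-injective n (X ∘ suc) (Y ∘ suc) (X′ ∘ suc) (Y′ ∘ suc) (mirror-shift X Y n m) (mirror-shift X′ Y′ n m′) (List.∷-injectiveʳ (List.∷-injectiveʳ e)) i
    (ℕ.≤∧≢⇒< (ℕ.s≤s⁻¹ (ℕ.s≤s⁻¹ i<)) i≢n)

  data At {A : Set} : List A → ℕ → A → Set where
    here  : ∀ {x xs} → At (x ∷ xs) 0 x
    there : ∀ {x xs j y} → At xs j y → At (x ∷ xs) (suc j) y

  At-∷ʳ : ∀ {A : Set} (xs : List A) {z j y} → At (xs ∷ʳ z) j y → At xs j y ⊎ (j ≡ length xs × y ≡ z)
  At-∷ʳ []       here      = inj₂ (refl , refl)
  At-∷ʳ (x ∷ xs) here      = inj₁ here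
  At-∷ʳ (x ∷ xs) (there p) with At-∷ʳ xs p
  ... | inj₁ q         = inj₁ (there q)
  ... | inj₂ (e , e′) = inj₂ (cong suc e , e′)

  At-applyUpTo : ∀ {A : Set} (f : ℕ → A) d {j y} → At (applyUpTo f d) j y → y ≡ f j × j ℕ.< d
  At-applyUpTo f (suc d) here      = refl , ℕ.s≤s ℕ.z≤n
  At-applyUpTo f (suc d) (there p) with At-applyUpTo (f ∘ suc) d p
  ... | e , j< = e , ℕ.s≤s j<

  -- Choosing a pair removes one list and appends one, so the queue length is invariant and the list
  -- appended at pair `j` is met at pair `length Q + j`. This is the distance in the chain
  -- hypothesis.
  gen-complete : ∀ L n Q (X Y : ℕ → ℕ) → (1 ℕ.≤ ⌊ n /2⌋ → 1 ℕ.≤ length Q) → (∀ j → j ℕ.< n → X j ∈ letters L) →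
    (∀ j {O} → j ℕ.< ⌊ n /2⌋ → At Q j O → (X j , Y j) ∈ O) →
    (∀ j → length Q ℕ.+ j ℕ.< ⌊ n /2⌋ → (X (length Q ℕ.+ j) , Y (length Q ℕ.+ j)) ∈ options L (X j , Y j)) →
    peel X Y n ∈ gen L Q n
  gen-complete L zero          Q       X Y ne let∈ q∈ chain = here refl
  gen-complete L (suc zero)    Q       X Y ne let∈ q∈ chain = ∈.∈-map⁺ (_∷ []) (let∈ 0 (ℕ.s≤s ℕ.z≤n))
  gen-complete L (suc (suc n)) []      X Y ne let∈ q∈ chain = contradiction (ne (ℕ.s≤s ℕ.z≤n)) λ ()
  gen-complete L (suc (suc n)) (O ∷ Q) X Y ne let∈ q∈ chain =
    ∈.∈-concatMap⁺ (λ p → map (λ c → proj₁ p ∷ proj₂ p ∷ c) (gen L (Q ∷ʳ options L p) n))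
      (Any.map (λ { refl → ∈.∈-map⁺ (λ c → X 0 ∷ Y 0 ∷ c) rest }) (q∈ 0 (ℕ.s≤s ℕ.z≤n) here))
    where
    Q′ : List (List Pair)
    Q′ = Q ∷ʳ options L (X 0 , Y 0)
    len : length Q′ ≡ suc (length Q)
    len = trans (List.length-++ Q) (ℕ.+-comm (length Q) 1)
    q∈′ : ∀ j {P} → j ℕ.< ⌊ n /2⌋ → At Q′ j P → (X (suc j) , Y (suc j)) ∈ P
    q∈′ j j< p with At-∷ʳ Q p
    ... | inj₁ q = q∈ (suc j) (ℕ.s≤s j<) (there q)
    ... | inj₂ (refl , refl) = subst (λ t → (X (suc t) , Y (suc t)) ∈ options L (X 0 , Y 0)) (ℕ.+-identityʳ (length Q))
      (chain 0 (ℕ.s≤s (subst (ℕ._< ⌊ n /2⌋) (sym (ℕ.+-identityʳ (length Q))) j<)))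
    chain′ : ∀ j → length Q′ ℕ.+ j ℕ.< ⌊ n /2⌋ → (X (suc (length Q′ ℕ.+ j)) , Y (suc (length Q′ ℕ.+ j))) ∈ options L (X (suc j) , Y (suc j))
    chain′ j j< = subst (λ t → (X t , Y t) ∈ options L (X (suc j) , Y (suc j))) (sym e) (chain (suc j) (ℕ.s≤s (subst (ℕ._≤ ⌊ n /2⌋) e j<)))
      where
      e : suc (length Q′ ℕ.+ j) ≡ suc (length Q ℕ.+ suc j)
      e = cong suc (trans (cong (ℕ._+ j) len) (sym (ℕ.+-suc (length Q) j)))
    rest : peel (X ∘ suc) (Y ∘ suc) n ∈ gen L Q′ n
    rest = gen-complete L n Q′ (X ∘ suc) (Y ∘ suc) (λ _ → subst (1 ℕ.≤_) (sym len) (ℕ.s≤s ℕ.z≤n)) (λ j j< → let∈ (suc j) (ℕ.s≤s (ℕ.m≤n⇒m≤1+n j<))) q∈′ chain′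

  ∈-states : ∀ L {x y} → x ∈ letters L → y ∈ letters L → floor L ℕ.≤ x ℕ.+ y → (x , y) ∈ states L
  ∈-states L {x} {y} x∈ y∈ h = ∈.∈-concatMap⁺ (λ x → map (x ,_) (filter (λ y → floor L ℕ.≤? x ℕ.+ y) (letters L)))
    (Any.map (λ { refl → ∈.∈-map⁺ (x ,_) (∈.∈-filter⁺ (λ y → floor L ℕ.≤? x ℕ.+ y) y∈ h) }) x∈)

  ∈-pick : ∀ L {x y} b b′ → (x , y) ∈ states L → (T b → x ≢ 1) → (T b′ → y ≢ 1) → (x , y) ∈ pick L b b′
  ∈-pick L true  true  p x≢1 y≢1 = ∈.∈-filter⁺ (λ p → ¬? (proj₂ p ℕ.≟ 1)) (∈.∈-filter⁺ (λ p → ¬? (proj₁ p ℕ.≟ 1)) p (x≢1 _)) (y≢1 _)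
  ∈-pick L true  false p x≢1 y≢1 = ∈.∈-filter⁺ (λ p → ¬? (proj₁ p ℕ.≟ 1)) p (x≢1 _)
  ∈-pick L false b′    p x≢1 y≢1 = p

  -- If a pair lies a full queue length further on, the queue was not cut down to the number of
  -- pairs, so links have distance exactly `a`.
  ⊓-case : ∀ a h j → (a ℕ.⊓ h) ℕ.+ j ℕ.< h → a ℕ.⊓ h ≡ a
  ⊓-case a h j p with ℕ.≤-total a h
  ... | inj₁ a≤h = ℕ.m≤n⇒m⊓n≡m a≤h
  ... | inj₂ h≤a = contradiction (ℕ.≤-trans p (ℕ.≤-trans (ℕ.m≤m+n h j) (ℕ.≤-reflexive (cong (ℕ._+ j) (sym (ℕ.m≥n⇒m⊓n≡n h≤a)))))) (ℕ.<-irrefl refl)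

  region-complete : ∀ L n a (f : ℕ → ℕ) (init : ℕ → List Pair) → 1 ℕ.≤ a →
    (∀ j → j ℕ.< n → f j ∈ letters L) →
    (∀ j → j ℕ.< ⌊ n /2⌋ → floor L ℕ.≤ f j ℕ.+ f (n ℕ.∸ suc j)) →
    (∀ j → j ℕ.+ a ℕ.< n → f (j ℕ.+ a) ℕ.≤ suc (f j)) →
    (∀ j → j ℕ.< ⌊ n /2⌋ → (f j , f (n ℕ.∸ suc j)) ∈ states L → (f j , f (n ℕ.∸ suc j)) ∈ init j) →
    peel f (λ j → f (n ℕ.∸ suc j)) n ∈ gen L (applyUpTo init (a ℕ.⊓ ⌊ n /2⌋)) n
  region-complete L n a f init 1≤a let∈ sum≥ chain init∈ =
    gen-complete L n Q f Y (λ 1≤h → subst (1 ℕ.≤_) (sym len) (ℕ.⊓-glb 1≤a 1≤h)) let∈ q∈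
      (λ j j< → link j (subst (λ t → t ℕ.+ j ℕ.< h) len j<) len)
    where
    h : ℕ
    h = ⌊ n /2⌋
    Y : ℕ → ℕ
    Y j = f (n ℕ.∸ suc j)
    Q : List (List Pair)
    Q = applyUpTo init (a ℕ.⊓ h)
    len : length Q ≡ a ℕ.⊓ h
    len = List.length-applyUpTo init (a ℕ.⊓ h)
    state : ∀ j → j ℕ.< h → (f j , Y j) ∈ states L
    state j j< = ∈-states L (let∈ j (half< j<)) (let∈ (n ℕ.∸ suc j) (ℕ.≤-trans (ℕ.≤-reflexive (sym (n∸m≡1+n∸1+m (half< j<)))) (ℕ.m∸n≤m n j))) (sum≥ j j<)
    q∈ : ∀ j {O} → j ℕ.< h → At Q j O → (f j , Y j) ∈ O
    q∈ j j< p with At-applyUpTo init (a ℕ.⊓ h) p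
    ... | refl , _ = init∈ j j< (state j j<)
    link : ∀ j {d} → (a ℕ.⊓ h) ℕ.+ j ℕ.< h → d ≡ a ℕ.⊓ h → (f (d ℕ.+ j) , Y (d ℕ.+ j)) ∈ options L (f j , Y j)
    link j {d} p e with trans e (⊓-case a h j p)
    ... | refl = ∈.∈-filter⁺ (step? (f j , Y j)) (state (a ℕ.+ j) a+j<h) (x-step , y-step)
      where
      a+j<h : a ℕ.+ j ℕ.< h
      a+j<h = subst (λ t → t ℕ.+ j ℕ.< h) (sym e) p
      a+j<n : a ℕ.+ j ℕ.< n
      a+j<n = half< a+j<h
      x-step : f (a ℕ.+ j) ℕ.≤ suc (f j)
      x-step = subst (λ t → f t ℕ.≤ suc (f j)) (ℕ.+-comm j a) (chain j (subst (ℕ._< n) (ℕ.+-comm a j) a+j<n))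
      back : n ℕ.∸ suc (a ℕ.+ j) ℕ.+ a ≡ n ℕ.∸ suc j
      back = trans (cong (λ t → n ℕ.∸ t ℕ.+ a) (trans (cong suc (ℕ.+-comm a j)) refl)) (trans (cong (ℕ._+ a) (sym (ℕ.∸-+-assoc n (suc j) a)))
        (ℕ.m∸n+n≡m (ℕ.m+n≤o⇒m≤o∸n a (subst (ℕ._≤ n) (sym (ℕ.+-suc a j)) a+j<n))))
      -- The chain condition is read at the mirror image of `a + j`; the mirror image of `j` lies
      -- `a` places to its right.
      y-step : Y j ℕ.≤ suc (Y (a ℕ.+ j))
      y-step = subst (λ t → f t ℕ.≤ suc (Y (a ℕ.+ j))) back (chain (n ℕ.∸ suc (a ℕ.+ j))
        (subst (ℕ._< n) (sym back) (ℕ.≤-trans (ℕ.≤-reflexive (sym (n∸m≡1+n∸1+m (ℕ.≤-<-trans (ℕ.m≤n+m j a) a+j<n)))) (ℕ.m∸n≤m n j))))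

  -- The top letter is at `k = suc n₁`, the word has `suc n₁ + n₂` letters and the multiplicity `m`
  -- is one more, so inner pairs have positions adding up to `m + k`.
  record Fits (S : Scheme) (w : ℕ → ℕ) (n₁ n₂ a : ℕ) : Set where
    open Scheme S
    field
      1≤a      : 1 ℕ.≤ a
      outer∈   : ∀ i → 1 ℕ.≤ i → i ℕ.≤ n₁ → w i ∈ letters outer
      inner∈   : ∀ i → suc n₁ ℕ.< i → i ℕ.≤ suc n₁ ℕ.+ n₂ → w i ∈ letters inner
      top∈     : w (suc n₁) ∈ top
      outerSum : ∀ i j → 1 ℕ.≤ i → 1 ℕ.≤ j → i ℕ.+ j ≡ suc n₁ → floor outer ℕ.≤ w i ℕ.+ w j
      innerSum : ∀ i j → suc n₁ ℕ.< i → suc n₁ ℕ.< j → i ℕ.+ j ≡ suc (suc n₁ ℕ.+ n₂) ℕ.+ suc n₁ → floor inner ℕ.≤ w i ℕ.+ w j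
      chain    : ∀ i → 1 ℕ.≤ i → i ℕ.+ a ℕ.≤ suc n₁ ℕ.+ n₂ → w (i ℕ.+ a) ℕ.≤ suc (w i)
      no1      : ∀ i → 1 ℕ.≤ i → i ℕ.< a → i ℕ.≤ suc n₁ ℕ.+ n₂ → w i ≢ 1

  code : (ℕ → ℕ) → ℕ → ℕ → Code
  code w n₁ n₂ = peel (w ∘ suc) (λ j → w (suc (n₁ ℕ.∸ suc j))) n₁ , w (suc n₁) ,
                 peel (λ j → w (suc (suc n₁ ℕ.+ j))) (λ j → w (suc (suc n₁ ℕ.+ (n₂ ℕ.∸ suc j)))) n₂

  code-mass : ∀ w n₁ n₂ → codeMass (code w n₁ n₂) ≡ pow r (sumTo (w ∘ suc) (suc n₁ ℕ.+ n₂))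
  code-mass w n₁ n₂ = trans (codeMass-sum (proj₁ (code w n₁ n₂)) (w (suc n₁)) (proj₂ (proj₂ (code w n₁ n₂)))) (cong (pow r) (trans
    (cong₂ (λ s t → s ℕ.+ (w (suc n₁) ℕ.+ t)) (sum-peel n₁ (λ _ _ → refl)) (sum-peel n₂ (λ _ _ → refl)))
    (sym (trans (sumTo-+ (w ∘ suc) (suc n₁) n₂) (trans (cong (ℕ._+ S₂) (sumTo-last (w ∘ suc) n₁)) (ℕ.+-assoc (sumTo (w ∘ suc) n₁) (w (suc n₁)) S₂))))))
    where
    S₂ : ℕ
    S₂ = sumTo (λ j → w (suc (suc n₁ ℕ.+ j))) n₂

  code-complete : ∀ S {w n₁ n₂ a} → Fits S w n₁ n₂ a → code w n₁ n₂ ∈ codes S n₁ n₂ a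
  code-complete S {w} {n₁} {n₂} {a} fits = ∈-pairs
    (region-complete outer n₁ a (w ∘ suc) (outerInit outer a n₁) 1≤a
      (λ j j< → outer∈ (suc j) (ℕ.s≤s ℕ.z≤n) j<)
      (λ j j< → outerSum (suc j) (suc (n₁ ℕ.∸ suc j)) (ℕ.s≤s ℕ.z≤n) (ℕ.s≤s ℕ.z≤n) (cong suc (trans (ℕ.+-suc j (n₁ ℕ.∸ suc j)) (ℕ.m+[n∸m]≡n (half< j<)))))
      (λ j j< → chain (suc j) (ℕ.s≤s ℕ.z≤n) (ℕ.≤-trans j< (ℕ.≤-trans (ℕ.n≤1+n n₁) (ℕ.m≤m+n (suc n₁) n₂))))
      (λ j j< p → ∈-pick outer (suc j ℕ.<ᵇ a) (n₁ ℕ.∸ j ℕ.<ᵇ a) p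
        (λ t → no1 (suc j) (ℕ.s≤s ℕ.z≤n) (ℕ.<ᵇ⇒< (suc j) a t) (ℕ.≤-trans (half< j<) n₁≤))
        (λ t → subst (λ i → w i ≢ 1) (n∸m≡1+n∸1+m (half< j<))
          (no1 (n₁ ℕ.∸ j) (subst (1 ℕ.≤_) (sym (n∸m≡1+n∸1+m (half< j<))) (ℕ.s≤s ℕ.z≤n)) (ℕ.<ᵇ⇒< (n₁ ℕ.∸ j) a t) (ℕ.≤-trans (ℕ.m∸n≤m n₁ j) n₁≤)))))
    (∈-pairs top∈ (region-complete inner n₂ a (λ j → w (suc (suc n₁ ℕ.+ j))) (innerInit inner (a ℕ.∸ suc n₁)) 1≤a
      (λ j j< → inner∈ (suc (suc n₁ ℕ.+ j)) (ℕ.s≤s (ℕ.m≤m+n (suc n₁) j)) (shift≤ j<))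
      (λ j j< → innerSum _ _ (ℕ.s≤s (ℕ.m≤m+n (suc n₁) j)) (ℕ.s≤s (ℕ.m≤m+n (suc n₁) (n₂ ℕ.∸ suc j))) (positions j (half< j<)))
      (λ j j< → subst (λ t → w t ℕ.≤ suc (w (suc (suc n₁ ℕ.+ j)))) (cong suc (ℕ.+-assoc (suc n₁) j a))
        (chain (suc (suc n₁ ℕ.+ j)) (ℕ.s≤s ℕ.z≤n) (ℕ.≤-trans (ℕ.≤-reflexive (cong suc (ℕ.+-assoc (suc n₁) j a))) (shift≤ j<))))
      (λ j j< p → ∈-pick inner (suc j ℕ.<ᵇ (a ℕ.∸ suc n₁)) false p
        (λ t → no1 (suc (suc n₁ ℕ.+ j)) (ℕ.s≤s ℕ.z≤n) (below j (ℕ.<ᵇ⇒< (suc j) (a ℕ.∸ suc n₁) t)) (shift≤ (half< j<))) λ ())))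
    where
    open Scheme S
    open Fits fits
    n₁≤ : n₁ ℕ.≤ suc n₁ ℕ.+ n₂
    n₁≤ = ℕ.≤-trans (ℕ.n≤1+n n₁) (ℕ.m≤m+n (suc n₁) n₂)
    shift≤ : ∀ {j} → j ℕ.< n₂ → suc (suc n₁ ℕ.+ j) ℕ.≤ suc n₁ ℕ.+ n₂
    shift≤ {j} j< = ℕ.≤-trans (ℕ.≤-reflexive (sym (ℕ.+-suc (suc n₁) j))) (ℕ.+-monoʳ-≤ (suc n₁) j<)
    below : ∀ j → suc j ℕ.< a ℕ.∸ suc n₁ → suc (suc n₁ ℕ.+ j) ℕ.< a
    below j p = subst (ℕ._< a) (trans (ℕ.+-comm (suc j) (suc n₁)) (ℕ.+-suc (suc n₁) j)) (ℕ.m≤o∸n⇒m+n≤o (suc (suc j)) (ℕ.<⇒≤ (ℕ.m∸n≢0⇒n<m nonzero)) p)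
      where
      nonzero : a ℕ.∸ suc n₁ ≢ 0
      nonzero e = contradiction (subst (suc j ℕ.<_) e p) λ ()
    positions : ∀ j → j ℕ.< n₂ → suc (suc n₁ ℕ.+ j) ℕ.+ suc (suc n₁ ℕ.+ (n₂ ℕ.∸ suc j)) ≡ suc (suc n₁ ℕ.+ n₂) ℕ.+ suc n₁
    positions j j< = trans
      (solve 3 (λ k j m → (con 1 :+ (k :+ j)) :+ (con 1 :+ (k :+ m)) := con 1 :+ (k :+ (con 1 :+ j :+ m)) :+ k) refl (suc n₁) j (n₂ ℕ.∸ suc j))
      (cong (λ t → suc (suc n₁ ℕ.+ t) ℕ.+ suc n₁) (ℕ.m+[n∸m]≡n j<))
      where
      open ℕSolver.+-*-Solver

-- From Kunz inequalities to codes: counting words with a letter at least `s`.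

module Counting where

  open ℚLemmas
  open Sums
  open Regions
  open LevelBounds
  open Schemes
  open Coding

  open import Data.Nat.DivMod using (_/_; _%_; m<n⇒m%n≡m; m<n⇒m/n≡0; [m+n]%n≡m%n; m/n≡1+[m∸n]/n)

  -- Words are stored last letter first, so the first hit is the last large letter. The value counts
  -- the letters before it; the letter itself is at `suc (pos s u)`.
  pos : ℕ → List ℕ → ℕ
  pos s []      = 0
  pos s (x ∷ u) with s ℕ.≤? x
  ... | yes _ = length u
  ... | no  _ = pos s u

  pos-spec : ∀ s {u} → Any (s ℕ.≤_) u → pos s u ℕ.< length u × s ℕ.≤ at u (suc (pos s u)) ×
             (∀ i → suc (pos s u) ℕ.< i → i ℕ.≤ length u → at u i ℕ.< s)
  pos-spec s {x ∷ u} p with s ℕ.≤? x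
  ... | yes s≤x = ℕ.≤-refl , subst (s ℕ.≤_) (sym (at-last x u refl)) s≤x , λ i lo hi → contradiction (ℕ.<-≤-trans lo hi) (ℕ.<-irrefl refl)
  ... | no  s≰x with p
  ... | here s≤x = contradiction s≤x s≰x
  ... | there q with pos-spec s q
  ... | lt , ge , later = ℕ.m≤n⇒m≤1+n lt , subst (s ℕ.≤_) (sym (at-init x u lt)) ge , go
    where
    go : ∀ i → suc (pos s u) ℕ.< i → i ℕ.≤ suc (length u) → at (x ∷ u) i ℕ.< s
    go i lo hi with i ℕ.≟ suc (length u)
    ... | yes _ = ℕ.≰⇒> s≰x
    ... | no ¬e = later i lo (ℕ.s≤s⁻¹ (ℕ.≤∧≢⇒< hi ¬e))

  after : ℕ → List ℕ → ℕ
  after s u = length u ℕ.∸ suc (pos s u)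

  wordCode : ℕ → List ℕ → Code
  wordCode s u = code (at u) (pos s u) (after s u)

  -- The lengths of the two lists in the code recover `pos` and the length of the word, after which
  -- the codes are compared position by position.
  wordCode-injective : ∀ s {u v} → pos s u ℕ.< length u → pos s v ℕ.< length v → wordCode s u ≡ wordCode s v → u ≡ v
  wordCode-injective s {u} {v} p q e = at-injective u v len agree
    where
    w w′ : ℕ → ℕ
    w = at u
    w′ = at v
    n₁ n₂ : ℕ
    n₁ = pos s u
    n₂ = after s u
    e₁ : n₁ ≡ pos s v
    e₁ = trans (sym (length-peel (w ∘ suc) (λ j → w (suc (n₁ ℕ.∸ suc j))) n₁)) (trans (cong (length ∘ proj₁) e)
      (length-peel (w′ ∘ suc) (λ j → w′ (suc (pos s v ℕ.∸ suc j))) (pos s v)))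
    e₂ : n₂ ≡ after s v
    e₂ = trans (sym (length-peel (λ j → w (suc (suc n₁ ℕ.+ j))) (λ j → w (suc (suc n₁ ℕ.+ (n₂ ℕ.∸ suc j)))) n₂)) (trans (cong (length ∘ proj₂ ∘ proj₂) e)
      (length-peel (λ j → w′ (suc (suc (pos s v) ℕ.+ j))) (λ j → w′ (suc (suc (pos s v) ℕ.+ (after s v ℕ.∸ suc j)))) (after s v)))
    len : length u ≡ length v
    len = trans (sym (ℕ.m+[n∸m]≡n p)) (trans (cong₂ (λ a b → suc a ℕ.+ b) e₁ e₂) (ℕ.m+[n∸m]≡n q))
    same : code w n₁ n₂ ≡ code w′ n₁ n₂
    same = trans e (cong₂ (code w′) (sym e₁) (sym e₂))
    agree : ∀ i → 1 ℕ.≤ i → i ℕ.≤ length u → w i ≡ w′ i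
    agree (suc i) _ i≤ with ℕ.<-cmp i n₁
    ... | tri< i< _ _ = peel-injective n₁ (w ∘ suc) _ (w′ ∘ suc) _ (λ _ _ → refl) (λ _ _ → refl) (cong proj₁ same) i i<
    ... | tri≈ _ refl _ = cong (proj₁ ∘ proj₂) same
    ... | tri> _ _ i> = subst (λ t → w (suc t) ≡ w′ (suc t)) (ℕ.m+[n∸m]≡n i>)
      (peel-injective n₂ (λ j → w (suc (suc n₁ ℕ.+ j))) _ (λ j → w′ (suc (suc n₁ ℕ.+ j))) _ (λ _ _ → refl) (λ _ _ → refl) (cong (proj₂ ∘ proj₂) same)
        (i ℕ.∸ suc n₁) (ℕ.∸-monoˡ-< i≤ i>))

  All1⇒length≤sum : ∀ {u} → All (1 ℕ.≤_) u → length u ℕ.≤ sum u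
  All1⇒length≤sum []       = ℕ.z≤n
  All1⇒length≤sum (p ∷ ps) = ℕ.+-mono-≤ p (All1⇒length≤sum ps)

  All≤sum : ∀ u → All (ℕ._≤ sum u) u
  All≤sum []      = []
  All≤sum (x ∷ u) = ℕ.m≤m+n x (sum u) ∷ All.map (λ p → ℕ.≤-trans p (ℕ.m≤n+m (sum u) x)) (All≤sum u)

  Encoded : Scheme → ℕ → List ℕ → Set
  Encoded S s u = pos s u ℕ.< length u × ∃[ a ] a ℕ.≤ suc (length u) × Fits S (at u) (pos s u) (after s u) a

  -- Positive letters of sum `g` number at most `g`, so `N = suc g` covers both region lengths and
  -- `a`.
  count-words : ∀ S s g {us} → Unique us → (∀ {u} → u ∈ us → All (1 ℕ.≤_) u × sum u ≡ g × Encoded S s u) →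
    ℕ⇒ℚ (length us) ℚ.* pow r g ℚ.≤ ℕ⇒ℚ (suc g) ℚ.* (ℕ⇒ℚ (suc g) ℚ.* (ℕ⇒ℚ (suc g) ℚ.* codes-bound S))
  count-words S s g {us} uniq ok = ℚ.≤-trans
    (count≤mass codeMass-nonNeg (pow r g) (wordCode s) uniq
      (λ u∈ v∈ → wordCode-injective s (proj₁ (proj₂ (proj₂ (ok u∈)))) (proj₁ (proj₂ (proj₂ (ok v∈))))) (λ u∈ → encode (ok u∈)))
    (allCodes-mass S (suc g))
    where
    encode : ∀ {u} → All (1 ℕ.≤_) u × sum u ≡ g × Encoded S s u → wordCode s u ∈ allCodes S (suc g) × codeMass (wordCode s u) ≡ pow r g
    encode {u} (positive , refl , p , a , a≤ , fits) =
      ∈-allCodes S (ℕ.s≤s (ℕ.≤-trans (ℕ.<⇒≤ p) len≤)) (ℕ.s≤s (ℕ.≤-trans (ℕ.m∸n≤m (length u) (suc (pos s u))) len≤))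
        (Fits.1≤a fits) (ℕ.≤-trans a≤ (ℕ.s≤s len≤)) (code-complete S fits) ,
      trans (code-mass (at u) (pos s u) (after s u)) (cong (pow r) (trans (cong (sumTo (at u ∘ suc)) (ℕ.m+[n∸m]≡n p)) (sym (sum-at u))))
      where
      len≤ : length u ℕ.≤ sum u
      len≤ = All1⇒length≤sum positive

  -- The carry `(a + b) / m` is 0 or 1, which merges the two kinds of Kunz inequality. The
  -- quantifiers are bounded to keep the condition decidable.
  Kunz : List ℕ → Set
  Kunz u = ∀ {a} → a ℕ.< suc (length u) → ∀ {b} → b ℕ.< suc (length u) →
           at u ((a ℕ.+ b) % suc (length u)) ℕ.≤ at u a ℕ.+ at u b ℕ.+ (a ℕ.+ b) / suc (length u)

  kunz? : ∀ u → Dec (Kunz u)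
  kunz? u = ℕ.allUpTo? (λ a → ℕ.allUpTo? (λ b → at u ((a ℕ.+ b) % suc (length u)) ℕ.≤? at u a ℕ.+ at u b ℕ.+ (a ℕ.+ b) / suc (length u)) (suc (length u))) (suc (length u))

  kunz-low : ∀ u → Kunz u → ∀ i j → i ℕ.+ j ℕ.≤ length u → at u (i ℕ.+ j) ℕ.≤ at u i ℕ.+ at u j
  kunz-low u k i j h = subst (at u (i ℕ.+ j) ℕ.≤_) (trans (cong (at u i ℕ.+ at u j ℕ.+_) (m<n⇒m/n≡0 (ℕ.s≤s h))) (ℕ.+-identityʳ _))
    (subst (λ t → at u t ℕ.≤ at u i ℕ.+ at u j ℕ.+ (i ℕ.+ j) / suc (length u)) (m<n⇒m%n≡m (ℕ.s≤s h))
      (k (ℕ.s≤s (ℕ.≤-trans (ℕ.m≤m+n i j) h)) (ℕ.s≤s (ℕ.≤-trans (ℕ.m≤n+m j i) h))))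

  kunz-high : ∀ u → Kunz u → ∀ i j t → i ℕ.≤ length u → j ℕ.≤ length u → t ℕ.≤ length u → i ℕ.+ j ≡ suc (length u) ℕ.+ t →
              at u t ℕ.≤ suc (at u i ℕ.+ at u j)
  kunz-high u k i j t i≤ j≤ t≤ e = subst (at u t ℕ.≤_) (trans (cong (at u i ℕ.+ at u j ℕ.+_) quotient) (ℕ.+-comm _ 1))
    (subst (λ x → at u x ℕ.≤ at u i ℕ.+ at u j ℕ.+ (i ℕ.+ j) / suc (length u)) remainder (k (ℕ.s≤s i≤) (ℕ.s≤s j≤)))
    where
    m : ℕ
    m = suc (length u)
    remainder : (i ℕ.+ j) % m ≡ t
    remainder = trans (cong (_% m) (trans e (ℕ.+-comm m t))) (trans ([m+n]%n≡m%n t m) (m<n⇒m%n≡m (ℕ.s≤s t≤)))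
    quotient : (i ℕ.+ j) / m ≡ 1
    quotient = trans (cong (_/ m) e) (trans (m/n≡1+[m∸n]/n (ℕ.m≤m+n m t)) (cong suc (trans (cong (_/ m) (ℕ.m+n∸m≡n m t)) (m<n⇒m/n≡0 (ℕ.s≤s t≤)))))

  -- If no letter is 1, `a` is one past the end: the chain condition becomes vacuous and every
  -- position is known to differ from 1.
  first-one : ∀ (w : ℕ → ℕ) ℓ → ∃[ a ] 1 ℕ.≤ a × a ℕ.≤ suc ℓ × (a ℕ.≤ ℓ → w a ≡ 1) × (∀ i → 1 ℕ.≤ i → i ℕ.< a → w i ≢ 1)
  first-one w zero    = 1 , ℕ.≤-refl , ℕ.≤-refl , (λ ()) , λ i 1≤i i<1 → contradiction 1≤i (ℕ.<⇒≱ i<1)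
  first-one w (suc ℓ) with first-one w ℓ
  ... | a , 1≤a , a≤ , one , none with a ℕ.≤? ℓ | w (suc ℓ) ℕ.≟ 1
  ... | yes a≤ℓ | _ = a , 1≤a , ℕ.m≤n⇒m≤1+n a≤ , (λ _ → one a≤ℓ) , none
  ... | no  a≰ℓ | yes e with ℕ.≤-antisym a≤ (ℕ.≰⇒> a≰ℓ)
  ... | refl = a , 1≤a , ℕ.n≤1+n a , (λ _ → e) , none
  first-one w (suc ℓ) | a , 1≤a , a≤ , one , none | no a≰ℓ | no ¬e with ℕ.≤-antisym a≤ (ℕ.≰⇒> a≰ℓ)
  ... | refl = suc a , ℕ.s≤s ℕ.z≤n , ℕ.≤-refl , (λ h → contradiction h ℕ.1+n≰n) , later
    where
    later : ∀ i → 1 ℕ.≤ i → i ℕ.< suc a → w i ≢ 1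
    later i 1≤i i< with i ℕ.≟ a
    ... | yes refl = ¬e
    ... | no  i≢a  = none i 1≤i (ℕ.≤∧≢⇒< (ℕ.s≤s⁻¹ i<) i≢a)

  -- The large letter at `k` forces both sums: `i + j = k` gives `s ≤ w k ≤ w i + w j`, and
  -- `i + j = m + k` gives `s ≤ w k ≤ w i + w j + 1`, whence the inner floor is one lower.
  encoded : ∀ S s u → let open Scheme S in Kunz u → Any (s ℕ.≤_) u →
    floor outer ℕ.≤ s → suc (floor inner) ℕ.≤ s →
    (∀ i → 1 ℕ.≤ i → i ℕ.≤ length u → at u i ∈ letters outer) →
    (∀ i → suc (pos s u) ℕ.< i → i ℕ.≤ length u → at u i ℕ.< s → at u i ∈ letters inner) →
    (∀ i → 1 ℕ.≤ i → i ℕ.≤ length u → s ℕ.≤ at u i → at u i ∈ top) → Encoded S s u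
  encoded S s u kunz any floor₁ floor₂ outer∈ inner∈ top∈ with pos-spec s any | first-one (at u) (length u)
  ... | p , s≤ , later | a , 1≤a , a≤ , one , none = p , a , a≤ , record
    { 1≤a      = 1≤a
    ; outer∈   = λ i 1≤i i≤ → outer∈ i 1≤i (ℕ.≤-trans i≤ (ℕ.<⇒≤ p))
    ; inner∈   = λ i lo hi → inner∈ i lo (to hi) (later i lo (to hi))
    ; top∈     = top∈ (suc (pos s u)) (ℕ.s≤s ℕ.z≤n) p s≤
    ; outerSum = λ i j _ _ e → ℕ.≤-trans floor₁ (ℕ.≤-trans s≤ (subst (λ t → at u t ℕ.≤ at u i ℕ.+ at u j) e
                   (kunz-low u kunz i j (subst (ℕ._≤ length u) (sym e) p))))
    ; innerSum = λ i j lo₁ lo₂ e → ℕ.s≤s⁻¹ (ℕ.≤-trans floor₂ (ℕ.≤-trans s≤ (kunz-high u kunz i j (suc (pos s u)) (below i j lo₂ e)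
                   (below j i lo₁ (trans (ℕ.+-comm j i) e)) p (trans e (cong (λ t → suc t ℕ.+ suc (pos s u)) ℓ)))))
    ; chain    = λ i _ h → ℕ.≤-trans (kunz-low u kunz i a (to h)) (ℕ.≤-reflexive (trans (cong (at u i ℕ.+_) (one (ℕ.≤-trans (ℕ.m≤n+m a i) (to h)))) (ℕ.+-comm (at u i) 1)))
    ; no1      = λ i 1≤i i<a _ → none i 1≤i i<a
    }
    where
    ℓ : suc (pos s u) ℕ.+ after s u ≡ length u
    ℓ = ℕ.m+[n∸m]≡n p
    to : ∀ {i} → i ℕ.≤ suc (pos s u) ℕ.+ after s u → i ℕ.≤ length u
    to = subst (_ ℕ.≤_) ℓ
    below : ∀ i j → suc (pos s u) ℕ.< j → i ℕ.+ j ≡ suc (suc (pos s u) ℕ.+ after s u) ℕ.+ suc (pos s u) → i ℕ.≤ length u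
    below i j lo e = ℕ.+-cancelʳ-≤ (suc (suc (pos s u))) i (length u) (ℕ.≤-trans (ℕ.+-monoʳ-≤ i lo)
      (ℕ.≤-reflexive (trans e (trans (cong (λ t → suc t ℕ.+ suc (pos s u)) ℓ) (sym (ℕ.+-suc (length u) (suc (pos s u))))))))

  -- A word ending in 3 has no inner region, so S₃ can use the empty alphabet there.
  S₃ S₄ S₅ : Scheme
  S₃ = record { outer = L₃ ; inner = L₀ ; top = 3 ∷ [] ; κ = 1ℚ ; τ = 1ℚ ; 0≤κ = 0≤1 ; κ≤1 = ℚ.≤-refl ; 1≤τ = ℚ.≤-refl
              ; τ≤2 = from-yes (1ℚ ℚ.≤? 2ℚ) ; κτ≡1 = refl ; outerBound = L₃-outer ; innerBound = L₀-inner ; topBound = from-yes (sumBy (pow r) (3 ∷ []) ℚ.≤? 2ℚ) }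
  S₄ = record { outer = L₄ ; inner = L₃ ; top = 4 ∷ [] ; κ = κ₄ ; τ = τ₄ ; 0≤κ = from-yes (0ℚ ℚ.≤? κ₄) ; κ≤1 = from-yes (κ₄ ℚ.≤? 1ℚ) ; 1≤τ = from-yes (1ℚ ℚ.≤? τ₄)
              ; τ≤2 = from-yes (τ₄ ℚ.≤? 2ℚ) ; κτ≡1 = refl ; outerBound = L₄-outer ; innerBound = L₃-inner ; topBound = from-yes (sumBy (pow r) (4 ∷ []) ℚ.≤? 2ℚ) }
  S₅ = record { outer = L₅ ; inner = L₄ ; top = 5 ∷ [] ; κ = κ₄ ; τ = τ₄ ; 0≤κ = from-yes (0ℚ ℚ.≤? κ₄) ; κ≤1 = from-yes (κ₄ ℚ.≤? 1ℚ) ; 1≤τ = from-yes (1ℚ ℚ.≤? τ₄)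
              ; τ≤2 = from-yes (τ₄ ℚ.≤? 2ℚ) ; κτ≡1 = refl ; outerBound = L₅-outer ; innerBound = L₄-inner ; topBound = from-yes (sumBy (pow r) (5 ∷ []) ℚ.≤? 2ℚ) }

  -- Inner chains at level 5 weigh at most 1, so there is no debt to pay and `κ = τ = 1`. The top
  -- letter has no fixed value and ranges over the whole alphabet.
  S₆ : ℕ → Scheme
  S₆ B = record { outer = L₆ B ; inner = L₅ ; top = range 1 B ; κ = 1ℚ ; τ = 1ℚ ; 0≤κ = 0≤1 ; κ≤1 = ℚ.≤-refl ; 1≤τ = ℚ.≤-refl
                ; τ≤2 = from-yes (1ℚ ℚ.≤? 2ℚ) ; κτ≡1 = refl ; outerBound = L₆-outer B ; innerBound = L₅-inner ; topBound = L₆-letterMass B }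

  private
    letter∈ : ∀ {u} → All (1 ℕ.≤_) u → ∀ {B} → All (ℕ._≤ B) u → ∀ i → 1 ℕ.≤ i → i ℕ.≤ length u → at u i ∈ range 1 B
    letter∈ positive bounded i 1≤i i≤ = ∈-range (at-All positive 1≤i i≤) (ℕ.s≤s (at-All bounded 1≤i i≤))

    single∈ : ∀ {x s} → x ℕ.≤ s → s ℕ.≤ x → x ∈ s ∷ []
    single∈ p q = here (ℕ.≤-antisym p q)

  encoded₃ : ∀ u → All (1 ℕ.≤_) (3 ∷ u) → All (ℕ._≤ 3) (3 ∷ u) → Kunz (3 ∷ u) → Encoded S₃ 3 (3 ∷ u)
  encoded₃ u positive ≤3 kunz = encoded S₃ 3 (3 ∷ u) kunz (here ℕ.≤-refl) ℕ.≤-refl (ℕ.s≤s ℕ.z≤n) (letter∈ positive ≤3)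
    (λ i lo hi _ → contradiction (ℕ.<-≤-trans lo hi) (ℕ.<-irrefl refl)) (λ i 1≤i i≤ → single∈ (at-All ≤3 1≤i i≤))

  encoded₄ : ∀ {u} → All (1 ℕ.≤_) u → All (ℕ._≤ 4) u → Any (4 ℕ.≤_) u → Kunz u → Encoded S₄ 4 u
  encoded₄ {u} positive ≤4 any kunz = encoded S₄ 4 u kunz any ℕ.≤-refl ℕ.≤-refl (letter∈ positive ≤4)
    (λ i lo hi lt → ∈-range (at-All positive (ℕ.<⇒≤ (ℕ.≤-<-trans (ℕ.s≤s ℕ.z≤n) lo)) hi) lt) (λ i 1≤i i≤ → single∈ (at-All ≤4 1≤i i≤))

  encoded₅ : ∀ {u} → All (1 ℕ.≤_) u → All (ℕ._≤ 5) u → Any (5 ℕ.≤_) u → Kunz u → Encoded S₅ 5 u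
  encoded₅ {u} positive ≤5 any kunz = encoded S₅ 5 u kunz any ℕ.≤-refl ℕ.≤-refl (letter∈ positive ≤5)
    (λ i lo hi lt → ∈-range (at-All positive (ℕ.<⇒≤ (ℕ.≤-<-trans (ℕ.s≤s ℕ.z≤n) lo)) hi) lt) (λ i 1≤i i≤ → single∈ (at-All ≤5 1≤i i≤))

  encoded₆ : ∀ {u} → All (1 ℕ.≤_) u → Any (6 ℕ.≤_) u → Kunz u → Encoded (S₆ (sum u)) 6 u
  encoded₆ {u} positive any kunz = encoded (S₆ (sum u)) 6 u kunz any ℕ.≤-refl ℕ.≤-refl (letter∈ positive (All≤sum u))
    (λ i lo hi lt → ∈-range (at-All positive (ℕ.<⇒≤ (ℕ.≤-<-trans (ℕ.s≤s ℕ.z≤n) lo)) hi) lt) (λ i 1≤i i≤ _ → letter∈ positive (All≤sum u) i 1≤i i≤)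

-- The correspondence between numerical semigroups and Kunz words.

module KunzWords where

  open import Data.Nat.DivMod using (_/_; _%_; m<n⇒m%n≡m; m<n⇒m/n≡0; [m+kn]%n≡m%n; +-distrib-/-∣ʳ; m*n/n≡m; %-distribˡ-+; m≡m%n+[m/n]*n; m%n<n; n%n≡0)
  open Sums
  open Coding
  open Counting

  Valid : List ℕ → Set
  Valid u = All (1 ℕ.≤_) u × Kunz u

  valid? : Decidable Valid
  valid? u = All.all? (1 ℕ.≤?_) u ×-dec kunz? u

  i+tm%m : ∀ {i m} .{{_ : ℕ.NonZero m}} t → i ℕ.< m → (i ℕ.+ t ℕ.* m) % m ≡ i
  i+tm%m {i} {m} t i<m = trans ([m+kn]%n≡m%n i t m) (m<n⇒m%n≡m i<m)

  x+tm/m : ∀ x {m} .{{_ : ℕ.NonZero m}} t → (x ℕ.+ t ℕ.* m) / m ≡ x / m ℕ.+ t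
  x+tm/m x {m} t = trans (+-distrib-/-∣ʳ x (n∣m*n t)) (cong (x / m ℕ.+_) (m*n/n≡m t m))

  i+tm/m : ∀ {i m} .{{_ : ℕ.NonZero m}} t → i ℕ.< m → (i ℕ.+ t ℕ.* m) / m ≡ t
  i+tm/m {i} {m} t i<m = trans (x+tm/m i t) (cong (ℕ._+ t) (m<n⇒m/n≡0 i<m))

  -- The last summand is the carry of the residues, the same term as in `Kunz`; this yields closure
  -- under addition.
  /-+ : ∀ a b m .{{_ : ℕ.NonZero m}} → (a ℕ.+ b) / m ≡ a / m ℕ.+ b / m ℕ.+ (a % m ℕ.+ b % m) / m
  /-+ a b m = trans (cong (_/ m) (trans (cong₂ ℕ._+_ (m≡m%n+[m/n]*n a m) (m≡m%n+[m/n]*n b m))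
      (solve 5 (λ x p y q m → (x :+ p :* m) :+ (y :+ q :* m) := (x :+ y) :+ (p :+ q) :* m) refl (a % m) (a / m) (b % m) (b / m) m)))
    (trans (x+tm/m (a % m ℕ.+ b % m) (a / m ℕ.+ b / m)) (ℕ.+-comm ((a % m ℕ.+ b % m) / m) (a / m ℕ.+ b / m)))
    where open ℕSolver.+-*-Solver

  -- The modulus is a parameter because the recursion shortens the word while the multiplicity stays
  -- fixed.
  wordGaps : ℕ → List ℕ → List ℕ
  wordGaps m []      = []
  wordGaps m (x ∷ u) = map (λ t → suc (length u) ℕ.+ t ℕ.* m) (upTo x) ++ wordGaps m u

  length-wordGaps : ∀ m u → length (wordGaps m u) ≡ sum u
  length-wordGaps m []      = refl
  length-wordGaps m (x ∷ u) = trans (List.length-++ (map (λ t → suc (length u) ℕ.+ t ℕ.* m) (upTo x)))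
    (cong₂ ℕ._+_ (trans (List.length-map (λ t → suc (length u) ℕ.+ t ℕ.* m) (upTo x)) (List.length-upTo x)) (length-wordGaps m u))

  ∈-wordGaps⁺ : ∀ m u {i t} → 1 ℕ.≤ i → i ℕ.≤ length u → t ℕ.< at u i → i ℕ.+ t ℕ.* m ∈ wordGaps m u
  ∈-wordGaps⁺ m (x ∷ u) {i} 1≤i i≤ t< with i ℕ.≟ suc (length u)
  ... | yes refl = ∈.∈-++⁺ˡ (∈.∈-map⁺ (λ t → suc (length u) ℕ.+ t ℕ.* m) (∈.∈-upTo⁺ t<))
  ... | no  i≢   = ∈.∈-++⁺ʳ (map (λ t → suc (length u) ℕ.+ t ℕ.* m) (upTo x)) (∈-wordGaps⁺ m u 1≤i (ℕ.s≤s⁻¹ (ℕ.≤∧≢⇒< i≤ i≢)) t<)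
  ∈-wordGaps⁺ m [] 1≤i i≤ ()

  ∈-wordGaps⁻ : ∀ m u {y} → y ∈ wordGaps m u → ∃[ i ] ∃[ t ] 1 ℕ.≤ i × i ℕ.≤ length u × t ℕ.< at u i × y ≡ i ℕ.+ t ℕ.* m
  ∈-wordGaps⁻ m (x ∷ u) y∈ with ∈.∈-++⁻ (map (λ t → suc (length u) ℕ.+ t ℕ.* m) (upTo x)) y∈
  ... | inj₁ p with ∈.∈-map⁻ (λ t → suc (length u) ℕ.+ t ℕ.* m) p
  ... | t , t∈ , e = suc (length u) , t , s≤s z≤n , ℕ.≤-refl , subst (t ℕ.<_) (sym (at-last x u refl)) (∈.∈-upTo⁻ t∈) , e
  ∈-wordGaps⁻ m (x ∷ u) y∈ | inj₂ p with ∈-wordGaps⁻ m u p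
  ... | i , t , 1≤i , i≤ , t< , e = i , t , 1≤i , ℕ.m≤n⇒m≤1+n i≤ , subst (t ℕ.<_) (sym (at-init x u i≤)) t< , e

  wordGaps-unique : ∀ m .{{_ : ℕ.NonZero m}} u → length u ℕ.< m → Unique (wordGaps m u)
  wordGaps-unique m []      _  = []
  wordGaps-unique m (x ∷ u) lt = Unique.++⁺
    (Unique.map⁺ (λ {s} {t} e → trans (sym (i+tm/m s lt)) (trans (cong (_/ m) e) (i+tm/m t lt))) (Unique.upTo⁺ x))
    (wordGaps-unique m u (ℕ.<⇒≤ lt)) disjoint
    where
    disjoint : ∀ {y} → ¬ (y ∈ map (λ t → suc (length u) ℕ.+ t ℕ.* m) (upTo x) × y ∈ wordGaps m u)
    disjoint (p , q) with ∈.∈-map⁻ (λ t → suc (length u) ℕ.+ t ℕ.* m) p | ∈-wordGaps⁻ m u q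
    ... | s , _ , refl | i , t , _ , i≤ , _ , e = ℕ.1+n≰n (subst (ℕ._≤ length u)
      (sym (trans (sym (i+tm%m s lt)) (trans (cong (_% m) e) (i+tm%m t (ℕ.≤-<-trans i≤ (ℕ.<⇒≤ lt)))))) i≤)

  modulus : List ℕ → ℕ
  modulus u = suc (length u)

  Member : List ℕ → ℕ → Set
  Member u x = at u (x % modulus u) ℕ.≤ x / modulus u

  member? : ∀ u → Decidable (Member u)
  member? u x = at u (x % modulus u) ℕ.≤? x / modulus u

  residue≤ : ∀ u x → x % modulus u ℕ.≤ length u
  residue≤ u x = ℕ.s≤s⁻¹ (m%n<n x (modulus u))

  fromWord : ∀ u → Valid u → NumericalSemigroup
  fromWord u (positive , kunz) = record
    { carrier     = Member u
    ; carrier?    = member? u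
    ; 0∈carrier   = subst (ℕ._≤ 0 / modulus u) (sym (at-0 u)) z≤n
    ; +-closed    = λ {a} {b} → closed {a} {b}
    ; gaps        = wordGaps (modulus u) u
    ; gaps-unique = wordGaps-unique (modulus u) u ℕ.≤-refl
    ; gaps-spec   = λ x → mk⇔ (gap⇒ x) (⇒gap x)
    }
    where
    m : ℕ
    m = modulus u
    closed : ∀ {a b} → Member u a → Member u b → Member u (a ℕ.+ b)
    closed {a} {b} p q = begin
      at u ((a ℕ.+ b) % m)                                              ≡⟨ cong (at u) (%-distribˡ-+ a b m) ⟩
      at u ((a % m ℕ.+ b % m) % m)                                      ≤⟨ kunz (m%n<n a m) (m%n<n b m) ⟩
      at u (a % m) ℕ.+ at u (b % m) ℕ.+ (a % m ℕ.+ b % m) / m           ≤⟨ ℕ.+-monoˡ-≤ ((a % m ℕ.+ b % m) / m) (ℕ.+-mono-≤ p q) ⟩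
      a / m ℕ.+ b / m ℕ.+ (a % m ℕ.+ b % m) / m                         ≡⟨ /-+ a b m ⟨
      (a ℕ.+ b) / m                                                     ∎
      where open ℕ.≤-Reasoning
    gap⇒ : ∀ x → x ∈ wordGaps m u → ¬ Member u x
    gap⇒ x x∈ p with ∈-wordGaps⁻ m u x∈
    ... | i , t , _ , i≤ , t< , refl = ℕ.<⇒≱ t< (subst (at u i ℕ.≤_) (i+tm/m t (s≤s i≤)) (subst (λ j → at u j ℕ.≤ (i ℕ.+ t ℕ.* m) / m) (i+tm%m t (s≤s i≤)) p))
    ⇒gap : ∀ x → ¬ Member u x → x ∈ wordGaps m u
    ⇒gap x ¬p = subst (_∈ wordGaps m u) (sym (m≡m%n+[m/n]*n x m)) (∈-wordGaps⁺ m u (1≤ (x % m) refl) (residue≤ u x) (ℕ.≰⇒> ¬p))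
      where
      1≤ : ∀ i → i ≡ x % m → 1 ℕ.≤ i
      1≤ (suc i) _ = s≤s z≤n
      1≤ zero    e = contradiction (subst (λ j → at u j ℕ.≤ x / m) e (subst (ℕ._≤ x / m) (sym (at-0 u)) z≤n)) ¬p

  genus-fromWord : ∀ u v → genus (fromWord u v) ≡ sum u
  genus-fromWord u v = length-wordGaps (modulus u) u

  -- The genus is the length of a chosen gap list; equal subsets have duplicate-free gap lists with
  -- the same members.
  genus-cong : ∀ {S T} → S ≋ T → genus S ≡ genus T
  genus-cong {S} {T} (p , q) = ℕ.≤-antisym
    (length-⊆ (NumericalSemigroup.gaps-unique S) (λ x∈ → GapLists.∉⇒gap T (λ x∈T → GapLists.gap⇒∉ S x∈ (q x∈T))))
    (length-⊆ (NumericalSemigroup.gaps-unique T) (λ x∈ → GapLists.∉⇒gap S (λ x∈S → GapLists.gap⇒∉ T x∈ (p x∈S))))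

  member-residue : ∀ u {i t} → i ℕ.≤ length u → Member u (i ℕ.+ t ℕ.* modulus u) → at u i ℕ.≤ t
  member-residue u {i} {t} i≤ p = subst (at u i ℕ.≤_) (i+tm/m t (s≤s i≤))
    (subst (λ j → at u j ℕ.≤ (i ℕ.+ t ℕ.* modulus u) / modulus u) (i+tm%m t (s≤s i≤)) p)

  residue-member : ∀ u {i t} → i ℕ.≤ length u → at u i ℕ.≤ t → Member u (i ℕ.+ t ℕ.* modulus u)
  residue-member u {i} {t} i≤ p = subst (λ j → at u j ℕ.≤ (i ℕ.+ t ℕ.* modulus u) / modulus u) (sym (i+tm%m t (s≤s i≤)))
    (subst (at u i ℕ.≤_) (sym (i+tm/m t (s≤s i≤))) p)

  fromWord-multiplicity : ∀ u v → IsMultiplicity (fromWord u v) (modulus u)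
  fromWord-multiplicity u (positive , kunz) = (modulus∈ , λ ()) , minimal
    where
    modulus∈ : Member u (modulus u)
    modulus∈ = subst (λ j → at u j ℕ.≤ modulus u / modulus u) (sym (n%n≡0 (modulus u))) (subst (ℕ._≤ modulus u / modulus u) (sym (at-0 u)) z≤n)
    minimal : ∀ x → Member u x → x ≢ 0 → modulus u ℕ.≤ x
    minimal x x∈ x≢0 with modulus u ℕ.≤? x
    ... | yes p = p
    ... | no  p = contradiction (ℕ.≤-trans (at-All positive (ℕ.n≢0⇒n>0 x≢0) (ℕ.s≤s⁻¹ x<m))
        (subst (at u x ℕ.≤_) (m<n⇒m/n≡0 x<m) (subst (λ j → at u j ℕ.≤ x / modulus u) (m<n⇒m%n≡m x<m) x∈))) λ ()
      where
      x<m : x ℕ.< modulus u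
      x<m = ℕ.≰⇒> p

  multiplicity-unique : ∀ {S T m m′} → S ≋ T → IsMultiplicity S m → IsMultiplicity T m′ → m ≡ m′
  multiplicity-unique (p , q) ((m∈ , m≢0) , min) ((m′∈ , m′≢0) , min′) = ℕ.≤-antisym (min _ (q m′∈) m′≢0) (min′ _ (p m∈) m≢0)

  -- The multiplicity determines the length, and `w i` is the least `t` for which `i + t * m` is a
  -- member.
  fromWord-injective : ∀ u v {p q} → fromWord u p ≋ fromWord v q → u ≡ v
  fromWord-injective u v {p} {q} eq@(to , from) = at-injective u v len
    (λ i _ i≤ → ℕ.≤-antisym
      (member-residue u i≤ (subst (λ m → Member u (i ℕ.+ at v i ℕ.* m)) (sym (cong suc len)) (from {i ℕ.+ at v i ℕ.* modulus v} (residue-member v (subst (i ℕ.≤_) len i≤) ℕ.≤-refl))))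
      (member-residue v (subst (i ℕ.≤_) len i≤) (subst (λ m → Member v (i ℕ.+ at u i ℕ.* m)) (cong suc len) (to {i ℕ.+ at u i ℕ.* modulus u} (residue-member u i≤ ℕ.≤-refl)))))
    where
    len : length u ≡ length v
    len = ℕ.suc-injective (multiplicity-unique {fromWord u p} {fromWord v q} eq (fromWord-multiplicity u p) (fromWord-multiplicity v q))

  least : ∀ {P : ℕ → Set} → Decidable P → ∀ {N} → P N → ∃[ k ] P k × (∀ j → P j → k ℕ.≤ j)
  least {P} P? {N} pN with search (suc N)
    where
    search : ∀ N → (∃[ k ] P k × (∀ j → P j → k ℕ.≤ j)) ⊎ (∀ j → j ℕ.< N → ¬ P j)
    search zero    = inj₂ λ _ ()
    search (suc N) with search N
    ... | inj₁ found = inj₁ found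
    ... | inj₂ none with P? N
    ... | yes pN = inj₁ (N , pN , λ j pj → ℕ.≮⇒≥ λ j<N → none j j<N pj)
    ... | no ¬pN = inj₂ none′
      where
      none′ : ∀ j → j ℕ.< suc N → ¬ P j
      none′ j j< with j ℕ.≟ N
      ... | yes refl = ¬pN
      ... | no  j≢N  = none j (ℕ.≤∧≢⇒< (ℕ.s≤s⁻¹ j<) j≢N)
  ... | inj₁ found = found
  ... | inj₂ none  = contradiction pN (none N ℕ.≤-refl)

  tabulateDown : (ℕ → ℕ) → ℕ → List ℕ
  tabulateDown f zero    = []
  tabulateDown f (suc n) = f (suc n) ∷ tabulateDown f n

  length-tabulateDown : ∀ f n → length (tabulateDown f n) ≡ n
  length-tabulateDown f zero    = refl
  length-tabulateDown f (suc n) = cong suc (length-tabulateDown f n)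

  at-tabulateDown : ∀ f n {i} → 1 ℕ.≤ i → i ℕ.≤ n → at (tabulateDown f n) i ≡ f i
  at-tabulateDown f zero    {suc i} _ ()
  at-tabulateDown f (suc n) {i} 1≤i i≤ with i ℕ.≟ suc n
  ... | yes refl = at-last (f (suc n)) (tabulateDown f n) (cong suc (sym (length-tabulateDown f n)))
  ... | no  i≢   = trans (at-init (f (suc n)) (tabulateDown f n) (subst (i ℕ.≤_) (sym (length-tabulateDown f n)) i≤n)) (at-tabulateDown f n 1≤i i≤n)
    where
    i≤n : i ℕ.≤ n
    i≤n = ℕ.s≤s⁻¹ (ℕ.≤∧≢⇒< i≤ i≢)

  -- All gaps lie below `2 * genus S`, which bounds both searches: for the least nonzero member `m`,
  -- and for the least quotient `w i` in each class. Minimality of `m` gives `w i ≥ 1` for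
  -- `0 < i < m`.
  toWord : ∀ S → ∃[ u ] Σ (Valid u) λ v → S ≋ fromWord u v
  toWord S with least (λ x → NumericalSemigroup.carrier? S x ×-dec ¬? (x ℕ.≟ 0)) {suc (2 ℕ.* genus S)} (large∈ (ℕ.n≤1+n _) , λ ())
    where
    large∈ : ∀ {x} → 2 ℕ.* genus S ℕ.≤ x → NumericalSemigroup.carrier S x
    large∈ h = GapLists.¬gap⇒∈ S (λ x∈ → ℕ.<⇒≱ (GapLists.gap<2g S x∈) h)
  ... | zero  , (_ , 0≢0)  , _ = contradiction refl 0≢0
  ... | suc ℓ , (m∈ , _) , minimal = u , (positive , kunz) , (λ {x} → to x) , λ {x} → from x
    where
    open NumericalSemigroup S using (carrier; carrier?; 0∈carrier; +-closed)
    m : ℕ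
    m = suc ℓ
    large∈ : ∀ {x} → 2 ℕ.* genus S ℕ.≤ x → carrier x
    large∈ h = GapLists.¬gap⇒∈ S (λ x∈ → ℕ.<⇒≱ (GapLists.gap<2g S x∈) h)
    entry : ∀ i → ∃[ t ] carrier (i ℕ.+ t ℕ.* m) × (∀ j → carrier (i ℕ.+ j ℕ.* m) → t ℕ.≤ j)
    entry i = least (λ t → carrier? (i ℕ.+ t ℕ.* m)) {2 ℕ.* genus S} (large∈ (ℕ.≤-trans (ℕ.m≤m*n (2 ℕ.* genus S) m) (ℕ.m≤n+m _ i)))
    w : ℕ → ℕ
    w i = proj₁ (entry i)
    w∈ : ∀ i → carrier (i ℕ.+ w i ℕ.* m)
    w∈ i = proj₁ (proj₂ (entry i))
    w≤ : ∀ i {j} → carrier (i ℕ.+ j ℕ.* m) → w i ℕ.≤ j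
    w≤ i {j} = proj₂ (proj₂ (entry i)) j
    multiple∈ : ∀ t → carrier (t ℕ.* m)
    multiple∈ zero    = 0∈carrier
    multiple∈ (suc t) = +-closed m∈ (multiple∈ t)
    ≤⇒∈ : ∀ i {j} → w i ℕ.≤ j → carrier (i ℕ.+ j ℕ.* m)
    ≤⇒∈ i {j} h = subst carrier (trans (ℕ.+-assoc i _ _) (cong (i ℕ.+_) (trans (sym (ℕ.*-distribʳ-+ m (w i) (j ℕ.∸ w i))) (cong (ℕ._* m) (ℕ.m+[n∸m]≡n h)))))
      (+-closed (w∈ i) (multiple∈ (j ℕ.∸ w i)))
    u : List ℕ
    u = tabulateDown w ℓ
    len : length u ≡ ℓ
    len = length-tabulateDown w ℓ
    at≡w : ∀ i → i ℕ.< m → at u i ≡ w i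
    at≡w zero    _  = trans (at-0 u) (sym (ℕ.n≤0⇒n≡0 (w≤ 0 0∈carrier)))
    at≡w (suc i) i< = at-tabulateDown w ℓ (s≤s z≤n) (ℕ.s≤s⁻¹ i<)
    positive : All (1 ℕ.≤_) u
    positive = All-at u λ i 1≤i i≤ → subst (1 ℕ.≤_) (sym (at≡w i (s≤s (subst (i ℕ.≤_) len i≤)))) (1≤w i 1≤i (s≤s (subst (i ℕ.≤_) len i≤)))
      where
      1≤w : ∀ i → 1 ℕ.≤ i → i ℕ.< m → 1 ℕ.≤ w i
      1≤w i 1≤i i<m = ℕ.n≢0⇒n>0 λ e → ℕ.<⇒≱ i<m (minimal i
        (subst carrier (trans (cong (λ t → i ℕ.+ t ℕ.* m) e) (ℕ.+-identityʳ i)) (w∈ i) , λ { refl → contradiction 1≤i λ () }))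
    kunz′ : ∀ {a} → a ℕ.< m → ∀ {b} → b ℕ.< m → at u ((a ℕ.+ b) % m) ℕ.≤ at u a ℕ.+ at u b ℕ.+ (a ℕ.+ b) / m
    kunz′ {a} a< {b} b< = begin
      at u ((a ℕ.+ b) % m)              ≡⟨ at≡w ((a ℕ.+ b) % m) (m%n<n (a ℕ.+ b) m) ⟩
      w ((a ℕ.+ b) % m)                 ≤⟨ w≤ ((a ℕ.+ b) % m) (subst carrier rearrange (+-closed (w∈ a) (w∈ b))) ⟩
      w a ℕ.+ w b ℕ.+ (a ℕ.+ b) / m     ≡⟨ cong₂ (λ s t → s ℕ.+ t ℕ.+ (a ℕ.+ b) / m) (at≡w a a<) (at≡w b b<) ⟨
      at u a ℕ.+ at u b ℕ.+ (a ℕ.+ b) / m ∎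
      where
      open ℕ.≤-Reasoning
      open ℕSolver.+-*-Solver
      rearrange : (a ℕ.+ w a ℕ.* m) ℕ.+ (b ℕ.+ w b ℕ.* m) ≡ (a ℕ.+ b) % m ℕ.+ (w a ℕ.+ w b ℕ.+ (a ℕ.+ b) / m) ℕ.* m
      rearrange = trans (solve 5 (λ a p b q m → (a :+ p :* m) :+ (b :+ q :* m) := (a :+ b) :+ (p :+ q) :* m) refl a (w a) b (w b) m)
        (trans (cong (ℕ._+ (w a ℕ.+ w b) ℕ.* m) (m≡m%n+[m/n]*n (a ℕ.+ b) m))
        (solve 4 (λ x q p m → (x :+ q :* m) :+ p :* m := x :+ (p :+ q) :* m) refl ((a ℕ.+ b) % m) ((a ℕ.+ b) / m) (w a ℕ.+ w b) m))
    kunz : Kunz u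
    kunz = subst (λ ℓ′ → ∀ {a} → a ℕ.< suc ℓ′ → ∀ {b} → b ℕ.< suc ℓ′ → at u ((a ℕ.+ b) % suc ℓ′) ℕ.≤ at u a ℕ.+ at u b ℕ.+ (a ℕ.+ b) / suc ℓ′) (sym len) kunz′
    to : ∀ x → carrier x → Member u x
    to x x∈ = subst (λ ℓ′ → at u (x % suc ℓ′) ℕ.≤ x / suc ℓ′) (sym len) (subst (ℕ._≤ x / m) (sym (at≡w (x % m) (m%n<n x m)))
      (w≤ (x % m) (subst carrier (m≡m%n+[m/n]*n x m) x∈)))
    from : ∀ x → Member u x → carrier x
    from x p = subst carrier (sym (m≡m%n+[m/n]*n x m)) (≤⇒∈ (x % m) (subst (ℕ._≤ x / m) (at≡w (x % m) (m%n<n x m))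
      (subst (λ ℓ′ → at u (x % suc ℓ′) ℕ.≤ x / suc ℓ′) len p)))

  -- Words are canonical representatives modulo `_≋_`, so the maps between `Fin k` and the positions
  -- of `us` induced by `toWord` and `fromWord` are injective; the cardinalities are compared both
  -- ways.
  card-words : ∀ {ℓ} (P : Pred NumericalSemigroup ℓ) → (∀ {S T} → S ≋ T → P S → P T) → (fin : Finite (SemigroupsWith P)) →
    ∀ {us} → Unique us → (∀ {u} → u ∈ us → Σ (Valid u) λ v → P (fromWord u v)) → (∀ u v → P (fromWord u v) → u ∈ us) → card fin ≡ length us
  card-words P resp (k , bij) {us} uniq sound complete = ℕ.≤-antisym
    (Fin.injective⇒≤ {f = λ i → Any.index (word∈ (to i))} (λ {i} {j} e → injective (word-injective (to i) (to j)
      (trans (Anyₚ.lookup-index (word∈ (to i))) (trans (cong (lookup us) e) (sym (Anyₚ.lookup-index (word∈ (to j)))))))))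
    (Fin.injective⇒≤ {f = λ i → proj₁ (surjective (semigroup i))} λ {i} {j} e → lookup-injective us uniq
      (fromWord-injective (lookup us i) (lookup us j) {proj₁ (sound (∈.∈-lookup i))} {proj₁ (sound (∈.∈-lookup j))} (compose (proj₂ (surjective (semigroup i)) refl) (proj₂ (surjective (semigroup j)) e))))
    where
    open Bijection bij using (to; injective; surjective)
    compose : ∀ {A B C : Pred ℕ _} → A ≐ B → A ≐ C → B ≐ C
    compose (p , q) (p′ , q′) = (λ x → p′ (q x)) , λ x → p (q′ x)
    word : Σ NumericalSemigroup P → List ℕ
    word (S , _) = proj₁ (toWord S)
    word∈ : ∀ X → word X ∈ us
    word∈ (S , p) = complete (proj₁ (toWord S)) (proj₁ (proj₂ (toWord S))) (resp {S} {fromWord (proj₁ (toWord S)) (proj₁ (proj₂ (toWord S)))} (proj₂ (proj₂ (toWord S))) p)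
    word-injective : ∀ X Y → word X ≡ word Y → proj₁ X ≋ proj₁ Y
    word-injective (S , _) (T , _) e with toWord S | toWord T
    ... | u , v , (p , q) | u′ , v′ , (p′ , q′) with e
    ... | refl = (λ x → q′ (p x)) , λ x → q (p′ x)
    semigroup : Fin (length us) → Σ NumericalSemigroup P
    semigroup i = fromWord (lookup us i) (proj₁ (sound (∈.∈-lookup i))) , proj₂ (sound (∈.∈-lookup i))
    lookup-injective : ∀ (vs : List (List ℕ)) → Unique vs → ∀ {i j} → lookup vs i ≡ lookup vs j → i ≡ j
    lookup-injective (v ∷ vs) (v∉ ∷ u) {Fin.zero}  {Fin.zero}  e = refl
    lookup-injective (v ∷ vs) (v∉ ∷ u) {Fin.zero}  {Fin.suc j} e = contradiction e (All.lookup v∉ (∈.∈-lookup j))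
    lookup-injective (v ∷ vs) (v∉ ∷ u) {Fin.suc i} {Fin.zero}  e = contradiction (sym e) (All.lookup v∉ (∈.∈-lookup i))
    lookup-injective (v ∷ vs) (v∉ ∷ u) {Fin.suc i} {Fin.suc j} e = cong Fin.suc (lookup-injective vs u e)

-- Counting words by genus: the recurrence for letters at most 3 and the exponential bounds.

module Enumeration where

  open import Data.Nat.DivMod using (_/_; _%_; m<n⇒m%n≡m; m≡m%n+[m/n]*n; m≥n⇒m/n>0)
  open ℚLemmas
  open Sums
  open Regions
  open Schemes
  open Coding
  open Counting
  open KunzWords

  Small : List ℕ → Set
  Small = All (ℕ._≤ 3)

  small? : Decidable Small
  small? = All.all? (ℕ._≤? 3)

  -- Inequalities that wrap around the modulus are automatic for letters between 1 and 3: the right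
  -- side is at least `1 + 1 + 1`.
  low⇒kunz : ∀ u → All (1 ℕ.≤_) u → Small u →
             (∀ i j → 1 ℕ.≤ i → 1 ℕ.≤ j → i ℕ.+ j ℕ.≤ length u → at u (i ℕ.+ j) ℕ.≤ at u i ℕ.+ at u j) → Kunz u
  low⇒kunz u positive small low {zero} _ {b} b< = subst (λ t → at u t ℕ.≤ at u 0 ℕ.+ at u b ℕ.+ b / modulus u) (sym (m<n⇒m%n≡m b<))
    (ℕ.≤-trans (ℕ.m≤n+m (at u b) (at u 0)) (ℕ.m≤m+n _ (b / modulus u)))
  low⇒kunz u positive small low {suc a} a< {zero} _ = subst (λ t → at u (t % modulus u) ℕ.≤ at u (suc a) ℕ.+ at u 0 ℕ.+ t / modulus u) (sym (ℕ.+-identityʳ (suc a)))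
    (subst (λ t → at u t ℕ.≤ at u (suc a) ℕ.+ at u 0 ℕ.+ suc a / modulus u) (sym (m<n⇒m%n≡m a<)) (ℕ.≤-trans (ℕ.m≤m+n (at u (suc a)) (at u 0)) (ℕ.m≤m+n _ (suc a / modulus u))))
  low⇒kunz u positive small low {suc a} a< {suc b} b< with suc a ℕ.+ suc b ℕ.≤? length u
  ... | yes h = subst (λ t → at u t ℕ.≤ at u (suc a) ℕ.+ at u (suc b) ℕ.+ (suc a ℕ.+ suc b) / modulus u) (sym (m<n⇒m%n≡m (s≤s h)))
    (ℕ.≤-trans (low (suc a) (suc b) (s≤s z≤n) (s≤s z≤n) h) (ℕ.m≤m+n _ _))
  ... | no  h = ℕ.≤-trans (at≤3 _ (residue≤ u (suc a ℕ.+ suc b))) (ℕ.+-mono-≤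
      (ℕ.+-mono-≤ (at-All positive (s≤s z≤n) (ℕ.s≤s⁻¹ a<)) (at-All positive (s≤s z≤n) (ℕ.s≤s⁻¹ b<))) (m≥n⇒m/n>0 {suc a ℕ.+ suc b} {modulus u} (ℕ.≰⇒> h)))
    where
    at≤3 : ∀ i → i ℕ.≤ length u → at u i ℕ.≤ 3
    at≤3 zero    _ = subst (ℕ._≤ 3) (sym (at-0 u)) z≤n
    at≤3 (suc i) h = at-All small (s≤s z≤n) h

  -- Dropping the last letter changes the modulus and with it all wrapping inequalities, but those
  -- are automatic; the others are inherited.
  valid-tail : ∀ x u → Valid (x ∷ u) → Small (x ∷ u) → Valid u
  valid-tail x u (_ ∷ positive , kunz) (_ ∷ small) = positive , low⇒kunz u positive small λ i j _ _ h →
    subst (ℕ._≤ at u i ℕ.+ at u j) (at-init x u h) (subst (at (x ∷ u) (i ℕ.+ j) ℕ.≤_)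
      (cong₂ ℕ._+_ (at-init x u (ℕ.≤-trans (ℕ.m≤m+n i j) h)) (at-init x u (ℕ.≤-trans (ℕ.m≤n+m j i) h)))
      (kunz-low (x ∷ u) kunz i j (ℕ.m≤n⇒m≤1+n h)))

  -- The new inequalities bound the last letter by a sum of two positive letters, which is at least
  -- 2.
  valid-∷ : ∀ x u → 1 ℕ.≤ x → x ℕ.≤ 2 → Valid u → Small u → Valid (x ∷ u)
  valid-∷ x u 1≤x x≤2 (positive , kunz) small = 1≤x ∷ positive , low⇒kunz (x ∷ u) (1≤x ∷ positive) (ℕ.m≤n⇒m≤1+n x≤2 ∷ small) low
    where
    low : ∀ i j → 1 ℕ.≤ i → 1 ℕ.≤ j → i ℕ.+ j ℕ.≤ suc (length u) → at (x ∷ u) (i ℕ.+ j) ℕ.≤ at (x ∷ u) i ℕ.+ at (x ∷ u) j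
    low i j 1≤i 1≤j h with i ℕ.+ j ℕ.≤? length u
    ... | yes h′ = subst (ℕ._≤ at (x ∷ u) i ℕ.+ at (x ∷ u) j) (sym (at-init x u h′)) (subst (at u (i ℕ.+ j) ℕ.≤_)
      (sym (cong₂ ℕ._+_ (at-init x u (ℕ.≤-trans (ℕ.m≤m+n i j) h′)) (at-init x u (ℕ.≤-trans (ℕ.m≤n+m j i) h′)))) (kunz-low u kunz i j h′))
    ... | no ¬h′ = ℕ.≤-trans (ℕ.≤-trans (ℕ.≤-reflexive (at-last x u (ℕ.≤-antisym h (ℕ.≰⇒> ¬h′)))) x≤2)
      (ℕ.+-mono-≤ (at-All (1≤x ∷ positive) 1≤i (ℕ.≤-trans (ℕ.m≤m+n i j) h)) (at-All (1≤x ∷ positive) 1≤j (ℕ.≤-trans (ℕ.m≤n+m j i) h)))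

  Ends3 : List ℕ → Set
  Ends3 u = ∃[ v ] u ≡ 3 ∷ v

  ends3? : Decidable Ends3
  ends3? []      = no λ ()
  ends3? (x ∷ u) = map′ (λ { refl → u , refl }) (λ { (_ , refl) → refl }) (x ℕ.≟ 3)

  -- Each `i + 3 * m` exceeds `f = 3 * m - 1`, so every letter is at most 3; and
  -- `f = (m - 1) + 2 * m` is a gap, so the last letter exceeds 2.
  F≡3m-1⇒ : ∀ u v → F≡3m-1 (fromWord u v) → Small u × Ends3 u
  F≡3m-1⇒ u v (f , m , (f∉ , f-max) , mult , e) with multiplicity-unique {fromWord u v} {fromWord u v} ((λ x → x) , (λ x → x)) mult (fromWord-multiplicity u v)
  F≡3m-1⇒ u v (_ , _ , (f∉ , f-max) , mult , refl) | refl = small , ends u small f∉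
    where
    small : Small u
    small = All-at u λ i _ i≤ → member-residue u i≤ (decidable-stable (member? u (i ℕ.+ 3 ℕ.* modulus u)) λ x∉ →
      ℕ.<⇒≱ (ℕ.≤-trans (ℕ.≤-refl {3 ℕ.* modulus u}) (ℕ.m≤n+m (3 ℕ.* modulus u) i)) (f-max (i ℕ.+ 3 ℕ.* modulus u) x∉))
    ends : ∀ u → Small u → ¬ Member u (length u ℕ.+ 2 ℕ.* modulus u) → Ends3 u
    ends []      _         ∉ = contradiction z≤n ∉
    ends (x ∷ u) (x≤3 ∷ _) ∉ = u , cong (_∷ u) (ℕ.≤-antisym x≤3 (ℕ.≰⇒> λ x≤2 → ∉ (residue-member (x ∷ u) ℕ.≤-refl (subst (ℕ._≤ 2) (sym (at-last x u refl)) x≤2))))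

  ⇒F≡3m-1 : ∀ u v → Small u → Ends3 u → F≡3m-1 (fromWord u v)
  ⇒F≡3m-1 u@(_ ∷ u′) v small (_ , refl) = length u ℕ.+ 2 ℕ.* modulus u , modulus u , (f∉ , f-max) , fromWord-multiplicity u v , refl
    where
    f∉ : ¬ Member u (length u ℕ.+ 2 ℕ.* modulus u)
    f∉ p = contradiction (subst (ℕ._≤ 2) (at-last 3 u′ refl) (member-residue u ℕ.≤-refl p)) λ { (s≤s (s≤s ())) }
    f-max : ∀ x → ¬ Member u x → x ℕ.≤ length u ℕ.+ 2 ℕ.* modulus u
    f-max x x∉ = ℕ.≤-trans (ℕ.≤-reflexive (m≡m%n+[m/n]*n x (modulus u)))
      (ℕ.+-mono-≤ (residue≤ u x) (ℕ.*-monoˡ-≤ (modulus u) (ℕ.s≤s⁻¹ (ℕ.≤-trans (ℕ.≰⇒> x∉) (at≤3 (x % modulus u) (residue≤ u x))))))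
      where
      at≤3 : ∀ i → i ℕ.≤ length u → at u i ℕ.≤ 3
      at≤3 zero    _ = subst (ℕ._≤ 3) (sym (at-0 u)) z≤n
      at≤3 (suc i) h = at-All small (s≤s z≤n) h

  Word : ℕ → List ℕ → Set
  Word g u = Valid u × sum u ≡ g

  word? : ∀ g → Decidable (Word g)
  word? g u = valid? u ×-dec (sum u ℕ.≟ g)

  -- Positive letters of sum `g` form a word of at most `g` letters, none above `g`, so this search
  -- space contains all words of genus `g`.
  enumerate : ∀ {P : List ℕ → Set} → Decidable P → ℕ → List (List ℕ)
  enumerate P? g = deduplicate (List.≡-dec ℕ._≟_) (filter (λ u → word? g u ×-dec P? u) (concatMap (GapLists.words (suc g)) (upTo (suc g))))

  module _ {P : List ℕ → Set} (P? : Decidable P) (g : ℕ) where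

    enumerate-unique : Unique (enumerate P? g)
    enumerate-unique = UniqueDec.deduplicate-! (List.≡-dec ℕ._≟_) (filter (λ u → word? g u ×-dec P? u) (concatMap (GapLists.words (suc g)) (upTo (suc g))))

    enumerate-sound : ∀ {u} → u ∈ enumerate P? g → Word g u × P u
    enumerate-sound u∈ = proj₂ (∈.∈-filter⁻ (λ u → word? g u ×-dec P? u) {xs = concatMap (GapLists.words (suc g)) (upTo (suc g))} (∈.∈-deduplicate⁻ (List.≡-dec ℕ._≟_) _ u∈))

    enumerate-complete : ∀ {u} → Word g u → P u → u ∈ enumerate P? g
    enumerate-complete {u} w@((positive , _) , refl) p = ∈.∈-deduplicate⁺ (List.≡-dec ℕ._≟_) (∈.∈-filter⁺ (λ u → word? g u ×-dec P? u)
      (∈.∈-concatMap⁺ (GapLists.words (suc g)) (Any.map (λ { refl → GapLists.∈-words (suc g) u (All.map s≤s (All≤sum u)) }) (∈.∈-upTo⁺ {suc g} (s≤s (All1⇒length≤sum positive))))) (w , p))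

  every? : Decidable {A = List ℕ} (λ _ → ⊤)
  every? _ = yes tt

  large? : Decidable (λ u → ¬ Small u)
  large? u = ¬? (small? u)

  ending? : Decidable (λ u → Small u × Ends3 u)
  ending? u = small? u ×-dec ends3? u

  -- `codes-bound` is the same number for every scheme, so this bound serves all levels.
  massBound : ℕ → ℚ
  massBound g = ℕ⇒ℚ (suc g) ℚ.* (ℕ⇒ℚ (suc g) ℚ.* (ℕ⇒ℚ (suc g) ℚ.* codes-bound S₃))

  abstract

    smalls larges endings : ℕ → ℕ
    smalls  g = length (enumerate small? g)
    larges  g = length (enumerate large? g)
    endings g = length (enumerate ending? g)

    n≡ : ∀ g → n g ≡ smalls g ℕ.+ larges g
    n≡ g = trans (card-words (λ S → genus S ≡ g) (λ {S} {T} S≋T e → trans (sym (genus-cong {S} {T} S≋T)) e) (genus-finite g)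
        (enumerate-unique every? g)
        (λ u∈ → let ((v , e) , _) = enumerate-sound every? g u∈ in v , trans (genus-fromWord _ v) e)
        (λ u v e → enumerate-complete every? g (v , trans (sym (genus-fromWord u v)) e) tt))
      (trans (ℕ.≤-antisym (length-⊆ (enumerate-unique every? g) split) (length-⊆ unique join)) (List.length-++ (enumerate small? g)))
      where
      unique : Unique (enumerate small? g ++ enumerate large? g)
      unique = Unique.++⁺ (enumerate-unique small? g) (enumerate-unique large? g) λ (p , q) → proj₂ (enumerate-sound large? g q) (proj₂ (enumerate-sound small? g p))
      split : ∀ {u} → u ∈ enumerate every? g → u ∈ enumerate small? g ++ enumerate large? g
      split {u} u∈ with small? u | enumerate-sound every? g u∈
      ... | yes s | w , _ = ∈.∈-++⁺ˡ (enumerate-complete small? g w s)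
      ... | no ¬s | w , _ = ∈.∈-++⁺ʳ (enumerate small? g) (enumerate-complete large? g w ¬s)
      join : ∀ {u} → u ∈ enumerate small? g ++ enumerate large? g → u ∈ enumerate every? g
      join u∈ with ∈.∈-++⁻ (enumerate small? g) u∈
      ... | inj₁ p = enumerate-complete every? g (proj₁ (enumerate-sound small? g p)) tt
      ... | inj₂ p = enumerate-complete every? g (proj₁ (enumerate-sound large? g p)) tt

    c̃≡ : ∀ g → c̃ g ≡ endings g
    c̃≡ g = card-words (λ S → genus S ≡ g × F≡3m-1 S)
      (λ {S} {T} S≋T (e , f) → trans (sym (genus-cong {S} {T} S≋T)) e , Decisions.F≡3m-1-resp {S} {T} S≋T f) (genus∧F≡3m-1-finite g)
      (enumerate-unique ending? g)
      (λ {u} u∈ → let ((v , e) , s , t) = enumerate-sound ending? g u∈ in v , trans (genus-fromWord u v) e , ⇒F≡3m-1 u v s t)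
      (λ u v (e , f) → enumerate-complete ending? g (v , trans (sym (genus-fromWord u v)) e) (F≡3m-1⇒ u v f))

    endings<3 : ∀ g → g ℕ.< 3 → endings g ≡ 0
    endings<3 g g<3 = go (enumerate ending? g) (λ u∈ → enumerate-sound ending? g u∈)
      where
      go : ∀ us → (∀ {u} → u ∈ us → Word g u × Small u × Ends3 u) → length us ≡ 0
      go []       _ = refl
      go (u ∷ us) h with h (here refl)
      ... | (_ , refl) , _ , (v , refl) = contradiction (ℕ.≤-trans (s≤s (ℕ.m≤m+n 3 (sum v))) g<3) (ℕ.1+n≰n)

    smalls-0 : smalls 0 ≡ 1
    smalls-0 = ℕ.≤-antisym (length-⊆ {ys = [] ∷ []} (enumerate-unique small? 0) only) (length-⊆ {xs = [] ∷ []} ([] ∷ []) λ { (here refl) → empty })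
      where
      only : ∀ {u} → u ∈ enumerate small? 0 → u ∈ [] ∷ []
      only {[]}    _  = here refl
      only {x ∷ u} u∈ with enumerate-sound small? 0 u∈
      ... | ((1≤x ∷ _ , _) , e) , _ = contradiction (ℕ.≤-trans 1≤x (ℕ.≤-trans (ℕ.m≤m+n x (sum u)) (ℕ.≤-reflexive e))) λ ()
      empty : [] ∈ enumerate small? 0
      empty = enumerate-complete small? 0 (([] , low⇒kunz [] [] [] λ i j 1≤i _ h → contradiction (ℕ.≤-trans 1≤i (ℕ.≤-trans (ℕ.m≤m+n i j) h)) λ ()) , refl) []

    private
      extend : ∀ g x → 1 ℕ.≤ x → x ℕ.≤ 2 → ∀ {u} → u ∈ map (x ∷_) (enumerate small? g) → u ∈ enumerate small? (x ℕ.+ g)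
      extend g x 1≤x x≤2 u∈ with ∈.∈-map⁻ (x ∷_) u∈
      ... | v , v∈ , refl with enumerate-sound small? g v∈
      ... | (valid , refl) , s = enumerate-complete small? (x ℕ.+ g) (valid-∷ x v 1≤x x≤2 valid s , refl) (ℕ.m≤n⇒m≤1+n x≤2 ∷ s)

      restrict : ∀ g x {u} → x ∷ u ∈ enumerate small? (x ℕ.+ g) → x ∷ u ∈ map (x ∷_) (enumerate small? g)
      restrict g x {u} u∈ with enumerate-sound small? (x ℕ.+ g) u∈
      ... | (valid , e) , s@(_ ∷ s′) = ∈.∈-map⁺ (x ∷_) (enumerate-complete small? g (valid-tail x u valid s , ℕ.+-cancelˡ-≡ x (sum u) g e) s′)

      ending⊆small : ∀ g {u} → u ∈ enumerate ending? g → u ∈ enumerate small? g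
      ending⊆small g u∈ with enumerate-sound ending? g u∈
      ... | w , s , _ = enumerate-complete small? g w s

      map-∷-unique : ∀ x {us : List (List ℕ)} → Unique us → Unique (map (x ∷_) us)
      map-∷-unique x = Unique.map⁺ (λ e → List.∷-injectiveʳ e)

      head≡ : ∀ {x} {us : List (List ℕ)} {u} → u ∈ map (x ∷_) us → ∃[ v ] u ≡ x ∷ v
      head≡ {x} u∈ with ∈.∈-map⁻ (x ∷_) u∈
      ... | v , _ , e = v , e

    -- The recurrence at `g = 1`, where no word ends in 2.
    smalls-1 : smalls 1 ≡ smalls 0 ℕ.+ endings 1
    smalls-1 = trans (ℕ.≤-antisym (length-⊆ (enumerate-unique small? 1) split) (length-⊆ (map-∷-unique 1 (enumerate-unique small? 0)) (extend 0 1 ℕ.≤-refl (s≤s z≤n))))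
      (trans (List.length-map (1 ∷_) (enumerate small? 0)) (sym (trans (cong (smalls 0 ℕ.+_) (endings<3 1 (s≤s (s≤s z≤n)))) (ℕ.+-identityʳ (smalls 0)))))
      where
      split : ∀ {u} → u ∈ enumerate small? 1 → u ∈ map (1 ∷_) (enumerate small? 0)
      split {[]}                  u∈ = contradiction (proj₂ (proj₁ (enumerate-sound small? 1 u∈))) λ ()
      split {zero ∷ u}            u∈ = contradiction (All.head (proj₁ (proj₁ (proj₁ (enumerate-sound small? 1 u∈))))) λ ()
      split {suc zero ∷ u}        u∈ = restrict 0 1 u∈
      split {suc (suc x) ∷ u}     u∈ = contradiction (proj₂ (proj₁ (enumerate-sound small? 1 u∈))) λ ()

    -- Words are sorted by last letter: 1 and 2 can be removed and appended freely, and 3 gives the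
    -- class counted by `endings`.
    smalls-+2 : ∀ g → smalls (2 ℕ.+ g) ≡ smalls (1 ℕ.+ g) ℕ.+ (smalls g ℕ.+ endings (2 ℕ.+ g))
    smalls-+2 g = trans (ℕ.≤-antisym (length-⊆ (enumerate-unique small? (2 ℕ.+ g)) split) (length-⊆ unique join))
      (trans (List.length-++ A) (cong₂ ℕ._+_ (List.length-map (1 ∷_) (enumerate small? (1 ℕ.+ g)))
        (trans (List.length-++ B) (cong (ℕ._+ endings (2 ℕ.+ g)) (List.length-map (2 ∷_) (enumerate small? g))))))
      where
      A B C : List (List ℕ)
      A = map (1 ∷_) (enumerate small? (1 ℕ.+ g))
      B = map (2 ∷_) (enumerate small? g)
      C = enumerate ending? (2 ℕ.+ g)
      unique : Unique (A ++ B ++ C)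
      unique = Unique.++⁺ (map-∷-unique 1 (enumerate-unique small? (1 ℕ.+ g)))
        (Unique.++⁺ (map-∷-unique 2 (enumerate-unique small? g)) (enumerate-unique ending? (2 ℕ.+ g)) B#C) A#BC
        where
        B#C : ∀ {u} → ¬ (u ∈ B × u ∈ C)
        B#C (p , q) with head≡ p | enumerate-sound ending? (2 ℕ.+ g) q
        ... | _ , refl | _ , _ , (_ , ())
        A#BC : ∀ {u} → ¬ (u ∈ A × u ∈ B ++ C)
        A#BC (p , q) with head≡ p | ∈.∈-++⁻ B q
        ... | _ , refl | inj₁ q′ = contradiction (head≡ q′) λ { (_ , ()) }
        ... | _ , refl | inj₂ q′ = contradiction (proj₂ (proj₂ (enumerate-sound ending? (2 ℕ.+ g) q′))) λ { (_ , ()) }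
      split : ∀ {u} → u ∈ enumerate small? (2 ℕ.+ g) → u ∈ A ++ B ++ C
      split {[]}                  u∈ = contradiction (proj₂ (proj₁ (enumerate-sound small? (2 ℕ.+ g) u∈))) λ ()
      split {zero ∷ u}            u∈ = contradiction (All.head (proj₁ (proj₁ (proj₁ (enumerate-sound small? (2 ℕ.+ g) u∈))))) λ ()
      split {suc zero ∷ u}        u∈ = ∈.∈-++⁺ˡ (restrict (1 ℕ.+ g) 1 u∈)
      split {suc (suc zero) ∷ u}  u∈ = ∈.∈-++⁺ʳ A (∈.∈-++⁺ˡ (restrict g 2 u∈))
      split {suc (suc (suc zero)) ∷ u} u∈ with enumerate-sound small? (2 ℕ.+ g) u∈
      ... | w , s = ∈.∈-++⁺ʳ A (∈.∈-++⁺ʳ B (enumerate-complete ending? (2 ℕ.+ g) w (s , u , refl)))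
      split {suc (suc (suc (suc x))) ∷ u} u∈ = contradiction (All.head (proj₂ (enumerate-sound small? (2 ℕ.+ g) u∈))) λ { (s≤s (s≤s (s≤s ()))) }
      join : ∀ {u} → u ∈ A ++ B ++ C → u ∈ enumerate small? (2 ℕ.+ g)
      join u∈ with ∈.∈-++⁻ A u∈
      ... | inj₁ p = extend (1 ℕ.+ g) 1 ℕ.≤-refl (s≤s z≤n) p
      ... | inj₂ q with ∈.∈-++⁻ B q
      ... | inj₁ p = extend g 2 (s≤s z≤n) ℕ.≤-refl p
      ... | inj₂ p = ending⊆small (2 ℕ.+ g) p

    endings-bound : ∀ g → ℕ⇒ℚ (endings g) ℚ.* pow r g ℚ.≤ massBound g
    endings-bound g = count-words S₃ 3 g (enumerate-unique ending? g) λ u∈ → encode (enumerate-sound ending? g u∈)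
      where
      encode : ∀ {u} → Word g u × Small u × Ends3 u → All (1 ℕ.≤_) u × sum u ≡ g × Encoded S₃ 3 u
      encode (((positive , kunz) , e) , small , (v , refl)) = positive , e , encoded₃ v positive small kunz

    length-split : ∀ {A : Set} {P : A → Set} (P? : Decidable P) xs → length xs ≡ length (filter P? xs) ℕ.+ length (filter (λ x → ¬? (P? x)) xs)
    length-split P? []       = refl
    length-split P? (x ∷ xs) with P? x
    ... | yes _ = cong suc (length-split P? xs)
    ... | no  _ = trans (cong suc (length-split P? xs)) (sym (ℕ.+-suc (length (filter P? xs)) _))

    -- Three classes by largest letter: at least 6, equal to 5, equal to 4. Each costs one
    -- `massBound`.
    larges-bound : ∀ g → ℕ⇒ℚ (larges g) ℚ.* pow r g ℚ.≤ massBound g ℚ.+ (massBound g ℚ.+ massBound g)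
    larges-bound g = ℚ.≤-trans (ℚ.≤-reflexive (trans
        (cong (λ t → ℕ⇒ℚ t ℚ.* pow r g) (trans (length-split six? xs) (cong (length xs₆ ℕ.+_) (length-split five? ys))))
        (trans (expand (length xs₆) (length xs₅ ℕ.+ length xs₄)) (cong (ℕ⇒ℚ (length xs₆) ℚ.* pow r g ℚ.+_) (expand (length xs₅) (length xs₄))))))
      (ℚ.+-mono-≤ (count-words (S₆ g) 6 g (Unique.filter⁺ six? uniq) encode₆)
        (ℚ.+-mono-≤ (count-words S₅ 5 g (Unique.filter⁺ five? uniq′) encode₅) (count-words S₄ 4 g (Unique.filter⁺ (λ u → ¬? (five? u)) uniq′) encode₄)))
      where
      six? : Decidable (Any (6 ℕ.≤_))
      six? = Any.any? (6 ℕ.≤?_)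
      five? : Decidable (Any (5 ℕ.≤_))
      five? = Any.any? (5 ℕ.≤?_)
      xs ys xs₆ xs₅ xs₄ : List (List ℕ)
      xs  = enumerate large? g
      ys  = filter (λ u → ¬? (six? u)) xs
      xs₆ = filter six? xs
      xs₅ = filter five? ys
      xs₄ = filter (λ u → ¬? (five? u)) ys
      uniq : Unique xs
      uniq = enumerate-unique large? g
      uniq′ : Unique ys
      uniq′ = Unique.filter⁺ (λ u → ¬? (six? u)) uniq
      expand : ∀ a b → ℕ⇒ℚ (a ℕ.+ b) ℚ.* pow r g ≡ ℕ⇒ℚ a ℚ.* pow r g ℚ.+ ℕ⇒ℚ b ℚ.* pow r g
      expand a b = trans (cong (ℚ._* pow r g) (ℕ⇒ℚ-Lemmas.ℕ⇒ℚ-+ a b)) (ℚ.*-distribʳ-+ (pow r g) (ℕ⇒ℚ a) (ℕ⇒ℚ b))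
      none⇒All : ∀ {k u} → ¬ Any (suc k ℕ.≤_) u → All (ℕ._≤ k) u
      none⇒All ¬a = All.map (λ ¬p → ℕ.s≤s⁻¹ (ℕ.≰⇒> ¬p)) (Allₚ.¬Any⇒All¬ _ ¬a)
      notSmall⇒Any : ∀ {u} → ¬ Small u → Any (4 ℕ.≤_) u
      notSmall⇒Any {u} ¬s = Any.map ℕ.≰⇒> (Allₚ.¬All⇒Any¬ (ℕ._≤? 3) u ¬s)
      encode₆ : ∀ {u} → u ∈ xs₆ → All (1 ℕ.≤_) u × sum u ≡ g × Encoded (S₆ g) 6 u
      encode₆ u∈ with ∈.∈-filter⁻ six? {xs = xs} u∈
      ... | u∈xs , any with enumerate-sound large? g u∈xs
      ... | ((positive , kunz) , refl) , _ = positive , refl , encoded₆ positive any kunz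
      encode₅ : ∀ {u} → u ∈ xs₅ → All (1 ℕ.≤_) u × sum u ≡ g × Encoded S₅ 5 u
      encode₅ u∈ with ∈.∈-filter⁻ five? {xs = ys} u∈
      ... | u∈ys , any with ∈.∈-filter⁻ (λ u → ¬? (six? u)) {xs = xs} u∈ys
      ... | u∈xs , ¬six with enumerate-sound large? g u∈xs
      ... | ((positive , kunz) , e) , _ = positive , e , encoded₅ positive (none⇒All ¬six) any kunz
      encode₄ : ∀ {u} → u ∈ xs₄ → All (1 ℕ.≤_) u × sum u ≡ g × Encoded S₄ 4 u
      encode₄ u∈ with ∈.∈-filter⁻ (λ u → ¬? (five? u)) {xs = ys} u∈
      ... | u∈ys , ¬five with enumerate-sound large? g (proj₁ (∈.∈-filter⁻ (λ u → ¬? (six? u)) {xs = xs} u∈ys))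
      ... | ((positive , kunz) , e) , ¬s = positive , e , encoded₄ positive (none⇒All ¬five) (notSmall⇒Any ¬s) kunz

open import Defs

-- Null sequences, asymptotic bounds on representatives, and geometric convergence.

module Sequences where

  open ℚLemmas

  open RationalLemmas

  Eventually : (ℕ → Set) → Set
  Eventually P = ∃[ N ] ∀ i → N ℕ.≤ i → P i

  both : ∀ {P Q R : ℕ → Set} → (∀ {i} → P i → Q i → R i) → Eventually P → Eventually Q → Eventually R
  both f (M , p) (N , q) = M ℕ.⊔ N , λ i i≥ → f (p i (ℕ.m⊔n≤o⇒m≤o M N i≥)) (q i (ℕ.m⊔n≤o⇒n≤o M N i≥))

  record Null (f : ℕ → ℚ) : Set where
    constructor null
    field
      eventually< : ∀ ε → 0ℚ ℚ.< ε → Eventually (λ i → ‖ f i ‖ ℚ.< ε)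

  open Null

  -- An upper bound on the absolute value of a real, stated on representatives so that rational
  -- identities mixing several Cauchy sequences apply directly.
  record Limsup≤ (f : ℕ → ℚ) (b : ℚ) : Set where
    constructor limsup
    field
      eventually≤ : ∀ ε → 0ℚ ℚ.< ε → Eventually (λ i → ‖ f i ‖ ℚ.≤ b ℚ.+ ε)

  open Limsup≤

  Bounded : (ℕ → ℚ) → Set
  Bounded f = ∃[ B ] 0ℚ ℚ.< B × Eventually (λ i → ‖ f i ‖ ℚ.≤ B)

  real-bounded : ∀ x → Bounded (ℝ.seq x)
  real-bounded = Boundedness.bounded

  null-≡ : ∀ {f h : ℕ → ℚ} → (∀ i → f i ≡ h i) → Null f → Null h
  null-≡ e p = null λ ε 0<ε → let (N , q) = eventually< p ε 0<ε in N , λ i i≥ → subst (λ t → ‖ t ‖ ℚ.< ε) (e i) (q i i≥)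

  null-0 : ∀ {f : ℕ → ℚ} → (∀ i → f i ≡ 0ℚ) → Null f
  null-0 e = null λ ε 0<ε → 0 , λ i _ → subst (λ t → ‖ t ‖ ℚ.< ε) (sym (e i)) 0<ε

  null-+ : ∀ {f h : ℕ → ℚ} → Null f → Null h → Null (λ i → f i ℚ.+ h i)
  null-+ p q = null λ ε 0<ε → both (‖p+q‖<ε) (eventually< p (ε ℚ.* ½) (half-pos 0<ε)) (eventually< q (ε ℚ.* ½) (half-pos 0<ε))

  null-* : ∀ {f h : ℕ → ℚ} → Bounded f → Null h → Null (λ i → f i ℚ.* h i)
  null-* (B , 0<B , bound) q = null λ ε 0<ε → both (‖p*q‖<ε B 0<B) bound (eventually< q (ε ℚ.* recip B 0<B) (pos* 0<ε (recip-pos B 0<B)))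

  limsup-null : ∀ {f : ℕ → ℚ} → Null f → Limsup≤ f 0ℚ
  limsup-null p = limsup λ ε 0<ε → let (N , q) = eventually< p ε 0<ε in N , λ i i≥ → ℚ.≤-trans (ℚ.<⇒≤ (q i i≥)) (ℚ.≤-reflexive (sym (ℚ.+-identityˡ ε)))

  limsup-eventually : ∀ {f : ℕ → ℚ} {b} → Eventually (λ i → ‖ f i ‖ ℚ.≤ b) → Limsup≤ f b
  limsup-eventually {b = b} (N , p) = limsup λ ε 0<ε → N , λ i i≥ → ℚ.≤-trans (p i i≥) (subst (ℚ._≤ b ℚ.+ ε) (ℚ.+-identityʳ b) (ℚ.+-monoʳ-≤ b (ℚ.<⇒≤ 0<ε)))

  limsup-≡ : ∀ {f h : ℕ → ℚ} {b} → (∀ i → f i ≡ h i) → Limsup≤ f b → Limsup≤ h b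
  limsup-≡ {b = b} e p = limsup λ ε 0<ε → let (N , q) = eventually≤ p ε 0<ε in N , λ i i≥ → subst (λ t → ‖ t ‖ ℚ.≤ b ℚ.+ ε) (e i) (q i i≥)

  limsup-mono : ∀ {f : ℕ → ℚ} {b c} → b ℚ.≤ c → Limsup≤ f b → Limsup≤ f c
  limsup-mono b≤c p = limsup λ ε 0<ε → let (N , q) = eventually≤ p ε 0<ε in N , λ i i≥ → ℚ.≤-trans (q i i≥) (ℚ.+-monoˡ-≤ ε b≤c)

  limsup-+ : ∀ {f h : ℕ → ℚ} {b c} → Limsup≤ f b → Limsup≤ h c → Limsup≤ (λ i → f i ℚ.+ h i) (b ℚ.+ c)
  limsup-+ {f} {h} {b} {c} p q = limsup λ ε 0<ε → both
    (λ {i} u v → ℚ.≤-trans (ℚ.∣p+q∣≤∣p∣+∣q∣ (f i) (h i)) (ℚ.≤-trans (ℚ.+-mono-≤ u v)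
      (ℚ.≤-reflexive (trans (solve 3 (λ b c e → (b :+ e) :+ (c :+ e) := (b :+ c) :+ (e :+ e)) refl b c (ε ℚ.* ½)) (cong (b ℚ.+ c ℚ.+_) (half+half ε))))))
    (eventually≤ p (ε ℚ.* ½) (half-pos 0<ε)) (eventually≤ q (ε ℚ.* ½) (half-pos 0<ε))
    where open +-*-Solver

  limsup-* : ∀ {f w : ℕ → ℚ} {b c} → 0ℚ ℚ.≤ b → c ℚ.≤ 1ℚ → Eventually (λ i → ‖ w i ‖ ℚ.≤ c) → Limsup≤ f b → Limsup≤ (λ i → w i ℚ.* f i) (c ℚ.* b)
  limsup-* {f} {w} {b} {c} 0≤b c≤1 small p = limsup λ ε 0<ε → both
    (λ {i} u v → ℚ.≤-trans (ℚ.≤-reflexive (ℚ.∣p*q∣≡∣p∣*∣q∣ (w i) (f i))) (ℚ.≤-trans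
      (*-mono-≤-nonNeg (ℚ.0≤∣p∣ (w i)) (+-nonNeg 0≤b (ℚ.<⇒≤ 0<ε)) u v)
      (ℚ.≤-trans (ℚ.≤-reflexive (ℚ.*-distribˡ-+ c b ε)) (ℚ.+-monoʳ-≤ (c ℚ.* b) (*≤1 (ℚ.<⇒≤ 0<ε) c≤1)))))
    small (eventually≤ p ε 0<ε)

  y : ℚ
  y = ℤ.+ 2000 ℚ./ 2001

  0≤y : 0ℚ ℚ.≤ y
  0≤y = from-yes (0ℚ ℚ.≤? y)

  y≤1 : y ℚ.≤ 1ℚ
  y≤1 = from-yes (y ℚ.≤? 1ℚ)

  -- Y = 1 / (1 - y)
  Y : ℚ
  Y = ℤ.+ 2001 ℚ./ 1

  pow-y≤1 : ∀ k → pow y k ℚ.≤ 1ℚ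
  pow-y≤1 k = pow-antitone 0≤y y≤1 {0} {k} z≤n

  -- `(k + 1) * y^k` is at most `1 + y + ... + y^k`, hence at most `Y`; the induction uses
  -- `y * Y + 1 = Y`.
  linear*pow : ∀ k → ℕ⇒ℚ (suc k) ℚ.* pow y k ℚ.≤ Y
  linear*pow zero    = from-yes (ℕ⇒ℚ 1 ℚ.* 1ℚ ℚ.≤? Y)
  linear*pow (suc k) = ℚ.≤-trans (ℚ.≤-reflexive (solve 3 (λ n y p → (con 1ℚ :+ n) :* (y :* p) := y :* (n :* p) :+ y :* p) refl (ℕ⇒ℚ (suc k)) y (pow y k)))
    (ℚ.≤-trans (ℚ.+-mono-≤ (*-monoˡ y 0≤y (linear*pow k)) (pow-y≤1 (suc k))) (from-yes (y ℚ.* Y ℚ.+ 1ℚ ℚ.≤? Y)))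
    where open +-*-Solver

  -- By `linear*pow`, `y^g` is at most `Y / (g + 1)`, so the Archimedean property supplies `G`.
  pow-y-small : ∀ K ε → 0ℚ ℚ.≤ K → 0ℚ ℚ.< ε → ∃[ G ] ∀ g → G ℕ.≤ g → K ℚ.* pow y g ℚ.≤ ε
  pow-y-small K ε 0≤K 0<ε = let (G , large) = ℕ⇒ℚ-Lemmas.archimedean (K ℚ.* Y ℚ.* recip ε 0<ε) in G , λ g g≥ →
    ℚ.*-cancelˡ-≤-pos (ℕ⇒ℚ (suc g)) {{ℚ.positive (ℕ⇒ℚ-Positivity.0<ℕ⇒ℚ g)}} (begin
      ℕ⇒ℚ (suc g) ℚ.* (K ℚ.* pow y g)      ≡⟨ solve 3 (λ n k p → n :* (k :* p) := k :* (n :* p)) refl (ℕ⇒ℚ (suc g)) K (pow y g) ⟩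
      K ℚ.* (ℕ⇒ℚ (suc g) ℚ.* pow y g)      ≤⟨ *-monoˡ K 0≤K (linear*pow g) ⟩
      K ℚ.* Y                              ≡⟨ ℚ.*-identityʳ (K ℚ.* Y) ⟨
      K ℚ.* Y ℚ.* 1ℚ                       ≡⟨ cong (K ℚ.* Y ℚ.*_) (trans (ℚ.*-comm (recip ε 0<ε) ε) (*-recip ε 0<ε)) ⟨
      K ℚ.* Y ℚ.* (recip ε 0<ε ℚ.* ε)      ≡⟨ ℚ.*-assoc (K ℚ.* Y) (recip ε 0<ε) ε ⟨
      K ℚ.* Y ℚ.* recip ε 0<ε ℚ.* ε        ≤⟨ *-monoʳ ε (ℚ.<⇒≤ 0<ε) (ℚ.≤-trans large (ℕ⇒ℚ-Lemmas.ℕ⇒ℚ-mono-≤ (ℕ.m≤n⇒m≤1+n g≥))) ⟩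
      ℕ⇒ℚ (suc g) ℚ.* ε                    ∎)
    where
    open ℚ.≤-Reasoning
    open +-*-Solver

  -- A positive real `ε` is eventually at least a rational `δ`: a quarter of `δ` covers `K * y^g`, a
  -- quarter the slack in `Limsup≤`, and the remaining half witnesses strictness.
  geometric-convergence : ∀ (x : ℕ → ℝ) ℓ K → 0ℚ ℚ.≤ K →
    (∀ g → Limsup≤ (λ i → ℝ.seq (x g) i ℚ.- ℝ.seq ℓ i) (K ℚ.* pow y g)) → x ⟶ ℓ
  geometric-convergence x ℓ K 0≤K bound ε (δ , 0<δ , N , low) =
    let (G , small) = pow-y-small K (δ ℚ.* ½ ℚ.* ½) 0≤K (half-pos (half-pos 0<δ)) in
    G , λ g g≥ → δ ℚ.* ½ , half-pos 0<δ , both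
      (λ {i} u v → ℚ.≤-trans (ℚ.+-monoˡ-≤ (δ ℚ.* ½) (ℚ.≤-trans v (ℚ.≤-trans (ℚ.+-monoˡ-≤ (δ ℚ.* ½ ℚ.* ½) (small g g≥)) (ℚ.≤-reflexive (half+half (δ ℚ.* ½))))))
        (ℚ.≤-trans (ℚ.≤-reflexive (trans (half+half δ) (sym (ℚ.+-identityˡ δ)))) u))
      (N , low) (eventually≤ (bound g) (δ ℚ.* ½ ℚ.* ½) (half-pos (half-pos 0<δ)))

-- Convergence of the series beyond 1/ω.

module Limit where

  open ℚLemmas
  open Regions using (r)
  open Schemes using (codes-bound)
  open Counting using (S₃)
  open Enumeration
  open Sequences

  open RationalLemmas

  -- Three of the factors y absorb the cubic growth of massBound, the fourth
  -- leaves the geometric decay y^g; still r₁ > 1/ω.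
  r₁ : ℚ
  r₁ = r ℚ.* (y ℚ.* (y ℚ.* (y ℚ.* y)))

  K : ℚ
  K = Y ℚ.* (Y ℚ.* (Y ℚ.* codes-bound S₃))

  massBound-pow : ∀ g → massBound g ℚ.* pow (y ℚ.* (y ℚ.* (y ℚ.* y))) g ℚ.≤ K ℚ.* pow y g
  massBound-pow g = begin
    massBound g ℚ.* pow (y ℚ.* (y ℚ.* (y ℚ.* y))) g
      ≡⟨ cong (massBound g ℚ.*_) (trans (pow-* y (y ℚ.* (y ℚ.* y)) g) (cong (p ℚ.*_) (trans (pow-* y (y ℚ.* y) g) (cong (p ℚ.*_) (pow-* y y g))))) ⟩
    massBound g ℚ.* (p ℚ.* (p ℚ.* (p ℚ.* p)))
      ≡⟨ solve 3 (λ n c p → (n :* (n :* (n :* c))) :* (p :* (p :* (p :* p))) := ((n :* p) :* ((n :* p) :* ((n :* p) :* c))) :* p) refl N (codes-bound S₃) p ⟩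
    (N ℚ.* p) ℚ.* ((N ℚ.* p) ℚ.* ((N ℚ.* p) ℚ.* codes-bound S₃)) ℚ.* p
      ≤⟨ *-monoʳ p 0≤p (*-mono-≤-nonNeg 0≤Np (from-yes (0ℚ ℚ.≤? Y ℚ.* (Y ℚ.* codes-bound S₃))) Np≤Y
           (*-mono-≤-nonNeg 0≤Np (from-yes (0ℚ ℚ.≤? Y ℚ.* codes-bound S₃)) Np≤Y (*-monoʳ (codes-bound S₃) (from-yes (0ℚ ℚ.≤? codes-bound S₃)) Np≤Y))) ⟩
    K ℚ.* p ∎
    where
    open ℚ.≤-Reasoning
    open +-*-Solver
    N p : ℚ
    N = ℕ⇒ℚ (suc g)
    p = pow y g
    0≤p : 0ℚ ℚ.≤ p
    0≤p = pow-nonNeg 0≤y g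
    0≤Np : 0ℚ ℚ.≤ N ℚ.* p
    0≤Np = *-nonNeg (ℕ⇒ℚ-Positivity.0≤ℕ⇒ℚ (suc g)) 0≤p
    Np≤Y : N ℚ.* p ℚ.≤ Y
    Np≤Y = linear*pow g

  shrink : ∀ a {b c} g → a ℚ.* pow r g ℚ.≤ b → b ℚ.* pow (y ℚ.* (y ℚ.* (y ℚ.* y))) g ℚ.≤ c → a ℚ.* pow r₁ g ℚ.≤ c
  shrink a g h h′ = ℚ.≤-trans (ℚ.≤-reflexive (trans (cong (a ℚ.*_) (pow-* r (y ℚ.* (y ℚ.* (y ℚ.* y))) g)) (sym (ℚ.*-assoc a (pow r g) _))))
    (ℚ.≤-trans (*-monoʳ _ (pow-nonNeg (from-yes (0ℚ ℚ.≤? y ℚ.* (y ℚ.* (y ℚ.* y)))) g) h) h′)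

  endings-r₁ : ∀ g → ℕ⇒ℚ (endings g) ℚ.* pow r₁ g ℚ.≤ K ℚ.* pow y g
  endings-r₁ g = shrink (ℕ⇒ℚ (endings g)) g (endings-bound g) (massBound-pow g)

  larges-r₁ : ∀ g → ℕ⇒ℚ (larges g) ℚ.* pow r₁ g ℚ.≤ (K ℚ.+ (K ℚ.+ K)) ℚ.* pow y g
  larges-r₁ g = shrink (ℕ⇒ℚ (larges g)) g (larges-bound g) (ℚ.≤-trans
    (ℚ.≤-reflexive (solve 2 (λ m q → (m :+ (m :+ m)) :* q := m :* q :+ (m :* q :+ m :* q)) refl (massBound g) (pow (y ℚ.* (y ℚ.* (y ℚ.* y))) g)))
    (ℚ.≤-trans (ℚ.+-mono-≤ (massBound-pow g) (ℚ.+-mono-≤ (massBound-pow g) (massBound-pow g)))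
      (ℚ.≤-reflexive (solve 2 (λ k p → k :* p :+ (k :* p :+ k :* p) := (k :+ (k :+ k)) :* p) refl K (pow y g)))))
    where open +-*-Solver

  0≤q-p : ∀ {p q} → p ℚ.≤ q → 0ℚ ℚ.≤ q ℚ.- p
  0≤q-p {p} {q} p≤q = subst (ℚ._≤ q ℚ.- p) (ℚ.+-inverseʳ p) (ℚ.+-monoˡ-≤ (ℚ.- p) p≤q)

  psum : ℚ → ℕ → ℚ
  psum ρ zero    = 0ℚ
  psum ρ (suc k) = psum ρ k ℚ.+ ℕ⇒ℚ (endings k) ℚ.* pow ρ k

  InDisc : ℚ → Set
  InDisc ρ = 0ℚ ℚ.≤ ρ × ρ ℚ.≤ r₁

  count*pow≤ : ∀ {ρ} → InDisc ρ → ∀ a k → ℕ⇒ℚ a ℚ.* pow ρ k ℚ.≤ ℕ⇒ℚ a ℚ.* pow r₁ k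
  count*pow≤ (0≤ρ , ρ≤) a k = *-monoˡ (ℕ⇒ℚ a) (ℕ⇒ℚ-Positivity.0≤ℕ⇒ℚ a) (pow-mono 0≤ρ ρ≤ k)

  -- The partial sum plus the geometric tail bound `K * Y * y^k` does not increase with `k`, since
  -- `1 + Y * y = Y`. The tail bound does not involve `ρ`, so it is uniform on the disc.
  psum-upper : ∀ {ρ} → InDisc ρ → ∀ k d → psum ρ (d ℕ.+ k) ℚ.+ K ℚ.* Y ℚ.* pow y (d ℕ.+ k) ℚ.≤ psum ρ k ℚ.+ K ℚ.* Y ℚ.* pow y k
  psum-upper     in-disc k zero    = ℚ.≤-refl
  psum-upper {ρ} in-disc k (suc d) = ℚ.≤-trans (begin
    psum ρ m ℚ.+ ℕ⇒ℚ (endings m) ℚ.* pow ρ m ℚ.+ K ℚ.* Y ℚ.* (y ℚ.* pow y m)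
      ≤⟨ ℚ.+-monoˡ-≤ _ (ℚ.+-monoʳ-≤ (psum ρ m) (ℚ.≤-trans (count*pow≤ in-disc (endings m) m) (endings-r₁ m))) ⟩
    psum ρ m ℚ.+ K ℚ.* pow y m ℚ.+ K ℚ.* Y ℚ.* (y ℚ.* pow y m)
      ≡⟨ solve 5 (λ s k Y y p → s :+ k :* p :+ k :* Y :* (y :* p) := s :+ k :* (con 1ℚ :+ Y :* y) :* p) refl (psum ρ m) K Y y (pow y m) ⟩
    psum ρ m ℚ.+ K ℚ.* (1ℚ ℚ.+ Y ℚ.* y) ℚ.* pow y m
      ≡⟨ refl ⟩
    psum ρ m ℚ.+ K ℚ.* Y ℚ.* pow y m ∎) (psum-upper in-disc k d)
    where
    open ℚ.≤-Reasoning
    open +-*-Solver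
    m : ℕ
    m = d ℕ.+ k

  psum-lower : ∀ {ρ} → InDisc ρ → ∀ k d → psum ρ k ℚ.≤ psum ρ (d ℕ.+ k)
  psum-lower     in-disc k zero    = ℚ.≤-refl
  psum-lower {ρ} in-disc k (suc d) = ℚ.≤-trans (psum-lower in-disc k d)
    (subst (ℚ._≤ psum ρ (d ℕ.+ k) ℚ.+ ℕ⇒ℚ (endings (d ℕ.+ k)) ℚ.* pow ρ (d ℕ.+ k)) (ℚ.+-identityʳ (psum ρ (d ℕ.+ k)))
      (ℚ.+-monoʳ-≤ (psum ρ (d ℕ.+ k)) (*-nonNeg (ℕ⇒ℚ-Positivity.0≤ℕ⇒ℚ (endings (d ℕ.+ k))) (pow-nonNeg (proj₁ in-disc) (d ℕ.+ k)))))

  psum-tail : ∀ {ρ} → InDisc ρ → ∀ {k l} → k ℕ.≤ l → ‖ psum ρ k ℚ.- psum ρ l ‖ ℚ.≤ K ℚ.* Y ℚ.* pow y k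
  psum-tail {ρ} in-disc {k} {l} k≤l = subst (λ l → ‖ psum ρ k ℚ.- psum ρ l ‖ ℚ.≤ K ℚ.* Y ℚ.* pow y k) (ℕ.m∸n+n≡m k≤l) (main (l ℕ.∸ k))
    where
    main : ∀ d → ‖ psum ρ k ℚ.- psum ρ (d ℕ.+ k) ‖ ℚ.≤ K ℚ.* Y ℚ.* pow y k
    main d = subst (ℚ._≤ K ℚ.* Y ℚ.* pow y k) (‖-‖-swap (psum ρ (d ℕ.+ k)) (psum ρ k))
      (subst (ℚ._≤ K ℚ.* Y ℚ.* pow y k) (sym (ℚ.0≤p⇒∣p∣≡p (0≤q-p (psum-lower in-disc k d))))
        (p-q≤r (ℚ.≤-trans (subst (ℚ._≤ psum ρ (d ℕ.+ k) ℚ.+ K ℚ.* Y ℚ.* pow y (d ℕ.+ k)) (ℚ.+-identityʳ (psum ρ (d ℕ.+ k)))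
          (ℚ.+-monoʳ-≤ (psum ρ (d ℕ.+ k)) (*-nonNeg (from-yes (0ℚ ℚ.≤? K ℚ.* Y)) (pow-nonNeg 0≤y (d ℕ.+ k))))) (psum-upper in-disc k d))))

  seq-^ : ∀ x k i → ℝ.seq (x ^ k) i ≡ pow (ℝ.seq x i) k
  seq-^ x zero    i = refl
  seq-^ x (suc k) i = cong (ℝ.seq x i ℚ.*_) (seq-^ x k i)

  -- A word ending in 3 has sum at least 3, so `endings` agrees with the zero coefficients below 3.
  seq-C̃ : ∀ k i → ℝ.seq (C̃ k) i ≡ ℕ⇒ℚ (endings k)
  seq-C̃ 0 i = cong ℕ⇒ℚ (sym (endings<3 0 (s≤s z≤n)))
  seq-C̃ 1 i = cong ℕ⇒ℚ (sym (endings<3 1 (s≤s (s≤s z≤n))))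
  seq-C̃ 2 i = cong ℕ⇒ℚ (sym (endings<3 2 (s≤s (s≤s (s≤s z≤n)))))
  seq-C̃ (suc (suc (suc k))) i = cong ℕ⇒ℚ (c̃≡ (suc (suc (suc k))))

  seq-partialSum : ∀ z k i → ℝ.seq (partialSum (λ k → C̃ k * z ^ k) k) i ≡ psum (ℝ.seq z i) k
  seq-partialSum z zero    i = refl
  seq-partialSum z (suc k) i = cong₂ ℚ._+_ (seq-partialSum z k i) (cong₂ ℚ._*_ (seq-C̃ k i) (seq-^ z k i))

  module _ (z : ℝ) (in-disc : Eventually (λ i → InDisc (ℝ.seq z i))) where

    -- On the diagonal, argument and truncation vary together. Both terms are compared with the
    -- truncation at a fixed `G`: tails are uniformly small, and the truncated sum is itself a real,
    -- hence Cauchy.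
    value-cauchy : Cauchy (λ i → psum (ℝ.seq z i) i)
    value-cauchy ε 0<ε = M , λ i j i≥ j≥ → subst (λ t → ‖ t ‖ ℚ.< ε)
        (solve 4 (λ a b c d → ((:- (b :- a)) :+ (d :- c)) :+ (b :- d) := a :- c) refl (psum (z′ i) i) (psum (z′ i) G) (psum (z′ j) j) (psum (z′ j) G))
        (‖p+q‖<ε {ℚ.- (psum (z′ i) G ℚ.- psum (z′ i) i) ℚ.+ (psum (z′ j) G ℚ.- psum (z′ j) j)} {psum (z′ i) G ℚ.- psum (z′ j) G}
          (ℚ.≤-<-trans (ℚ.∣p+q∣≤∣p∣+∣q∣ (ℚ.- (psum (z′ i) G ℚ.- psum (z′ i) i)) (psum (z′ j) G ℚ.- psum (z′ j) j)) (tails i j i≥ j≥)) (middle i j i≥ j≥))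
      where
      open +-*-Solver
      z′ : ℕ → ℚ
      z′ = ℝ.seq z
      -- Two tails of at most `ε/8` stay below `ε/2`; the difference of the truncated sums takes the
      -- other half.
      η : ℚ
      η = ε ℚ.* ½ ℚ.* ½ ℚ.* ½
      choice : ∃[ G ] ∀ g → G ℕ.≤ g → K ℚ.* Y ℚ.* pow y g ℚ.≤ η
      choice = pow-y-small (K ℚ.* Y) η (from-yes (0ℚ ℚ.≤? K ℚ.* Y)) (half-pos (half-pos (half-pos 0<ε)))
      G : ℕ
      G = proj₁ choice
      finite : Cauchy (ℝ.seq (partialSum (λ k → C̃ k * z ^ k) G))
      finite = ℝ.cauchy (partialSum (λ k → C̃ k * z ^ k) G)
      M₁ M₂ M : ℕ
      M₁ = proj₁ in-disc
      M₂ = proj₁ (finite (ε ℚ.* ½) (half-pos 0<ε))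
      M = G ℕ.⊔ (M₁ ℕ.⊔ M₂)
      ≥G : ∀ {i} → M ℕ.≤ i → G ℕ.≤ i
      ≥G = ℕ.m⊔n≤o⇒m≤o G (M₁ ℕ.⊔ M₂)
      ≥M₁ : ∀ {i} → M ℕ.≤ i → M₁ ℕ.≤ i
      ≥M₁ h = ℕ.m⊔n≤o⇒m≤o M₁ M₂ (ℕ.m⊔n≤o⇒n≤o G (M₁ ℕ.⊔ M₂) h)
      ≥M₂ : ∀ {i} → M ℕ.≤ i → M₂ ℕ.≤ i
      ≥M₂ h = ℕ.m⊔n≤o⇒n≤o M₁ M₂ (ℕ.m⊔n≤o⇒n≤o G (M₁ ℕ.⊔ M₂) h)
      tail : ∀ i → M ℕ.≤ i → ‖ psum (z′ i) G ℚ.- psum (z′ i) i ‖ ℚ.≤ η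
      tail i i≥ = ℚ.≤-trans (psum-tail (proj₂ in-disc i (≥M₁ i≥)) (≥G i≥)) (proj₂ choice G ℕ.≤-refl)
      tails : ∀ i j → M ℕ.≤ i → M ℕ.≤ j → ‖ ℚ.- (psum (z′ i) G ℚ.- psum (z′ i) i) ‖ ℚ.+ ‖ psum (z′ j) G ℚ.- psum (z′ j) j ‖ ℚ.< ε ℚ.* ½
      tails i j i≥ j≥ = ℚ.≤-<-trans (ℚ.+-mono-≤ (ℚ.≤-trans (ℚ.≤-reflexive (ℚ.∣-p∣≡∣p∣ (psum (z′ i) G ℚ.- psum (z′ i) i))) (tail i i≥)) (tail j j≥))
        (subst (ℚ._< ε ℚ.* ½) (sym (half+half (ε ℚ.* ½ ℚ.* ½))) (half< (half-pos 0<ε)))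
        where
        half< : ∀ {e} → 0ℚ ℚ.< e → e ℚ.* ½ ℚ.< e
        half< {e} 0<e = subst (e ℚ.* ½ ℚ.<_) (half+half e) (subst (ℚ._< e ℚ.* ½ ℚ.+ e ℚ.* ½) (ℚ.+-identityʳ (e ℚ.* ½)) (ℚ.+-monoʳ-< (e ℚ.* ½) (half-pos 0<e)))
      middle : ∀ i j → M ℕ.≤ i → M ℕ.≤ j → ‖ psum (z′ i) G ℚ.- psum (z′ j) G ‖ ℚ.< ε ℚ.* ½
      middle i j i≥ j≥ = subst (λ t → ‖ t ‖ ℚ.< ε ℚ.* ½) (cong₂ ℚ._-_ (seq-partialSum z G i) (seq-partialSum z G j))
        (proj₂ (finite (ε ℚ.* ½) (half-pos 0<ε)) i j (≥M₂ i≥) (≥M₂ j≥))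

    value : ℝ
    value = mkℝ (λ i → psum (ℝ.seq z i) i) value-cauchy

    value-limsup : ∀ k → Limsup≤ (λ i → psum (ℝ.seq z i) k ℚ.- psum (ℝ.seq z i) i) (K ℚ.* Y ℚ.* pow y k)
    value-limsup k = limsup-eventually {b = K ℚ.* Y ℚ.* pow y k} (both (λ d k≤i → psum-tail d k≤i) in-disc (k , λ i i≥ → i≥))

    hasSum : C̃ at z HasSum value
    hasSum = geometric-convergence (partialSum (λ k → C̃ k * z ^ k)) value (K ℚ.* Y) (from-yes (0ℚ ℚ.≤? K ℚ.* Y))
      (λ k → limsup-≡ {b = K ℚ.* Y ℚ.* pow y k} (λ i → cong (ℚ._- psum (ℝ.seq z i) i) (sym (seq-partialSum z k i))) (value-limsup k))

-- The golden ratio and the limit of n(g)/ω^g.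

module GoldenRatio where

  open ℚLemmas
  open Enumeration
  open Sequences
  open Limit

  open RationalLemmas
  open InvLemmas

  s ω′ z A : ℕ → ℚ
  s  = √-seq 5
  ω′ = ℝ.seq ω
  z  = ℝ.seq ω⁻¹
  A  = ℝ.seq ((fromℕ 5 + √ 5) / fromℕ 10 [ fromℕ-nonzero 9 ])

  0<ω : ∀ i → 0ℚ ℚ.< ω′ i
  0<ω i = pos* (ℚ.+-mono-<-≤ (from-yes (0ℚ ℚ.<? 1ℚ)) (√-Lemmas.0≤√ 5 i)) (from-yes (0ℚ ℚ.<? ½))

  -- Exact at every index: all terms representing `ω` are positive, so `inv` is a true inverse.
  ωz≡1 : ∀ i → ω′ i ℚ.* z i ≡ 1ℚ
  ωz≡1 i = inv-inverse (ω′ i) (λ e → ℚ.<⇒≢ (0<ω i) (sym e))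

  0<z : ∀ i → 0ℚ ℚ.< z i
  0<z i = ℚ.*-cancelˡ-<-nonNeg (ω′ i) {{ℚ.nonNegative (ℚ.<⇒≤ (0<ω i))}}
    (subst (ℚ._< ω′ i ℚ.* z i) (sym (ℚ.*-zeroʳ (ω′ i))) (subst (0ℚ ℚ.<_) (sym (ωz≡1 i)) (from-yes (0ℚ ℚ.<? 1ℚ))))

  inv-pow : ∀ i g → inv (pow (ω′ i) g) ≡ pow (z i) g
  inv-pow i g = begin-equality
    inv W                       ≡⟨ ℚ.*-identityʳ (inv W) ⟨
    inv W ℚ.* 1ℚ                ≡⟨ cong (inv W ℚ.*_) W*Z ⟨
    inv W ℚ.* (W ℚ.* Z)         ≡⟨ solve 3 (λ v w z → v :* (w :* z) := (w :* v) :* z) refl (inv W) W Z ⟩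
    (W ℚ.* inv W) ℚ.* Z         ≡⟨ cong (ℚ._* Z) (inv-inverse W W≢0) ⟩
    1ℚ ℚ.* Z                    ≡⟨ ℚ.*-identityˡ Z ⟩
    Z                           ∎
    where
    open ℚ.≤-Reasoning
    open +-*-Solver
    W Z : ℚ
    W = pow (ω′ i) g
    Z = pow (z i) g
    pow-1 : ∀ k → pow 1ℚ k ≡ 1ℚ
    pow-1 zero    = refl
    pow-1 (suc k) = trans (ℚ.*-identityˡ (pow 1ℚ k)) (pow-1 k)
    W*Z : W ℚ.* Z ≡ 1ℚ
    W*Z = trans (sym (pow-* (ω′ i) (z i) g)) (trans (cong (λ t → pow t g) (ωz≡1 i)) (pow-1 g))
    W≢0 : W ≢ 0ℚ
    W≢0 e = ℚ.<⇒≢ (from-yes (0ℚ ℚ.<? 1ℚ)) (trans (sym (ℚ.*-zeroˡ Z)) (trans (cong (ℚ._* Z) (sym e)) W*Z))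

  η : ℕ → ℚ
  η i = z i ℚ.+ z i ℚ.* z i ℚ.- 1ℚ

  private
    5ℚ ¼ ⅖ ⅕ ⅒ 2ℚ : ℚ
    5ℚ = ℕ⇒ℚ 5
    ¼ = ℤ.+ 1 ℚ./ 4
    ⅖ = ℤ.+ 2 ℚ./ 5
    ⅕ = ℤ.+ 1 ℚ./ 5
    ⅒ = ℤ.+ 1 ℚ./ 10
    2ℚ = ℤ.+ 2 ℚ./ 1

    defect : ∀ i → ω′ i ℚ.* z i ℚ.- 1ℚ ≡ 0ℚ
    defect i = cong (ℚ._- 1ℚ) (ωz≡1 i)

    zero-product : ∀ p {q} → q ≡ 0ℚ → p ℚ.* q ≡ 0ℚ
    zero-product p refl = ℚ.*-zeroʳ p

  -- Put `d = ω z - 1`. As `ω² = ω + 1 + (s² - 5)/4`, expanding `(ω z)² = (1 + d)²` gives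
  -- `η = (2 + d - z) d - z² (s² - 5)/4`, where `d` vanishes exactly.
  null-η : Null η
  null-η = null-≡ (λ i → sym (identity i)) (null-+
      (null-0 (λ i → zero-product (2ℚ ℚ.+ (ω′ i ℚ.* z i ℚ.- 1ℚ) ℚ.- z i) (defect i)))
      (null-* (real-bounded (fromℚ (ℚ.- ¼) * (ω⁻¹ * ω⁻¹))) (null (√-square 5))))
    where
    open +-*-Solver
    identity : ∀ i → η i ≡ (2ℚ ℚ.+ (ω′ i ℚ.* z i ℚ.- 1ℚ) ℚ.- z i) ℚ.* (ω′ i ℚ.* z i ℚ.- 1ℚ) ℚ.+ (ℚ.- ¼ ℚ.* (z i ℚ.* z i)) ℚ.* (s i ℚ.* s i ℚ.- 5ℚ)
    identity i = solve 2 (λ s z → let a = ((con 1ℚ :+ s) :* con ½) :* z :- con 1ℚ in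
      z :+ z :* z :- con 1ℚ := (con 2ℚ :+ a :- z) :* a :+ (con (ℚ.- ¼) :* (z :* z)) :* (s :* s :- con 5ℚ)) refl (s i) (z i)

  -- The constant `(5 + √5)/10 = (ω + 2)/5` is `1/(1 + z²)` at `z = 1/ω`; the identity comes from
  -- `ω z = 1` and `z² = 1 - z + η`.
  null-A : Null (λ i → A i ℚ.* (1ℚ ℚ.+ z i ℚ.* z i) ℚ.- 1ℚ)
  null-A = null-≡ (λ i → sym (identity i)) (null-+
      (null-0 (λ i → zero-product (⅖ ℚ.* (1ℚ ℚ.+ z i) ℚ.- ⅕) (defect i)))
      (null-* (real-bounded ((fromℕ 5 + √ 5) / fromℕ 10 [ fromℕ-nonzero 9 ] + fromℚ (ℚ.- ⅖) * ω)) null-η))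
    where
    open +-*-Solver
    identity : ∀ i → A i ℚ.* (1ℚ ℚ.+ z i ℚ.* z i) ℚ.- 1ℚ ≡
      (⅖ ℚ.* (1ℚ ℚ.+ z i) ℚ.- ⅕) ℚ.* (ω′ i ℚ.* z i ℚ.- 1ℚ) ℚ.+ (A i ℚ.+ ℚ.- ⅖ ℚ.* ω′ i) ℚ.* η i
    identity i = solve 2 (λ s z → let w = (con 1ℚ :+ s) :* con ½ ; A = (con 5ℚ :+ s) :* con ⅒ in
      A :* (con 1ℚ :+ z :* z) :- con 1ℚ :=
      (con ⅖ :* (con 1ℚ :+ z) :- con ⅕) :* (w :* z :- con 1ℚ) :+ (A :+ con (ℚ.- ⅖) :* w) :* (z :+ z :* z :- con 1ℚ)) refl (s i) (z i)

  -- 1/ω < ζ < r₁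
  ζ : ℚ
  ζ = ℤ.+ 2000 ℚ./ 3233

  z≤ζ : Eventually (λ i → z i ℚ.≤ ζ)
  z≤ζ = let (N , small) = ℕ⇒ℚ-Lemmas.δ-small 1/1000 (from-yes (0ℚ ℚ.<? 1/1000)) in N , λ i i≥ → bound i (small i i≥)
    where
    -- `ζ` is the reciprocal of `(1 + σ)/2`, and `σ` stays below √5 even after adding 1/1000, which
    -- covers `δ i` in `5 < (s i + δ i)²`.
    1/1000 σ : ℚ
    1/1000 = ℤ.+ 1 ℚ./ 1000
    σ = ℤ.+ 2233 ℚ./ 1000
    bound : ∀ i → ℕ⇒ℚ-Lemmas.δ i ℚ.< 1/1000 → z i ℚ.≤ ζ
    bound i δ< = begin
      z i                                  ≡⟨ ℚ.*-identityˡ (z i) ⟨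
      1ℚ ℚ.* z i                           ≡⟨ refl ⟩
      (ζ ℚ.* ((1ℚ ℚ.+ σ) ℚ.* ½)) ℚ.* z i   ≤⟨ *-monoʳ (z i) (ℚ.<⇒≤ (0<z i)) (*-monoˡ ζ (from-yes (0ℚ ℚ.≤? ζ)) (*-monoʳ ½ (from-yes (0ℚ ℚ.≤? ½)) (ℚ.+-monoʳ-≤ 1ℚ σ≤s))) ⟩
      (ζ ℚ.* ω′ i) ℚ.* z i                 ≡⟨ ℚ.*-assoc ζ (ω′ i) (z i) ⟩
      ζ ℚ.* (ω′ i ℚ.* z i)                 ≡⟨ cong (ζ ℚ.*_) (ωz≡1 i) ⟩
      ζ ℚ.* 1ℚ                             ≡⟨ ℚ.*-identityʳ ζ ⟩
      ζ                                    ∎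
      where
      open ℚ.≤-Reasoning
      σ≤s : σ ℚ.≤ s i
      σ≤s = ℚ.≮⇒≥ λ s<σ → ℚ<⇒≱ (√-Lemmas.k<√+δ² 5 i) (ℚ.≤-trans
        (square-mono (+-nonNeg (√-Lemmas.0≤√ 5 i) (ℚ.<⇒≤ (ℕ⇒ℚ-Lemmas.0<δ i))) (ℚ.<⇒≤ (ℚ.+-mono-< s<σ δ<)))
        (from-yes ((σ ℚ.+ 1/1000) ℚ.* (σ ℚ.+ 1/1000) ℚ.≤? 5ℚ)))

  z-in-disc : Eventually (λ i → InDisc (z i))
  z-in-disc = let (N , p) = z≤ζ in N , λ i i≥ → ℚ.<⇒≤ (0<z i) , ℚ.≤-trans (p i i≥) (from-yes (ζ ℚ.≤? r₁))

  -- The factor ½ makes the error recursion for `term` contract, and the factor `y` makes it do so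
  -- relative to `y^g`.
  z²-small : Eventually (λ i → ‖ ℚ.- (z i ℚ.* z i) ‖ ℚ.≤ ½ ℚ.* y)
  z²-small = let (N , p) = z≤ζ in N , λ i i≥ → ℚ.≤-trans
    (ℚ.≤-reflexive (trans (ℚ.∣-p∣≡∣p∣ (z i ℚ.* z i)) (ℚ.0≤p⇒∣p∣≡p (*-nonNeg (ℚ.<⇒≤ (0<z i)) (ℚ.<⇒≤ (0<z i))))))
    (ℚ.≤-trans (square-mono (ℚ.<⇒≤ (0<z i)) (p i i≥)) (from-yes (ζ ℚ.* ζ ℚ.≤? ½ ℚ.* y)))

  ω⁻¹<r₁ : ω⁻¹ < fromℚ r₁
  ω⁻¹<r₁ = r₁ ℚ.- ζ , from-yes (0ℚ ℚ.<? r₁ ℚ.- ζ) , proj₁ z≤ζ , λ i i≥ →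
    ℚ.≤-trans (ℚ.+-monoˡ-≤ (r₁ ℚ.- ζ) (proj₂ z≤ζ i i≥)) (from-yes (ζ ℚ.+ (r₁ ℚ.- ζ) ℚ.≤? r₁))

  C̃-value : ℝ
  C̃-value = value ω⁻¹ z-in-disc

  L : ℕ → ℚ
  L   = ℝ.seq (((fromℕ 5 + √ 5) / fromℕ 10 [ fromℕ-nonzero 9 ]) * (fromℕ 1 + C̃-value))

  term : ℕ → ℕ → ℚ
  term g i = ℕ⇒ℚ (smalls g) ℚ.* pow (z i) g

  bounded-term : ∀ a k → Bounded (λ i → ℕ⇒ℚ a ℚ.* pow (z i) k)
  bounded-term a k = let (B , 0<B , N , p) = real-bounded (fromℕ a * ω⁻¹ ^ k) in
    B , 0<B , N , λ i i≥ → subst (λ t → ‖ ℕ⇒ℚ a ℚ.* t ‖ ℚ.≤ B) (seq-^ ω⁻¹ k i) (p i i≥)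

  -- The error in `T(g+1) z^(g+1) + z² T(g) z^g = 1 + Σ c̃(j) z^j`, the sum running to `j = g + 1`.
  residue : ℕ → ℕ → ℚ
  residue g i = term (suc g) i ℚ.+ z i ℚ.* z i ℚ.* term g i ℚ.- (1ℚ ℚ.+ psum (z i) (2 ℕ.+ g))

  -- By the recurrence for `smalls`, passing from `g` to `g + 1` adds `T(g+1) z^(g+1) η`, which is
  -- null.
  null-residue : ∀ g → Null (residue g)
  null-residue zero = null-≡ (λ i → sym (start (z i) (ℕ⇒ℚ (smalls 1)) (ℕ⇒ℚ (smalls 0)) (ℕ⇒ℚ (endings 0)) (ℕ⇒ℚ (endings 1))
      (cong ℕ⇒ℚ (trans smalls-1 (cong₂ ℕ._+_ smalls-0 (endings<3 1 (s≤s (s≤s z≤n)))))) (cong ℕ⇒ℚ smalls-0)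
      (cong ℕ⇒ℚ (endings<3 0 (s≤s z≤n))) (cong ℕ⇒ℚ (endings<3 1 (s≤s (s≤s z≤n)))))) null-η
    where
    open +-*-Solver
    start : ∀ z T₁ T₀ e₀ e₁ → T₁ ≡ 1ℚ → T₀ ≡ 1ℚ → e₀ ≡ 0ℚ → e₁ ≡ 0ℚ →
      T₁ ℚ.* (z ℚ.* 1ℚ) ℚ.+ z ℚ.* z ℚ.* (T₀ ℚ.* 1ℚ) ℚ.- (1ℚ ℚ.+ (0ℚ ℚ.+ e₀ ℚ.* 1ℚ ℚ.+ e₁ ℚ.* (z ℚ.* 1ℚ))) ≡ z ℚ.+ z ℚ.* z ℚ.- 1ℚ
    start z _ _ _ _ refl refl refl refl = solve 1 (λ z →
      con 1ℚ :* (z :* con 1ℚ) :+ z :* z :* (con 1ℚ :* con 1ℚ) :- (con 1ℚ :+ (con 0ℚ :+ con 0ℚ :* con 1ℚ :+ con 0ℚ :* (z :* con 1ℚ))) := z :+ z :* z :- con 1ℚ) refl z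
  null-residue (suc g) = null-≡ (λ i → sym (step i)) (null-+ (null-residue g) (null-* (bounded-term (smalls (suc g)) (suc g)) null-η))
    where
    open +-*-Solver
    count : ℕ⇒ℚ (smalls (2 ℕ.+ g)) ≡ ℕ⇒ℚ (smalls (1 ℕ.+ g)) ℚ.+ (ℕ⇒ℚ (smalls g) ℚ.+ ℕ⇒ℚ (endings (2 ℕ.+ g)))
    count = trans (cong ℕ⇒ℚ (smalls-+2 g)) (trans (ℕ⇒ℚ-Lemmas.ℕ⇒ℚ-+ (smalls (1 ℕ.+ g)) (smalls g ℕ.+ endings (2 ℕ.+ g)))
      (cong (ℕ⇒ℚ (smalls (1 ℕ.+ g)) ℚ.+_) (ℕ⇒ℚ-Lemmas.ℕ⇒ℚ-+ (smalls g) (endings (2 ℕ.+ g)))))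
    step : ∀ i → residue (suc g) i ≡ residue g i ℚ.+ (ℕ⇒ℚ (smalls (suc g)) ℚ.* pow (z i) (suc g)) ℚ.* η i
    step i = trans
      (cong (λ T → T ℚ.* (z i ℚ.* (z i ℚ.* p)) ℚ.+ z i ℚ.* z i ℚ.* (T₁ ℚ.* (z i ℚ.* p)) ℚ.- (1ℚ ℚ.+ (σ ℚ.+ e ℚ.* (z i ℚ.* (z i ℚ.* p))))) count)
      (solve 6 (λ z p σ T₁ T₀ e →
        (T₁ :+ (T₀ :+ e)) :* (z :* (z :* p)) :+ z :* z :* (T₁ :* (z :* p)) :- (con 1ℚ :+ (σ :+ e :* (z :* (z :* p)))) :=
        (T₁ :* (z :* p) :+ z :* z :* (T₀ :* p) :- (con 1ℚ :+ σ)) :+ (T₁ :* (z :* p)) :* (z :+ z :* z :- con 1ℚ)) refl (z i) p σ T₁ T₀ e)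
      where
      p σ T₁ T₀ e : ℚ
      p = pow (z i) g
      σ = psum (z i) (2 ℕ.+ g)
      T₁ = ℕ⇒ℚ (smalls (suc g))
      T₀ = ℕ⇒ℚ (smalls g)
      e = ℕ⇒ℚ (endings (2 ℕ.+ g))

  initial : Bounded (λ i → term 0 i ℚ.- L i)
  initial = real-bounded (fromℕ (smalls 0) * ω⁻¹ ^ 0 - ((fromℕ 5 + √ 5) / fromℕ 10 [ fromℕ-nonzero 9 ]) * (fromℕ 1 + C̃-value))

  -- `B` dominates the initial error and satisfies `KY + B/2 ≤ B`, which closes the induction in
  -- `smalls-limsup`.
  KY B : ℚ
  KY = K ℚ.* Y
  B  = KY ℚ.+ KY ℚ.+ proj₁ initial

  0≤KY : 0ℚ ℚ.≤ KY
  0≤KY = from-yes (0ℚ ℚ.≤? KY)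

  0≤B : 0ℚ ℚ.≤ B
  0≤B = +-nonNeg (+-nonNeg 0≤KY 0≤KY) (ℚ.<⇒≤ (proj₁ (proj₂ initial)))

  -- For `E g = term g - L` the residue identity gives `E (g+1) = - z² E g` plus a tail of the
  -- series and null terms. The tail is at most `KY * y^(g+2)` and `z² ≤ y/2`, so `B * y^g` is
  -- preserved as a bound.
  smalls-limsup : ∀ g → Limsup≤ (λ i → term g i ℚ.- L i) (B ℚ.* pow y g)
  smalls-limsup zero = limsup-eventually {b = B ℚ.* 1ℚ} (proj₁ (proj₂ (proj₂ initial)) , λ i i≥ → ℚ.≤-trans (proj₂ (proj₂ (proj₂ initial)) i i≥)
    (ℚ.≤-trans (subst (ℚ._≤ B) (ℚ.+-identityˡ (proj₁ initial)) (ℚ.+-monoˡ-≤ (proj₁ initial) (+-nonNeg 0≤KY 0≤KY))) (ℚ.≤-reflexive (sym (ℚ.*-identityʳ B)))))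
  smalls-limsup (suc g) = limsup-mono {c = B ℚ.* pow y (suc g)} total (limsup-≡ {b = bound} (λ i → sym (step i))
    (limsup-+ (limsup-null (null-+ (null-residue g) (null-* (real-bounded (- (fromℕ 1 + C̃-value))) null-A)))
      (limsup-+ (value-limsup ω⁻¹ z-in-disc (2 ℕ.+ g))
        (limsup-* (*-nonNeg 0≤B (pow-nonNeg 0≤y g)) (from-yes (½ ℚ.* y ℚ.≤? 1ℚ)) z²-small (smalls-limsup g)))))
    where
    open +-*-Solver
    bound : ℚ
    bound = 0ℚ ℚ.+ (KY ℚ.* pow y (2 ℕ.+ g) ℚ.+ ½ ℚ.* y ℚ.* (B ℚ.* pow y g))
    step : ∀ i → term (suc g) i ℚ.- L i ≡
      (residue g i ℚ.+ ℚ.- (1ℚ ℚ.+ psum (z i) i) ℚ.* (A i ℚ.* (1ℚ ℚ.+ z i ℚ.* z i) ℚ.- 1ℚ)) ℚ.+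
      ((psum (z i) (2 ℕ.+ g) ℚ.- psum (z i) i) ℚ.+ ℚ.- (z i ℚ.* z i) ℚ.* (term g i ℚ.- L i))
    step i = solve 6 (λ z t₁ t₀ σ v A →
      t₁ :- A :* (con 1ℚ :+ v) :=
      ((t₁ :+ z :* z :* t₀ :- (con 1ℚ :+ σ)) :+ :- (con 1ℚ :+ v) :* (A :* (con 1ℚ :+ z :* z) :- con 1ℚ)) :+
      ((σ :- v) :+ :- (z :* z) :* (t₀ :- A :* (con 1ℚ :+ v)))) refl (z i) (term (suc g) i) (term g i) (psum (z i) (2 ℕ.+ g)) (psum (z i) i) (A i)
    total : bound ℚ.≤ B ℚ.* pow y (suc g)
    total = ℚ.≤-trans (ℚ.≤-reflexive (solve 4 (λ k y p b → con 0ℚ :+ (k :* (y :* (y :* p)) :+ con ½ :* y :* ((k :+ k :+ b) :* p)) :=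
        (y :* k :+ (k :+ b :* con ½)) :* (y :* p)) refl KY y (pow y g) b₀))
      (*-monoʳ (pow y (suc g)) (pow-nonNeg 0≤y (suc g)) (ℚ.≤-trans (ℚ.+-mono-≤ (*≤1 0≤KY y≤1) (ℚ.+-monoʳ-≤ KY half≤)) (ℚ.≤-reflexive (sym (ℚ.+-assoc KY KY b₀)))))
      where
      b₀ : ℚ
      b₀ = proj₁ initial
      half≤ : b₀ ℚ.* ½ ℚ.≤ b₀
      half≤ = subst (b₀ ℚ.* ½ ℚ.≤_) (ℚ.*-identityʳ b₀) (*-monoˡ b₀ (ℚ.<⇒≤ (proj₁ (proj₂ initial))) (from-yes (½ ℚ.≤? 1ℚ)))

  larges-limsup : ∀ g → Limsup≤ (λ i → ℕ⇒ℚ (larges g) ℚ.* pow (z i) g) ((K ℚ.+ (K ℚ.+ K)) ℚ.* pow y g)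
  larges-limsup g = limsup-eventually {b = (K ℚ.+ (K ℚ.+ K)) ℚ.* pow y g} (let (N , p) = z-in-disc in N , λ i i≥ →
    ℚ.≤-trans (ℚ.≤-reflexive (ℚ.0≤p⇒∣p∣≡p (*-nonNeg (ℕ⇒ℚ-Positivity.0≤ℕ⇒ℚ (larges g)) (pow-nonNeg (proj₁ (p i i≥)) g))))
      (ℚ.≤-trans (count*pow≤ (p i i≥) (larges g) g) (larges-r₁ g)))

  growth : (λ g → fromℕ (n g) / ω ^ g [ ω^-nonzero g ]) ⟶ ((fromℕ 5 + √ 5) / fromℕ 10 [ fromℕ-nonzero 9 ]) * (fromℕ 1 + C̃-value)
  growth = geometric-convergence (λ g → fromℕ (n g) / ω ^ g [ ω^-nonzero g ]) (((fromℕ 5 + √ 5) / fromℕ 10 [ fromℕ-nonzero 9 ]) * (fromℕ 1 + C̃-value))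
    (B ℚ.+ (K ℚ.+ (K ℚ.+ K))) (+-nonNeg 0≤B (from-yes (0ℚ ℚ.≤? K ℚ.+ (K ℚ.+ K))))
    λ g → limsup-mono {c = (B ℚ.+ (K ℚ.+ (K ℚ.+ K))) ℚ.* pow y g} (ℚ.≤-reflexive (sym (ℚ.*-distribʳ-+ (pow y g) B (K ℚ.+ (K ℚ.+ K)))))
      (limsup-≡ {b = B ℚ.* pow y g ℚ.+ (K ℚ.+ (K ℚ.+ K)) ℚ.* pow y g} (λ i → sym (split g i)) (limsup-+ (smalls-limsup g) (larges-limsup g)))
    where
    open +-*-Solver
    split : ∀ g i → ℕ⇒ℚ (n g) ℚ.* inv (ℝ.seq (ω ^ g) i) ℚ.- L i ≡ (term g i ℚ.- L i) ℚ.+ ℕ⇒ℚ (larges g) ℚ.* pow (z i) g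
    split g i = trans (cong (ℚ._- L i) (cong₂ ℚ._*_ (trans (cong ℕ⇒ℚ (n≡ g)) (ℕ⇒ℚ-Lemmas.ℕ⇒ℚ-+ (smalls g) (larges g))) (trans (cong inv (seq-^ ω g i)) (inv-pow i g))))
      (solve 4 (λ a b p l → (a :+ b) :* p :- l := (a :* p :- l) :+ b :* p) refl (ℕ⇒ℚ (smalls g)) (ℕ⇒ℚ (larges g)) (pow (z i) g) (L i))

open Sequences
open Limit
open GoldenRatio

theorem1p1 : (ω⁻¹ <radius C̃) ×
    (∃[ s ] (C̃ at ω⁻¹ HasSum s) ×
    ((λ g → fromℕ (n g) / ω ^ g [ ω^-nonzero g ]) ⟶
    ((fromℕ 5 + √ 5) / fromℕ 10 [ fromℕ-nonzero 9 ]) * (fromℕ 1 + s)))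
theorem1p1 =
  -- The witness for the radius is the rational `r₁`, at which the bound on `endings` was proved.
  (fromℚ r₁ , (nonneg , value (fromℚ r₁) disc , hasSum (fromℚ r₁) disc) , ω⁻¹<r₁) ,
  C̃-value , hasSum ω⁻¹ z-in-disc , growth
  where
  0≤r₁ : 0ℚ ℚ.≤ r₁
  0≤r₁ = from-yes (0ℚ ℚ.≤? r₁)
  disc : Eventually (λ i → InDisc r₁)
  disc = 0 , λ _ _ → 0≤r₁ , ℚ.≤-refl
  nonneg : fromℕ 0 ≤ fromℚ r₁
  nonneg (ε , 0<ε , N , p) = RationalLemmas.ℚ<⇒≱ (ℚ.+-mono-≤-< 0≤r₁ 0<ε) (p N ℕ.≤-refl)
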